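{- Let $n \in \mathbb{N}$ be odd and let $\mathbf{u} = (u_1,u_2,u_3) \in \mathbb{Z}^3$, with all $u_i \neq 0$, be a solution to $$\frac{4}{n} = \frac{1}{u_1} + \frac{1}{u_2} + \frac{1}{u_3}$$ which is not a natural number solution (that is, at least one $u_i$ is negative). Then $$\prod_{p \mid n} (-u_1/u_3, -u_2/u_3)_p = 1,$$ where the product is over the primes $p$ dividing $n$.
   Context: $\mathbb{N}$ denotes the positive integers. For a prime $p$ and $a,b \in \mathbb{Q}_p^*$, $(a,b)_p \in \{\pm 1\}$ denotes the Hilbert symbol: it is $1$ if $z^2 = ax^2+by^2$ has a non-trivial solution in $\mathbb{Q}_p$, and $-1$ otherwise. An empty product equals $1$. -}

module Defs where

open import Data.Nat.Base as ℕ using (ℕ; suc; _≤_; _⊔_; _^_)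
import Data.Nat.Properties as ℕ
open import Data.Nat.Divisibility using (_∣_; _∤_; _∣?_; quotient; quotient-<; quotient≢0;
  m∣n⇒n≡m*quotient; ∣1⇒≡1)
open import Data.Nat.Induction using (<-rec)
open import Data.Nat.Primality
  using (Prime; prime?; euclidsLemma; prime⇒nonTrivial; ¬prime[1])
open import Data.Integer.Base as ℤ using (ℤ; +_; 0ℤ; 1ℤ)
import Data.Integer.Properties as ℤ
open import Data.Integer.Solver using (module +-*-Solver)
open import Data.Rational.Unnormalised.Base as ℚ
  using (ℚᵘ; mkℚᵘ; ↥_; ↧_; ↧ₙ_; _/_; _≃_; *≡*; 0ℚᵘ)
import Data.Rational.Unnormalised.Properties as ℚ
import Data.Rational.Unnormalised.Solver as ℚSolver
open import Data.Sign.Base as Sign using (Sign)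
open import Data.List.Base using (List; filter; foldr; map; upTo)
open import Data.Product.Base using (∃₂; ∃-syntax; _×_; _,_)
open import Data.Sum.Base using ([_,_]′)
open import Relation.Nullary using (¬_; contradiction; yes; no)
open import Relation.Nullary.Decidable using (_×-dec_)
open import Relation.Binary.PropositionalEquality

primeDivisors : ℕ → List ℕ
primeDivisors n = filter (λ p → prime? p ×-dec p ∣? n) (upTo (suc n))

∏[_]_ : List ℕ → (ℕ → Sign) → Sign
∏[ ps ] f = foldr Sign._*_ Sign.+ (map f ps)

fromℤ : ℤ → ℚᵘ
fromℤ i = i / 1

-- The field ℚ_p, as the completion of ℚ for the p-adic absolute value.

module Padic (p : ℕ) (p-prime : Prime p) where

  infix  4 ∣_∣≤p^-_ _≈_
  infixl 7 _*_
  infixl 6 _+_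

  -- |q|_p ≤ p^(-k), that is, q = p^k · (a / b) for integers a, b with p ∤ b.
  record ∣_∣≤p^-_ (q : ℚᵘ) (k : ℕ) : Set where
    constructor small
    field
      a   : ℤ
      b   : ℕ
      p∤b : p ∤ b
      eq  : ↥ q ℤ.* + b ≡ + (p ^ k) ℤ.* a ℤ.* ↧ q

  record ℚₚ : Set where
    field
      seq    : ℕ → ℚᵘ
      cauchy : ∀ k → ∃[ N ] ∀ i j → N ≤ i → N ≤ j → ∣ seq i ℚ.- seq j ∣≤p^- k

  open ℚₚ public

  -- Equality in the completion: the difference tends to 0 p-adically.
  _≈_ : ℚₚ → ℚₚ → Set
  x ≈ y = ∀ k → ∃[ N ] ∀ i → N ≤ i → ∣ seq x i ℚ.- seq y i ∣≤p^- k

  ∤-* : ∀ {b c} → p ∤ b → p ∤ c → p ∤ b ℕ.* c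
  ∤-* {b} {c} p∤b p∤c p∣bc = [ p∤b , p∤c ]′ (euclidsLemma b c p-prime p∣bc)

  p∤1 : p ∤ 1
  p∤1 p∣1 = ¬prime[1] (subst Prime (∣1⇒≡1 p∣1) p-prime)

  small-≃ : ∀ {k q r} → q ≃ r → ∣ q ∣≤p^- k → ∣ r ∣≤p^- k
  small-≃ {k} {q@record{}} {r@record{}} (*≡* q≃r) (small a b p∤b eq) =
    small a b p∤b (ℤ.*-cancelʳ-≡ _ _ (↧ q) (begin
      ↥ r ℤ.* + b ℤ.* ↧ q               ≡⟨ swap (↥ r) (+ b) (↧ q) ⟩
      ↥ r ℤ.* ↧ q ℤ.* + b               ≡⟨ cong (ℤ._* + b) q≃r ⟨
      ↥ q ℤ.* ↧ r ℤ.* + b               ≡⟨ swap (↥ q) (↧ r) (+ b) ⟩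
      ↥ q ℤ.* + b ℤ.* ↧ r               ≡⟨ cong (ℤ._* ↧ r) eq ⟩
      + (p ^ k) ℤ.* a ℤ.* ↧ q ℤ.* ↧ r   ≡⟨ swap (+ (p ^ k) ℤ.* a) (↧ q) (↧ r) ⟩
      + (p ^ k) ℤ.* a ℤ.* ↧ r ℤ.* ↧ q   ∎))
    where
    open ≡-Reasoning
    swap : ∀ x y z → x ℤ.* y ℤ.* z ≡ x ℤ.* z ℤ.* y
    swap = solve 3 (λ x y z → x :* y :* z := x :* z :* y) refl
      where
      open +-*-Solver

  small-0 : ∀ k → ∣ 0ℚᵘ ∣≤p^- k
  small-0 k = small 0ℤ 1 p∤1 (sym (trans (ℤ.*-identityʳ _) (ℤ.*-zeroʳ (+ (p ^ k)))))

  small-+ : ∀ {k q r} → ∣ q ∣≤p^- k → ∣ r ∣≤p^- k → ∣ q ℚ.+ r ∣≤p^- k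
  small-+ {k} {q@record{}} {r@record{}} (small a b p∤b eq) (small c d p∤d eq′) =
    small (a ℤ.* + d ℤ.+ c ℤ.* + b) (b ℕ.* d) (∤-* p∤b p∤d) (begin
      (↥ q ℤ.* ↧ r ℤ.+ ↥ r ℤ.* ↧ q) ℤ.* + (b ℕ.* d)
        ≡⟨ cong ((↥ q ℤ.* ↧ r ℤ.+ ↥ r ℤ.* ↧ q) ℤ.*_) (ℤ.pos-* b d) ⟩
      (↥ q ℤ.* ↧ r ℤ.+ ↥ r ℤ.* ↧ q) ℤ.* (+ b ℤ.* + d)
        ≡⟨ solve 6 (λ n m n′ m′ b d →
             (n :* m′ :+ n′ :* m) :* (b :* d) :=
             n :* b :* (m′ :* d) :+ n′ :* d :* (m :* b))
           refl (↥ q) (↧ q) (↥ r) (↧ r) (+ b) (+ d) ⟩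
      ↥ q ℤ.* + b ℤ.* (↧ r ℤ.* + d) ℤ.+ ↥ r ℤ.* + d ℤ.* (↧ q ℤ.* + b)
        ≡⟨ cong₂ (λ s t → s ℤ.* (↧ r ℤ.* + d) ℤ.+ t ℤ.* (↧ q ℤ.* + b)) eq eq′ ⟩
      + (p ^ k) ℤ.* a ℤ.* ↧ q ℤ.* (↧ r ℤ.* + d) ℤ.+
        + (p ^ k) ℤ.* c ℤ.* ↧ r ℤ.* (↧ q ℤ.* + b)
        ≡⟨ solve 7 (λ u a m m′ b c d →
             u :* a :* m :* (m′ :* d) :+ u :* c :* m′ :* (m :* b) :=
             u :* (a :* d :+ c :* b) :* (m :* m′))
           refl (+ (p ^ k)) a (↧ q) (↧ r) (+ b) c (+ d) ⟩
      + (p ^ k) ℤ.* (a ℤ.* + d ℤ.+ c ℤ.* + b) ℤ.* (↧ q ℤ.* ↧ r)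
        ≡⟨⟩
      + (p ^ k) ℤ.* (a ℤ.* + d ℤ.+ c ℤ.* + b) ℤ.* ↧ (q ℚ.+ r) ∎)
    where
    open ≡-Reasoning
    open +-*-Solver

  small-neg : ∀ {k q} → ∣ q ∣≤p^- k → ∣ ℚ.- q ∣≤p^- k
  small-neg {k} {q@record{}} (small a b p∤b eq) = small (ℤ.- a) b p∤b (begin
    ℤ.- ↥ q ℤ.* + b                  ≡⟨ ℤ.neg-distribˡ-* (↥ q) (+ b) ⟨
    ℤ.- (↥ q ℤ.* + b)                ≡⟨ cong ℤ.-_ eq ⟩
    ℤ.- (+ (p ^ k) ℤ.* a ℤ.* ↧ q)    ≡⟨ solve 3 (λ u a m → :- (u :* a :* m) := u :* (:- a) :* m)
                                          refl (+ (p ^ k)) a (↧ q) ⟩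
    + (p ^ k) ℤ.* (ℤ.- a) ℤ.* ↧ q    ∎)
    where
    open ≡-Reasoning
    open +-*-Solver

  -- If |q|_p ≤ p^m and |r|_p ≤ p^(-(m+k)) then |q r|_p ≤ p^(-k).
  small-* : ∀ m {k q r} → ∣ fromℤ (+ (p ^ m)) ℚ.* q ∣≤p^- 0 → ∣ r ∣≤p^- (m ℕ.+ k) →
            ∣ q ℚ.* r ∣≤p^- k
  small-* m {k} {q@record{}} {r@record{}} (small a b p∤b eq) (small c d p∤d eq′) =
    small (a ℤ.* c) (b ℕ.* d) (∤-* p∤b p∤d) (begin
      ↥ q ℤ.* ↥ r ℤ.* + (b ℕ.* d)
        ≡⟨ cong (↥ q ℤ.* ↥ r ℤ.*_) (ℤ.pos-* b d) ⟩
      ↥ q ℤ.* ↥ r ℤ.* (+ b ℤ.* + d)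
        ≡⟨ solve 4 (λ n n′ b d → n :* n′ :* (b :* d) := n :* b :* (n′ :* d))
             refl (↥ q) (↥ r) (+ b) (+ d) ⟩
      ↥ q ℤ.* + b ℤ.* (↥ r ℤ.* + d)
        ≡⟨ cong (↥ q ℤ.* + b ℤ.*_) eq′ ⟩
      ↥ q ℤ.* + b ℤ.* (+ (p ^ (m ℕ.+ k)) ℤ.* c ℤ.* ↧ r)
        ≡⟨ cong (λ u → ↥ q ℤ.* + b ℤ.* (u ℤ.* c ℤ.* ↧ r)) p^[m+k] ⟩
      ↥ q ℤ.* + b ℤ.* (+ (p ^ m) ℤ.* + (p ^ k) ℤ.* c ℤ.* ↧ r)
        ≡⟨ solve 6 (λ n b u v c m′ →
             n :* b :* (u :* v :* c :* m′) := u :* n :* b :* (v :* c :* m′))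
             refl (↥ q) (+ b) (+ (p ^ m)) (+ (p ^ k)) c (↧ r) ⟩
      + (p ^ m) ℤ.* ↥ q ℤ.* + b ℤ.* (+ (p ^ k) ℤ.* c ℤ.* ↧ r)
        ≡⟨ cong (ℤ._* (+ (p ^ k) ℤ.* c ℤ.* ↧ r)) eq ⟩
      1ℤ ℤ.* a ℤ.* ↧ (fromℤ (+ (p ^ m)) ℚ.* q) ℤ.* (+ (p ^ k) ℤ.* c ℤ.* ↧ r)
        ≡⟨ cong (λ u → 1ℤ ℤ.* a ℤ.* u ℤ.* (+ (p ^ k) ℤ.* c ℤ.* ↧ r))
             (ℤ.*-identityˡ (↧ q)) ⟩
      1ℤ ℤ.* a ℤ.* ↧ q ℤ.* (+ (p ^ k) ℤ.* c ℤ.* ↧ r)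
        ≡⟨ solve 5 (λ a c u m m′ →
             con 1ℤ :* a :* m :* (u :* c :* m′) := u :* (a :* c) :* (m :* m′))
             refl a c (+ (p ^ k)) (↧ q) (↧ r) ⟩
      + (p ^ k) ℤ.* (a ℤ.* c) ℤ.* ↧ (q ℚ.* r) ∎)
    where
    open ≡-Reasoning
    open +-*-Solver
    p^[m+k] : + (p ^ (m ℕ.+ k)) ≡ + (p ^ m) ℤ.* + (p ^ k)
    p^[m+k] = trans (cong +_ (ℕ.^-distribˡ-+-* p m k)) (ℤ.pos-* (p ^ m) (p ^ k))

  p-part : ∀ d .{{_ : ℕ.NonZero d}} → ∃₂ λ m b → p ∤ b × d ≡ p ^ m ℕ.* b
  p-part = <-rec _ step
    where
    step : ∀ d → (∀ {e} → e ℕ.< d → .{{_ : ℕ.NonZero e}} →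
                  ∃₂ λ m b → p ∤ b × e ≡ p ^ m ℕ.* b) →
           .{{_ : ℕ.NonZero d}} → ∃₂ λ m b → p ∤ b × d ≡ p ^ m ℕ.* b
    step d rec with p ∣? d
    ... | no  p∤d = 0 , d , p∤d , sym (ℕ.+-identityʳ d)
    ... | yes p∣d
      with m , b , p∤b , eq ← rec (quotient-< p∣d {{prime⇒nonTrivial p-prime}})
                                  {{quotient≢0 p∣d}} =
      suc m , b , p∤b , trans (m∣n⇒n≡m*quotient p∣d)
        (trans (cong (p ℕ.*_) eq) (sym (ℕ.*-assoc p (p ^ m) b)))

  bounded : ∀ q → ∃[ m ] ∣ fromℤ (+ (p ^ m)) ℚ.* q ∣≤p^- 0
  bounded q@record{} with m , b , p∤b , eq ← p-part (↧ₙ q) =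
    m , small (↥ q) b p∤b (begin
      + (p ^ m) ℤ.* ↥ q ℤ.* + b         ≡⟨ solve 3 (λ u n b → u :* n :* b := n :* (u :* b))
                                             refl (+ (p ^ m)) (↥ q) (+ b) ⟩
      ↥ q ℤ.* (+ (p ^ m) ℤ.* + b)       ≡⟨ cong (↥ q ℤ.*_) (ℤ.pos-* (p ^ m) b) ⟨
      ↥ q ℤ.* + (p ^ m ℕ.* b)           ≡⟨ cong (λ d → ↥ q ℤ.* + d) eq ⟨
      ↥ q ℤ.* ↧ q                       ≡⟨ solve 2 (λ n d → n :* d := con 1ℤ :* n :* (con 1ℤ :* d))
                                             refl (↥ q) (↧ q) ⟩
      1ℤ ℤ.* ↥ q ℤ.* (1ℤ ℤ.* ↧ q)       ∎)
    where
    open ≡-Reasoning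
    open +-*-Solver

  small-scale : ∀ m {q} → ∣ q ∣≤p^- 0 → ∣ fromℤ (+ (p ^ m)) ℚ.* q ∣≤p^- 0
  small-scale m {q@record{}} (small a b p∤b eq) =
    small (+ (p ^ m) ℤ.* a) b p∤b (begin
      + (p ^ m) ℤ.* ↥ q ℤ.* + b                  ≡⟨ ℤ.*-assoc (+ (p ^ m)) (↥ q) (+ b) ⟩
      + (p ^ m) ℤ.* (↥ q ℤ.* + b)                ≡⟨ cong (+ (p ^ m) ℤ.*_) eq ⟩
      + (p ^ m) ℤ.* (1ℤ ℤ.* a ℤ.* ↧ q)           ≡⟨ solve 3 (λ u a d → u :* (con 1ℤ :* a :* d) :=
                                                                con 1ℤ :* (u :* a) :* (con 1ℤ :* d))
                                                      refl (+ (p ^ m)) a (↧ q) ⟩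
      1ℤ ℤ.* (+ (p ^ m) ℤ.* a) ℤ.* (1ℤ ℤ.* ↧ q)  ∎)
    where
    open ≡-Reasoning
    open +-*-Solver

  eventually-bounded : ∀ x → ∃₂ λ m N → ∀ i → N ≤ i →
                       ∣ fromℤ (+ (p ^ m)) ℚ.* seq x i ∣≤p^- 0
  eventually-bounded x
    with N , close ← cauchy x 0
    with m , bound ← bounded (seq x N) =
    m , N , λ i N≤i →
      small-≃ (split (fromℤ (+ (p ^ m))) (seq x i) (seq x N))
        (small-+ bound (small-scale m (close i N N≤i ℕ.≤-refl)))
    where
    split : ∀ u q r → u ℚ.* r ℚ.+ u ℚ.* (q ℚ.- r) ≃ u ℚ.* q
    split = solve 3 (λ u q r → u :* r :+ u :* (q :- r) := u :* q) ℚ.≃-refl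
      where
      open ℚSolver.+-*-Solver

  fromℚ : ℚᵘ → ℚₚ
  fromℚ q = record
    { seq    = λ _ → q
    ; cauchy = λ k → 0 , λ _ _ _ _ → small-≃ (ℚ.≃-sym (ℚ.+-inverseʳ q)) (small-0 k)
    }

  _+_ : ℚₚ → ℚₚ → ℚₚ
  x + y = record
    { seq    = λ i → seq x i ℚ.+ seq y i
    ; cauchy = λ k →
        let M , f = cauchy x k
            N , g = cauchy y k
        in M ⊔ N , λ i j i≥ j≥ →
          small-≃ (regroup (seq x i) (seq x j) (seq y i) (seq y j))
            (small-+ (f i j (ℕ.m⊔n≤o⇒m≤o M N i≥) (ℕ.m⊔n≤o⇒m≤o M N j≥))
                     (g i j (ℕ.m⊔n≤o⇒n≤o M N i≥) (ℕ.m⊔n≤o⇒n≤o M N j≥)))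
    }
    where
    regroup : ∀ q q′ r r′ → (q ℚ.- q′) ℚ.+ (r ℚ.- r′) ≃ (q ℚ.+ r) ℚ.- (q′ ℚ.+ r′)
    regroup = solve 4 (λ q q′ r r′ → (q :- q′) :+ (r :- r′) := (q :+ r) :- (q′ :+ r′)) ℚ.≃-refl
      where
      open ℚSolver.+-*-Solver

  _*_ : ℚₚ → ℚₚ → ℚₚ
  x * y = record
    { seq    = λ i → seq x i ℚ.* seq y i
    ; cauchy = λ k →
        let m , A , bx = eventually-bounded x
            n , B , by = eventually-bounded y
            C , cy     = cauchy y (m ℕ.+ k)
            D , cx     = cauchy x (n ℕ.+ k)
            M          = A ⊔ B
            N          = C ⊔ D
        in M ⊔ N , λ i j i≥ j≥ →
          let i≥M = ℕ.m⊔n≤o⇒m≤o M N i≥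
              i≥N = ℕ.m⊔n≤o⇒n≤o M N i≥
              j≥M = ℕ.m⊔n≤o⇒m≤o M N j≥
              j≥N = ℕ.m⊔n≤o⇒n≤o M N j≥
          in small-≃ (regroup (seq x i) (seq x j) (seq y i) (seq y j))
               (small-+
                 (small-* m {q = seq x i} (bx i (ℕ.m⊔n≤o⇒m≤o A B i≥M))
                   (cy i j (ℕ.m⊔n≤o⇒m≤o C D i≥N) (ℕ.m⊔n≤o⇒m≤o C D j≥N)))
                 (small-* n {q = seq y j} (by j (ℕ.m⊔n≤o⇒n≤o A B j≥M))
                   (cx i j (ℕ.m⊔n≤o⇒n≤o C D i≥N) (ℕ.m⊔n≤o⇒n≤o C D j≥N))))
    }
    where
    regroup : ∀ q q′ r r′ →
              q ℚ.* (r ℚ.- r′) ℚ.+ r′ ℚ.* (q ℚ.- q′) ≃ q ℚ.* r ℚ.- q′ ℚ.* r′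
    regroup = solve 4 (λ q q′ r r′ → q :* (r :- r′) :+ r′ :* (q :- q′) := q :* r :- q′ :* r′)
                ℚ.≃-refl
      where
      open ℚSolver.+-*-Solver

  0ₚ : ℚₚ
  0ₚ = fromℚ 0ℚᵘ

  HasNontrivialSolution : ℚₚ → ℚₚ → Set
  HasNontrivialSolution a b = ∃[ x ] ∃[ y ] ∃[ z ]
    ¬ (x ≈ 0ₚ × y ≈ 0ₚ × z ≈ 0ₚ) × z * z ≈ a * (x * x) + b * (y * y)

  -- HilbertSymbol a b s says that (a , b)_p is defined and equal to s.  It is a
  -- relation because, constructively, a sign-valued function on all of ℚₚ
  -- would require the solvability of z² = a x² + b y² to be decidable.
  data HilbertSymbol (a b : ℚₚ) : Sign → Set where
    solvable   :   HasNontrivialSolution a b → HilbertSymbol a b Sign.+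
    unsolvable : ¬ HasNontrivialSolution a b → HilbertSymbol a b Sign.-

  HilbertSymbol-unique : ∀ {a b s t} → HilbertSymbol a b s → HilbertSymbol a b t → s ≡ t
  HilbertSymbol-unique (solvable _)   (solvable _)   = refl
  HilbertSymbol-unique (solvable s)   (unsolvable u) = contradiction s u
  HilbertSymbol-unique (unsolvable u) (solvable s)   = contradiction s u
  HilbertSymbol-unique (unsolvable _) (unsolvable _) = refl

module Submission where

-- Put X = − u₁ u₂ and D = n (n − 4 u₃).  The identity
-- (u₁ + u₂) (u₁ x² + u₂ y²) = (u₁ x + u₂ y)² + u₁ u₂ (x − y)² and the given equation
-- make u₁ x² + u₂ y² + u₃ z² similar to X x² + D y² − z², so the symbol at p is
-- (X , D)_p.  As n is odd, D ≡ 1 (mod 4).  At a prime p ∤ n, including 2, this symbol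
-- is 1: either p ∣ u₃ and D ≡ n², or u₁ and u₂ have the same valuation and, if p ∣ D,
-- their unit parts v and w satisfy − v w ≡ v².  At ∞ it is 1 because X and D are not
-- both negative.  What remains is Hilbert's product formula for (X , D), which by
-- bimultiplicativity reduces to D = q* = ± q for odd primes q and to X = −1 or X prime:
-- this is quadratic reciprocity, here by Gauss's lemma and Eisenstein's count.  For
-- odd p the tame symbol decides solvability over ℚₚ: a zero modulo p lifts by
-- Newton's iteration, and an anisotropic form admits a descent dividing by p.

-- The choice of D: with s = u₁ x + u₂ y and t = x - y, the form u₁ x² + u₂ y² + u₃ z² times u₁ + u₂
-- is s² - X t² + (u₁ + u₂) u₃ z². As n ≠ 0, the given equation says exactly that n² (u₁ + u₂) u₃ =
-- X D, so the last coefficient is X D up to a square; multiplying by X leaves X, D and -1 up to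
-- squares. The factor n in D makes D ≡ n² ≡ 1 (mod 4), which reduces the symbol at 2 to (2 / D)
-- raised to the 2-adic valuation of X. The product formula concerns explicit signs `T p a b`; they
-- are compared with solvability over ℚₚ only at the primes dividing n, all of which are odd. The
-- negative term decides the place ∞: if all uᵢ were positive, 4 / n > 1 / u₃ would make D negative
-- along with X, and the sign at ∞ would be -1. Elements of ℚₚ are Cauchy sequences, so either
-- answer about solvability has to carry data: a convergent sequence of approximate integer zeros,
-- or a divisibility bound valid for all integer vectors.

-- Congruences between integers

module Congruences where
  open import Data.Nat.Base as ℕ using (ℕ; zero; suc)
  open import Data.Nat.Primality using (Prime; euclidsLemma; ¬prime[1])
  import Data.Nat.Divisibility as ℕ∣
  open import Data.Integer.Base hiding (suc)
  open import Data.Integer.Properties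
  open import Data.Integer.Divisibility.Signed
  open import Data.Integer.Tactic.RingSolver using (solve-∀)
  open import Data.Product.Base using (_,_)
  open import Data.Sum.Base using (_⊎_; inj₁; inj₂; [_,_]′) renaming (map to map-⊎)
  open import Function.Base using (id)
  open import Relation.Nullary using (¬_; contradiction)
  open import Relation.Binary.PropositionalEquality

  infix 4 _≈_[_] _∤_

  _∤_ : ℤ → ℤ → Set
  m ∤ a = ¬ m ∣ a

  -- A record rather than a synonym, so that a and b can be inferred; unification cannot recover
  -- them from a - b.
  record _≈_[_] (a b m : ℤ) : Set where
    constructor congruent
    field difference : m ∣ a - b

  open _≈_[_] public

  module _ {m : ℤ} where

    ≈-reflexive : ∀ {a b} → a ≡ b → a ≈ b [ m ]
    ≈-reflexive {a} refl = congruent (divides 0ℤ (+-inverseʳ a))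

    ≈-refl : ∀ {a} → a ≈ a [ m ]
    ≈-refl = ≈-reflexive refl

    ≈-sym : ∀ {a b} → a ≈ b [ m ] → b ≈ a [ m ]
    ≈-sym {a} {b} (congruent d) = congruent (subst (m ∣_) (flip a b) (∣m⇒∣-m d))
      where
      flip : ∀ a b → - (a - b) ≡ b - a
      flip = solve-∀

    ≈-trans : ∀ {a b c} → a ≈ b [ m ] → b ≈ c [ m ] → a ≈ c [ m ]
    ≈-trans {a} {b} {c} (congruent d) (congruent e) =
      congruent (subst (m ∣_) (telescope a b c) (∣m∣n⇒∣m+n d e))
      where
      telescope : ∀ a b c → (a - b) + (b - c) ≡ a - c
      telescope = solve-∀

    ≈-+ : ∀ {a b c d} → a ≈ b [ m ] → c ≈ d [ m ] → a + c ≈ b + d [ m ]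
    ≈-+ {a} {b} {c} {d} (congruent e) (congruent f) =
      congruent (subst (m ∣_) (regroup a b c d) (∣m∣n⇒∣m+n e f))
      where
      regroup : ∀ a b c d → (a - b) + (c - d) ≡ (a + c) - (b + d)
      regroup = solve-∀

    ≈-* : ∀ {a b c d} → a ≈ b [ m ] → c ≈ d [ m ] → a * c ≈ b * d [ m ]
    ≈-* {a} {b} {c} {d} (congruent e) (congruent f) =
      congruent (subst (m ∣_) (regroup a b c d) (∣m∣n⇒∣m+n (∣n⇒∣m*n c e) (∣n⇒∣m*n b f)))
      where
      regroup : ∀ a b c d → c * (a - b) + b * (c - d) ≡ a * c - b * d
      regroup = solve-∀

    ≈-^ : ∀ {a b} n → a ≈ b [ m ] → a ^ n ≈ b ^ n [ m ]
    ≈-^ zero    _ = ≈-refl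
    ≈-^ (suc n) e = ≈-* e (≈-^ n e)

    ≈-neg : ∀ {a b} → a ≈ b [ m ] → - a ≈ - b [ m ]
    ≈-neg {a} {b} (congruent d) = congruent (subst (m ∣_) (neg-minus a b) (∣m⇒∣-m d))
      where
      neg-minus : ∀ a b → - (a - b) ≡ - a - - b
      neg-minus = solve-∀

    ∣⇒≈0 : ∀ {a} → m ∣ a → a ≈ 0ℤ [ m ]
    ∣⇒≈0 {a} d = congruent (subst (m ∣_) (sym (+-identityʳ a)) d)

    ≈0⇒∣ : ∀ {a} → a ≈ 0ℤ [ m ] → m ∣ a
    ≈0⇒∣ {a} (congruent d) = subst (m ∣_) (+-identityʳ a) d

    ∣-resp-≈ : ∀ {a b} → a ≈ b [ m ] → m ∣ a → m ∣ b
    ∣-resp-≈ e d = ≈0⇒∣ (≈-trans (≈-sym e) (∣⇒≈0 d))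

  infixr 2 _≈⟨_⟩_
  infix  3 _≈∎

  _≈⟨_⟩_ : ∀ a {b c m} → a ≈ b [ m ] → b ≈ c [ m ] → a ≈ c [ m ]
  _ ≈⟨ e ⟩ f = ≈-trans e f

  _≈∎ : ∀ a {m} → a ≈ a [ m ]
  _ ≈∎ = ≈-refl

  ^-distribʳ-* : ∀ a b n → (a * b) ^ n ≡ a ^ n * b ^ n
  ^-distribʳ-* a b zero    = refl
  ^-distribʳ-* a b (suc n) =
    trans (cong (a * b *_) (^-distribʳ-* a b n)) (swap a b (a ^ n) (b ^ n))
    where
    swap : ∀ a b c d → a * b * (c * d) ≡ a * c * (b * d)
    swap = solve-∀

  module PrimeModulus {p : ℕ} (p-prime : Prime p) where

    p∣*⇒ : ∀ a b → + p ∣ a * b → (+ p ∣ a) ⊎ (+ p ∣ b)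
    p∣*⇒ a b d = map-⊎ ∣ᵤ⇒∣ ∣ᵤ⇒∣
      (euclidsLemma ∣ a ∣ ∣ b ∣ p-prime (subst (p ℕ∣.∣_) (abs-* a b) (∣⇒∣ᵤ d)))

    p∤* : ∀ {a b} → + p ∤ a → + p ∤ b → + p ∤ a * b
    p∤* {a} {b} p∤a p∤b d = [ p∤a , p∤b ]′ (p∣*⇒ a b d)

    p∣²⇒ : ∀ a → + p ∣ a * a → + p ∣ a
    p∣²⇒ a d = [ id , id ]′ (p∣*⇒ a a d)

    p∤1 : + p ∤ 1ℤ
    p∤1 d = ¬prime[1] (subst Prime (ℕ∣.∣1⇒≡1 (∣⇒∣ᵤ d)) p-prime)

    ≈-cancelˡ : ∀ c {a b} → + p ∤ c → c * a ≈ c * b [ + p ] → a ≈ b [ + p ]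
    ≈-cancelˡ c {a} {b} p∤c (congruent d)
      with p∣*⇒ c (a - b) (subst (+ p ∣_) (factor a b c) d)
      where
      factor : ∀ a b c → c * a - c * b ≡ c * (a - b)
      factor = solve-∀
    ... | inj₁ p∣c = contradiction p∣c p∤c
    ... | inj₂ p∣  = congruent p∣

-- Products of signs and of integers; roots of polynomials modulo p

module SignProducts where
  open Congruences
  open import Data.Nat.Base as ℕ using (ℕ; zero; suc)
  import Data.Nat.Properties as ℕ
  open import Data.Nat.Primality using (Prime)
  open import Data.Integer.Base hiding (suc)
  open import Data.Integer.Properties
  open import Data.Integer.Divisibility.Signed
  open import Data.Integer.Tactic.RingSolver using (solve-∀)
  open import Data.Sign.Base as Sign using (Sign; opposite)
  import Data.Sign.Properties as Sign
  import Algebra.Properties.CommutativeMonoid.Sum as Sum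
  open import Data.Fin.Base as Fin using (Fin; zero; suc; punchOut)
  import Data.Fin.Properties as Fin
  open import Data.Fin.Permutation using (permutation; _⟨$⟩ʳ_)
  open import Data.Vec.Base using (Vec; []; _∷_; replicate)
  open import Data.Product.Base using (∃-syntax; _,_; proj₁; proj₂)
  open import Data.Sum.Base using ([_,_]′)
  open import Function.Base using (_∘_; id)
  open import Function.Definitions using (Injective)
  open import Relation.Nullary using (¬_; contradiction; yes; no)
  open import Relation.Binary.PropositionalEquality

  open Sum Sign.*-commutativeMonoid public
    using () renaming (sum to ∏; sum-cong-≗ to ∏-cong; ∑-distrib-+ to ∏-distrib-*;
                       ∑-comm to ∏-comm)
  open Sum *-1-commutativeMonoid public
    using () renaming (sum to ∏ᶻ; sum-permute to ∏ᶻ-permute)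

  ⟦_⟧ : Sign → ℤ
  ⟦ Sign.+ ⟧ = 1ℤ
  ⟦ Sign.- ⟧ = -1ℤ

  ⟦⟧-* : ∀ s t → ⟦ s Sign.* t ⟧ ≡ ⟦ s ⟧ * ⟦ t ⟧
  ⟦⟧-* Sign.+ t      = sym (*-identityˡ ⟦ t ⟧)
  ⟦⟧-* Sign.- Sign.+ = refl
  ⟦⟧-* Sign.- Sign.- = refl

  ⟦⟧² : ∀ s → ⟦ s ⟧ * ⟦ s ⟧ ≡ 1ℤ
  ⟦⟧² Sign.+ = refl
  ⟦⟧² Sign.- = refl

  ⟦∏⟧ : ∀ {n} (f : Fin n → Sign) → ⟦ ∏ f ⟧ ≡ ∏ᶻ (⟦_⟧ ∘ f)
  ⟦∏⟧ {zero}  f = refl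
  ⟦∏⟧ {suc n} f = trans (⟦⟧-* (f zero) (∏ (f ∘ suc))) (cong (⟦ f zero ⟧ *_) (⟦∏⟧ (f ∘ suc)))

  -1^ : ℕ → Sign
  -1^ zero    = Sign.+
  -1^ (suc n) = opposite (-1^ n)

  opposite-*ˡ : ∀ s t → opposite s Sign.* t ≡ opposite (s Sign.* t)
  opposite-*ˡ Sign.+ t      = refl
  opposite-*ˡ Sign.- Sign.+ = refl
  opposite-*ˡ Sign.- Sign.- = refl

  -1^-+ : ∀ m n → -1^ (m ℕ.+ n) ≡ -1^ m Sign.* -1^ n
  -1^-+ zero    n = refl
  -1^-+ (suc m) n = trans (cong opposite (-1^-+ m n)) (sym (opposite-*ˡ (-1^ m) (-1^ n)))

  -1^-double : ∀ m → -1^ (m ℕ.+ m) ≡ Sign.+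
  -1^-double m = trans (-1^-+ m m) (Sign.s*s≡+ (-1^ m))

  ∏-plus : ∀ n → ∏ {n} (λ _ → Sign.+) ≡ Sign.+
  ∏-plus zero    = refl
  ∏-plus (suc n) = ∏-plus n

  ∏-minus : ∀ n → ∏ {n} (λ _ → Sign.-) ≡ -1^ n
  ∏-minus zero    = refl
  ∏-minus (suc n) = cong opposite (∏-minus n)

  ∏ᶻ-cong : ∀ {n m} {f g : Fin n → ℤ} → (∀ i → f i ≈ g i [ m ]) → ∏ᶻ f ≈ ∏ᶻ g [ m ]
  ∏ᶻ-cong {zero}  e = ≈-refl
  ∏ᶻ-cong {suc n} e = ≈-* (e zero) (∏ᶻ-cong (e ∘ suc))

  ∏ᶻ-scale : ∀ {n} c (f : Fin n → ℤ) → ∏ᶻ (λ i → c * f i) ≡ c ^ n * ∏ᶻ f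
  ∏ᶻ-scale {zero}  c f = refl
  ∏ᶻ-scale {suc n} c f =
    trans (cong (c * f zero *_) (∏ᶻ-scale c (f ∘ suc))) (swap c (f zero) (c ^ n) (∏ᶻ (f ∘ suc)))
    where
    swap : ∀ a b c d → a * b * (c * d) ≡ a * c * (b * d)
    swap = solve-∀

  ∏ᶻ-* : ∀ {n} (f g : Fin n → ℤ) → ∏ᶻ (λ i → f i * g i) ≡ ∏ᶻ f * ∏ᶻ g
  ∏ᶻ-* = Sum.∑-distrib-+ *-1-commutativeMonoid

  -- A missed value could be punched out of the codomain, leaving an injection into a smaller set.
  injective⇒surjective : ∀ {n} (f : Fin n → Fin n) → Injective _≡_ _≡_ f → ∀ j → ∃[ i ] f i ≡ j
  injective⇒surjective {suc n} f f-inj j with Fin.any? (λ i → f i Fin.≟ j)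
  ... | yes found = found
  ... | no missed = contradiction (Fin.injective⇒≤ punched-inj) ℕ.1+n≰n
    where
    j≢f : ∀ i → j ≢ f i
    j≢f i j≡fi = missed (i , sym j≡fi)
    punched-inj : Injective _≡_ _≡_ (λ i → punchOut (j≢f i))
    punched-inj {i} {i′} eq = f-inj (Fin.punchOut-injective (j≢f i) (j≢f i′) eq)

  injective⇒permutation : ∀ {n} (f : Fin n → Fin n) → Injective _≡_ _≡_ f →
                          ∃[ π ] ∀ i → π ⟨$⟩ʳ i ≡ f i
  injective⇒permutation f f-inj =
    permutation f (proj₁ ∘ onto) (proj₂ ∘ onto) (λ i → f-inj (proj₂ (onto (f i)))) , λ _ → refl
    where
    onto = injective⇒surjective f f-inj

  -- monic (c₀ ∷ … ∷ c_{d-1} ∷ []) x = c₀ + … + c_{d-1} x^{d-1} + x^d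
  monic : ∀ {d} → Vec ℤ d → ℤ → ℤ
  monic []       x = 1ℤ
  monic (c ∷ cs) x = c + x * monic cs x

  -- Synthetic division by x - r; the quotient is again monic.
  quot : ∀ {d} → Vec ℤ (suc d) → ℤ → Vec ℤ d
  quot {zero}  (c ∷ [])  r = []
  quot {suc d} (c ∷ cs)  r = monic cs r ∷ quot cs r

  monic-quot : ∀ {d} (cs : Vec ℤ (suc d)) r x →
               monic cs x - monic cs r ≡ (x - r) * monic (quot cs r) x
  monic-quot {zero}  (c ∷ []) r x = linear c r x
    where
    linear : ∀ c r x → (c + x * 1ℤ) - (c + r * 1ℤ) ≡ (x - r) * 1ℤ
    linear = solve-∀
  monic-quot {suc d} (c ∷ cs) r x = begin
    (c + x * P x) - (c + r * P r)     ≡⟨ split c x r (P x) (P r) ⟩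
    (x - r) * P r + x * (P x - P r)   ≡⟨ cong (λ t → (x - r) * P r + x * t) (monic-quot cs r x) ⟩
    (x - r) * P r + x * ((x - r) * Q) ≡⟨ factor x r (P r) Q ⟩
    (x - r) * (P r + x * Q)           ∎
    where
    open ≡-Reasoning
    P = monic cs
    Q = monic (quot cs r) x
    split : ∀ c x r s t → (c + x * s) - (c + r * t) ≡ (x - r) * t + x * (s - t)
    split = solve-∀
    factor : ∀ x r t q → (x - r) * t + x * ((x - r) * q) ≡ (x - r) * (t + x * q)
    factor = solve-∀

  monic-x^d-1 : ∀ d x → monic (-1ℤ ∷ replicate d 0ℤ) x ≡ x ^ suc d - 1ℤ
  monic-x^d-1 d x = trans (cong (λ t → -1ℤ + x * t) (x^d d)) (+-comm -1ℤ (x ^ suc d))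
    where
    x^d : ∀ d → monic (replicate d 0ℤ) x ≡ x ^ d
    x^d zero    = refl
    x^d (suc d) = trans (+-identityˡ _) (cong (x *_) (x^d d))

  module _ {p : ℕ} (p-prime : Prime p) where
    open PrimeModulus p-prime

    -- Lagrange's bound. After division by x - r₀ every other root is a root of the quotient, since
    -- p does not divide rᵢ - r₀ and is prime.
    tooManyRoots : ∀ {d} (cs : Vec ℤ d) (r : Fin (suc d) → ℤ) →
                   (∀ i j → r i ≈ r j [ + p ] → i ≡ j) → ¬ (∀ i → + p ∣ monic cs (r i))
    tooManyRoots []         r distinct root = p∤1 (root zero)
    tooManyRoots cs@(_ ∷ _) r distinct root =
      tooManyRoots (quot cs (r zero)) (r ∘ suc)
        (λ i j e → Fin.suc-injective (distinct (suc i) (suc j) e)) λ i →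
          [ (λ d → contradiction (distinct (suc i) zero (congruent d)) λ ()) , id ]′
            (p∣*⇒ (r (suc i) - r zero) _ (subst (+ p ∣_) (monic-quot cs (r zero) (r (suc i)))
              (∣m∣n⇒∣m-n (root (suc i)) (root zero))))

-- The Legendre symbol, Euler's criterion and Gauss's lemma

module LegendreSymbol where
  open Congruences
  open SignProducts
  open import Data.Nat.Base as ℕ using (ℕ; zero; suc; ⌊_/2⌋; NonZero; z≤n; s≤s)
  import Data.Nat.Properties as ℕ
  import Data.Nat.DivMod as ℕ
  import Data.Nat.Divisibility as ℕ∣
  import Data.Nat.Tactic.RingSolver as ℕSolver
  open import Data.Nat.Primality using (Prime; prime⇒nonZero; prime⇒irreducible)
  open import Data.Integer.Base hiding (suc; NonZero)
  open import Data.Integer.Properties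
  open import Data.Integer.Divisibility.Signed
  open import Data.Integer.DivMod using (_%ℕ_; a≡a%ℕn+[a/ℕn]*n; _/ℕ_)
  open import Data.Integer.Tactic.RingSolver using (solve-∀)
  open import Data.Sign.Base as Sign using (Sign; opposite)
  import Data.Sign.Properties as Sign
  open import Data.Bool.Base using (if_then_else_)
  open import Data.Fin.Base as Fin using (Fin; zero; suc; toℕ; fromℕ<)
  import Data.Fin.Properties as Fin
  open import Data.Vec.Base using (_∷_; replicate)
  open import Data.Product.Base using (∃-syntax; _,_; proj₁; proj₂)
  open import Data.Sum.Base using (_⊎_; inj₁; inj₂; [_,_]′)
  open import Function.Base using (_∘_; id)
  open import Relation.Nullary using (¬_; contradiction; Dec; yes; no; does)
  open import Relation.Nullary.Decidable using (dec-false)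
  open import Relation.Binary.PropositionalEquality

  signOf : ∀ {A : Set} → Dec A → Sign
  signOf d = if does d then Sign.+ else Sign.-

  signOf-yes : ∀ {A : Set} (d : Dec A) → A → signOf d ≡ Sign.+
  signOf-yes (yes _) _ = refl
  signOf-yes (no ¬a) a = contradiction a ¬a

  signOf-no : ∀ {A : Set} (d : Dec A) → ¬ A → signOf d ≡ Sign.-
  signOf-no (yes a) ¬a = contradiction a ¬a
  signOf-no (no _)  _  = refl

  -- The Legendre symbol (a / p) for odd p, by Euler's criterion; for p = 2 the
  -- Kronecker symbol (2 / a), which is only meaningful when a ≡ 1 (mod 4).
  χ : ℕ → ℤ → Sign
  χ p a = if does (p ℕ.≟ 2) then signOf (+ 8 ∣? (a - 1ℤ))
                            else signOf (+ p ∣? (a ^ ⌊ p /2⌋ - 1ℤ))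

  half : ∀ n → n ≡ ⌊ n /2⌋ ℕ.+ ⌊ n /2⌋ ⊎ n ≡ suc (⌊ n /2⌋ ℕ.+ ⌊ n /2⌋)
  half 0 = inj₁ refl
  half 1 = inj₂ refl
  half (suc (suc n)) with half n
  ... | inj₁ e = inj₁ (cong suc (trans (cong suc e) (sym (ℕ.+-suc _ _))))
  ... | inj₂ e = inj₂ (cong (λ k → suc (suc k)) (trans e (sym (ℕ.+-suc _ _))))

  m+m≢1+n+n : ∀ m n → m ℕ.+ m ≢ suc (n ℕ.+ n)
  m+m≢1+n+n m n eq = ℕ.even≢odd m n
    (trans (double m) (trans eq (cong suc (sym (double n)))))
    where
    double : ∀ m → 2 ℕ.* m ≡ m ℕ.+ m
    double = ℕSolver.solve-∀

  half-≤ : ∀ {m n} → m ℕ.+ m ℕ.≤ n ℕ.+ n → m ℕ.≤ n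
  half-≤ le = ℕ.≮⇒≥ λ lt → ℕ.<⇒≱ (ℕ.+-mono-< lt lt) le

  half-< : ∀ {m n} → m ℕ.+ m ℕ.< n ℕ.+ n → m ℕ.< n
  half-< lt = ℕ.≰⇒> λ le → ℕ.<⇒≱ lt (ℕ.+-mono-≤ le le)

  half-≡ : ∀ {m n} → m ℕ.+ m ≡ n ℕ.+ n → m ≡ n
  half-≡ eq = ℕ.≤-antisym (half-≤ (ℕ.≤-reflexive eq)) (half-≤ (ℕ.≤-reflexive (sym eq)))

  +∣+⇒≥ : ∀ {d n} .{{_ : NonZero n}} → + d ∣ + n → d ℕ.≤ n
  +∣+⇒≥ = ℕ∣.∣⇒≤ ∘ ∣⇒∣ᵤ

  module OddPrime {p : ℕ} (p-prime : Prime p) (p≢2 : p ≢ 2) where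
    open PrimeModulus p-prime

    instance
      p≢0 : NonZero p
      p≢0 = prime⇒nonZero p-prime

    h : ℕ
    h = ⌊ p /2⌋

    p≡1+2h : p ≡ suc (h ℕ.+ h)
    p≡1+2h with half p
    ... | inj₂ odd = odd
    ... | inj₁ even with prime⇒irreducible p-prime (ℕ∣.divides h (trans even (double h)))
      where
      double : ∀ m → m ℕ.+ m ≡ m ℕ.* 2
      double = ℕSolver.solve-∀
    ...   | inj₂ 2≡p = contradiction (sym 2≡p) p≢2

    small-∤ : ∀ {n} .{{_ : NonZero n}} → n ℕ.≤ h ℕ.+ h → + p ∤ + n
    small-∤ n≤2h d = ℕ.<⇒≱ (subst (_ ℕ.<_) (sym p≡1+2h) (s≤s n≤2h)) (+∣+⇒≥ d)

    p∤2 : + p ∤ + 2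
    p∤2 d with h | p≡1+2h
    ... | zero  | refl = p∤1 (divides 1ℤ refl)
    ... | suc k | refl = ℕ.<⇒≱ (s≤s (s≤s (ℕ.≤-trans (s≤s z≤n) (ℕ.m≤n+m (suc k) k)))) (+∣+⇒≥ d)

    signs-distinct : ∀ {s t} → ⟦ s ⟧ ≈ ⟦ t ⟧ [ + p ] → s ≡ t
    signs-distinct {Sign.+} {Sign.+} _ = refl
    signs-distinct {Sign.-} {Sign.-} _ = refl
    signs-distinct {Sign.+} {Sign.-} (congruent d) = contradiction d p∤2
    signs-distinct {Sign.-} {Sign.+} (congruent d) = contradiction (∣m⇒∣-m d) p∤2

    -- For odd p the signs are distinct modulo p, so a sign congruent to a ^ h is the symbol. The
    -- values of `χ` at odd p are obtained through this.
    χ-char : ∀ {a s} → a ^ h ≈ ⟦ s ⟧ [ + p ] → χ p a ≡ s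
    χ-char {a} {s} e rewrite dec-false (p ℕ.≟ 2) p≢2 = euler s e
      where
      euler : ∀ s → a ^ h ≈ ⟦ s ⟧ [ + p ] → signOf (+ p ∣? (a ^ h - 1ℤ)) ≡ s
      euler Sign.+ e = signOf-yes (+ p ∣? (a ^ h - 1ℤ)) (difference e)
      euler Sign.- e = signOf-no (+ p ∣? (a ^ h - 1ℤ)) λ d →
        contradiction (signs-distinct {Sign.+} {Sign.-} (≈-trans (≈-sym (congruent d)) e)) λ ()

    i<h⇒p∤ : ∀ (i : Fin h) → + p ∤ + suc (toℕ i)
    i<h⇒p∤ i = small-∤ (ℕ.≤-trans (Fin.toℕ<n i) (ℕ.m≤m+n h h))

    ordered-≈⇒≡ : ∀ {i j : Fin h} → toℕ i ℕ.≤ toℕ j →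
                  + suc (toℕ j) ≈ + suc (toℕ i) [ + p ] → i ≡ j
    ordered-≈⇒≡ {i} {j} i≤j (congruent d) with toℕ j ℕ.∸ toℕ i | ℕ.m+[n∸m]≡n i≤j
    ... | zero  | eq = Fin.toℕ-injective (trans (sym (ℕ.+-identityʳ _)) eq)
    ... | suc k | eq = contradiction
      (subst (+ p ∣_) (trans (cong (λ t → + suc t - + suc (toℕ i)) (sym eq))
        (trans (cong (_- + suc (toℕ i)) (pos-+ (suc (toℕ i)) (suc k)))
          (cancel (+ suc (toℕ i)) (+ suc k)))) d)
      (small-∤ (ℕ.≤-trans (ℕ.m≤n+m (suc k) (toℕ i))
        (ℕ.≤-trans (ℕ.≤-reflexive eq) (ℕ.≤-trans (ℕ.<⇒≤ (Fin.toℕ<n j)) (ℕ.m≤m+n h h)))))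
      where
      cancel : ∀ x y → x + y - x ≡ y
      cancel = solve-∀

    ≈⇒≡ : ∀ {i j : Fin h} → + suc (toℕ i) ≈ + suc (toℕ j) [ + p ] → i ≡ j
    ≈⇒≡ {i} {j} e with ℕ.≤-total (toℕ i) (toℕ j)
    ... | inj₁ i≤j = ordered-≈⇒≡ i≤j (≈-sym e)
    ... | inj₂ j≤i = sym (ordered-≈⇒≡ j≤i e)

    -- ⌊2m / p⌋ is odd exactly when the residue of m modulo p exceeds p / 2.
    residue : ∀ m → + p ∤ + m →
              ∃[ s ] + m ≈ ⟦ -1^ ((m ℕ.+ m) ℕ./ p) ⟧ * + suc (toℕ {h} s) [ + p ]
    residue m p∤m
      with (m ℕ.+ m) ℕ./ p | (m ℕ.+ m) ℕ.% p | ℕ.m≡m%n+[m/n]*n (m ℕ.+ m) p | ℕ.m%n<n (m ℕ.+ m) p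
    ... | f | r | eq | r<p with half f | half r
    ... | inj₁ f≡ | inj₁ r≡ = even ⌊ r /2⌋ refl
      where
      k = ⌊ f /2⌋
      m≡ : m ≡ ⌊ r /2⌋ ℕ.+ k ℕ.* p
      m≡ = half-≡ (trans eq (trans (cong₂ (λ f r → r ℕ.+ f ℕ.* p) f≡ r≡) (regroup ⌊ r /2⌋ k p)))
        where
        regroup : ∀ j k p → (j ℕ.+ j) ℕ.+ (k ℕ.+ k) ℕ.* p ≡ (j ℕ.+ k ℕ.* p) ℕ.+ (j ℕ.+ k ℕ.* p)
        regroup = ℕSolver.solve-∀
      even : ∀ j → j ≡ ⌊ r /2⌋ → ∃[ s ] + m ≈ ⟦ -1^ f ⟧ * + suc (toℕ {h} s) [ + p ]
      even zero j≡ = contradiction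
        (∣ᵤ⇒∣ (ℕ∣.divides k (trans m≡ (cong (ℕ._+ k ℕ.* p) (sym j≡))))) p∤m
      even (suc j) j≡ = fromℕ< j<h , congruent (divides (+ k) (begin
        + m - ⟦ -1^ f ⟧ * + suc (toℕ (fromℕ< j<h))
          ≡⟨ cong₂ (λ s t → + m - ⟦ s ⟧ * + suc t)
               (trans (cong -1^ f≡) (-1^-double k)) (Fin.toℕ-fromℕ< j<h) ⟩
        + m - 1ℤ * + suc j
          ≡⟨ cong (λ t → + t - 1ℤ * + suc j) (trans m≡ (cong (ℕ._+ k ℕ.* p) (sym j≡))) ⟩
        + (suc j ℕ.+ k ℕ.* p) - 1ℤ * + suc j
          ≡⟨ cong (_- 1ℤ * + suc j) (trans (pos-+ (suc j) (k ℕ.* p))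
               (cong (_+_ (+ suc j)) (pos-* k p))) ⟩
        + suc j + + k * + p - 1ℤ * + suc j
          ≡⟨ cancel (+ suc j) (+ k * + p) ⟩
        + k * + p ∎))
        where
        open ≡-Reasoning
        j<h : j ℕ.< h
        j<h = half-≤ (ℕ.≤-pred (subst₂ ℕ._<_ (trans r≡ (cong (λ j → j ℕ.+ j) (sym j≡))) p≡1+2h r<p))
        cancel : ∀ j x → j + x - 1ℤ * j ≡ x
        cancel = solve-∀
    ... | inj₂ f≡ | inj₂ r≡ = fromℕ< t<h , congruent (divides (+ suc k) (begin
        + m - ⟦ -1^ f ⟧ * + suc (toℕ (fromℕ< t<h))
          ≡⟨ cong₂ (λ s t → + m - ⟦ s ⟧ * + suc t)
               (trans (cong -1^ f≡) (cong opposite (-1^-double k))) (Fin.toℕ-fromℕ< t<h) ⟩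
        + m - -1ℤ * + suc t
          ≡⟨ negate (+ m) (+ suc t) ⟩
        + m + + suc t
          ≡⟨ pos-+ m (suc t) ⟨
        + (m ℕ.+ suc t)
          ≡⟨ cong +_ m+t≡ ⟩
        + (suc k ℕ.* p)
          ≡⟨ pos-* (suc k) p ⟩
        + suc k * + p ∎))
      where
      open ≡-Reasoning
      k = ⌊ f /2⌋
      j = ⌊ r /2⌋
      j<h : j ℕ.< h
      j<h = half-< (ℕ.≤-pred (subst₂ ℕ._<_ r≡ p≡1+2h r<p))
      -- With r = 2j + 1 and f = 2k + 1 one has m = j + 1 + h + k p, which falls short of (k + 1) p
      -- by h - j = t + 1.
      t = h ℕ.∸ suc j
      h≡ : suc j ℕ.+ t ≡ h
      h≡ = ℕ.m+[n∸m]≡n j<h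
      t<h : t ℕ.< h
      t<h = subst (t ℕ.<_) h≡ (s≤s (ℕ.m≤n+m t j))
      m≡ : m ≡ suc j ℕ.+ h ℕ.+ k ℕ.* p
      m≡ = half-≡ (trans eq (trans (cong₂ (λ f r → r ℕ.+ f ℕ.* p) f≡ r≡)
             (trans (cong (λ q → suc (j ℕ.+ j) ℕ.+ (q ℕ.+ (k ℕ.+ k) ℕ.* p)) p≡1+2h)
               (regroup j k p h))))
        where
        regroup : ∀ j k p h → suc (j ℕ.+ j) ℕ.+ (suc (h ℕ.+ h) ℕ.+ (k ℕ.+ k) ℕ.* p) ≡
                  (suc j ℕ.+ h ℕ.+ k ℕ.* p) ℕ.+ (suc j ℕ.+ h ℕ.+ k ℕ.* p)
        regroup = ℕSolver.solve-∀
      m+t≡ : m ℕ.+ suc t ≡ suc k ℕ.* p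
      m+t≡ = trans (cong (ℕ._+ suc t) m≡) (trans (regroup j h t (k ℕ.* p))
               (trans (cong (λ g → suc (h ℕ.+ g) ℕ.+ k ℕ.* p) h≡)
                 (cong (ℕ._+ k ℕ.* p) (sym p≡1+2h))))
        where
        regroup : ∀ j h t x → suc j ℕ.+ h ℕ.+ x ℕ.+ suc t ≡ suc (h ℕ.+ (suc j ℕ.+ t)) ℕ.+ x
        regroup = ℕSolver.solve-∀
      negate : ∀ a b → a - -1ℤ * b ≡ a + b
      negate = solve-∀
    -- As p is odd and 2m even, the quotient and the remainder have the same parity; the mixed cases
    -- are absurd.
    ... | inj₁ f≡ | inj₂ r≡ = contradiction
      (trans eq (trans (cong₂ (λ f r → r ℕ.+ f ℕ.* p) f≡ r≡) (regroup ⌊ r /2⌋ ⌊ f /2⌋ p)))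
      (m+m≢1+n+n m (⌊ r /2⌋ ℕ.+ ⌊ f /2⌋ ℕ.* p))
      where
      regroup : ∀ j k p → suc (j ℕ.+ j) ℕ.+ (k ℕ.+ k) ℕ.* p ≡
                suc ((j ℕ.+ k ℕ.* p) ℕ.+ (j ℕ.+ k ℕ.* p))
      regroup = ℕSolver.solve-∀
    ... | inj₂ f≡ | inj₁ r≡ = contradiction
      (trans eq (trans (cong₂ (λ f r → r ℕ.+ f ℕ.* p) f≡ r≡)
        (trans (cong (λ q → (⌊ r /2⌋ ℕ.+ ⌊ r /2⌋) ℕ.+ (q ℕ.+ (⌊ f /2⌋ ℕ.+ ⌊ f /2⌋) ℕ.* p)) p≡1+2h)
          (regroup ⌊ r /2⌋ ⌊ f /2⌋ p h))))
      (m+m≢1+n+n m (⌊ r /2⌋ ℕ.+ h ℕ.+ ⌊ f /2⌋ ℕ.* p))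
      where
      regroup : ∀ j k p h → (j ℕ.+ j) ℕ.+ (suc (h ℕ.+ h) ℕ.+ (k ℕ.+ k) ℕ.* p) ≡
                suc ((j ℕ.+ h ℕ.+ k ℕ.* p) ℕ.+ (j ℕ.+ h ℕ.+ k ℕ.* p))
      regroup = ℕSolver.solve-∀

    module _ {a : ℕ} (p∤a : + p ∤ + a) where

      private
        ∏ᶻ-cong-≡ : ∀ {n} {f g : Fin n → ℤ} → (∀ i → f i ≡ g i) → ∏ᶻ f ≡ ∏ᶻ g
        ∏ᶻ-cong-≡ {zero}  e = refl
        ∏ᶻ-cong-≡ {suc n} e = cong₂ _*_ (e zero) (∏ᶻ-cong-≡ (e ∘ suc))

        multiple : Fin h → ℕ
        multiple i = a ℕ.* suc (toℕ i)

        gaussSign : Fin h → Sign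
        gaussSign i = -1^ ((multiple i ℕ.+ multiple i) ℕ./ p)

        p∤multiple : ∀ i → + p ∤ + multiple i
        p∤multiple i = subst (+ p ∤_) (sym (pos-* a (suc (toℕ i)))) (p∤* p∤a (i<h⇒p∤ i))

        σ : Fin h → Fin h
        σ i = proj₁ (residue (multiple i) (p∤multiple i))

        multiple≈ : ∀ i → + a * + suc (toℕ i) ≈ ⟦ gaussSign i ⟧ * + suc (toℕ (σ i)) [ + p ]
        multiple≈ i = ≈-trans (≈-reflexive (sym (pos-* a (suc (toℕ i)))))
          (proj₂ (residue (multiple i) (p∤multiple i)))

        -- Equal images make a x and a y congruent up to sign. Equal signs cancel to x = y; opposite
        -- signs would give p ∣ x + y, although 0 < x + y ≤ 2h < p.
        σ-injective : ∀ {i j} → σ i ≡ σ j → i ≡ j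
        σ-injective {i} {j} σi≡σj =
          compare (gaussSign i) (gaussSign j)
            (≈-trans (multiple≈ i) (≈-reflexive (cong (λ k → ⟦ gaussSign i ⟧ * + suc (toℕ k)) σi≡σj)))
            (multiple≈ j)
          where
          x = + suc (toℕ i)
          y = + suc (toℕ j)
          z = + suc (toℕ (σ j))
          opposite-signs : + a * x ≈ - (+ a * y) [ + p ] → i ≡ j
          opposite-signs (congruent d) = contradiction
            ([ (λ p∣a → contradiction p∣a p∤a) , id ]′
              (p∣*⇒ (+ a) (x + y) (subst (+ p ∣_) (collect (+ a) x y) d)))
            (small-∤ (ℕ.+-mono-≤ (Fin.toℕ<n i) (Fin.toℕ<n j)))
            where
            collect : ∀ a x y → a * x - - (a * y) ≡ a * (x + y)
            collect = solve-∀
          negate : ∀ z → -1ℤ * z ≡ - (1ℤ * z)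
          negate = solve-∀
          compare : ∀ s t → + a * x ≈ ⟦ s ⟧ * z [ + p ] → + a * y ≈ ⟦ t ⟧ * z [ + p ] → i ≡ j
          compare Sign.+ Sign.+ e f = ≈⇒≡ (≈-cancelˡ (+ a) p∤a (≈-trans e (≈-sym f)))
          compare Sign.- Sign.- e f = ≈⇒≡ (≈-cancelˡ (+ a) p∤a (≈-trans e (≈-sym f)))
          compare Sign.+ Sign.- e f = opposite-signs (≈-trans e
            (≈-trans (≈-reflexive (sym (trans (cong -_ (negate z)) (neg-involutive (1ℤ * z)))))
              (≈-neg (≈-sym f))))
          compare Sign.- Sign.+ e f = opposite-signs (≈-trans e
            (≈-trans (≈-reflexive (negate z)) (≈-neg (≈-sym f))))

        p∤∏ : ∀ {n} (f : Fin n → ℤ) → (∀ i → + p ∤ f i) → + p ∤ ∏ᶻ f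
        p∤∏ {zero}  f p∤f = p∤1
        p∤∏ {suc n} f p∤f = p∤* (p∤f zero) (p∤∏ (f ∘ suc) (p∤f ∘ suc))

        half-factorial : ℤ
        half-factorial = ∏ᶻ {h} (λ i → + suc (toℕ i))

        σ-permutes : ∏ᶻ {h} (λ i → + suc (toℕ (σ i))) ≡ half-factorial
        σ-permutes = sym (trans (∏ᶻ-permute (λ i → + suc (toℕ i)) (proj₁ π))
          (∏ᶻ-cong-≡ λ i → cong (λ k → + suc (toℕ k)) (proj₂ π i)))
          where
          π = injective⇒permutation σ σ-injective

      -- Multiply the congruences a x ≡ ± σ x over all x ≤ h. Both sides contain h!, because σ is a
      -- permutation, and h! is prime to p.
      gauss≈ : (+ a) ^ h ≈ ⟦ ∏ gaussSign ⟧ [ + p ]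
      gauss≈ = ≈-cancelˡ half-factorial (p∤∏ {h} _ i<h⇒p∤) (
        half-factorial * (+ a) ^ h
          ≈⟨ ≈-reflexive (*-comm half-factorial ((+ a) ^ h)) ⟩
        (+ a) ^ h * half-factorial
          ≈⟨ ≈-reflexive (sym (∏ᶻ-scale {h} (+ a) (λ i → + suc (toℕ i)))) ⟩
        ∏ᶻ {h} (λ i → + a * + suc (toℕ i))
          ≈⟨ ∏ᶻ-cong {h} multiple≈ ⟩
        ∏ᶻ {h} (λ i → ⟦ gaussSign i ⟧ * + suc (toℕ (σ i)))
          ≈⟨ ≈-reflexive (∏ᶻ-* {h} (λ i → ⟦ gaussSign i ⟧) (λ i → + suc (toℕ (σ i)))) ⟩
        ∏ᶻ {h} (λ i → ⟦ gaussSign i ⟧) * ∏ᶻ {h} (λ i → + suc (toℕ (σ i)))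
          ≈⟨ ≈-reflexive (cong₂ _*_ (sym (⟦∏⟧ gaussSign)) σ-permutes) ⟩
        ⟦ ∏ gaussSign ⟧ * half-factorial
          ≈⟨ ≈-reflexive (*-comm ⟦ ∏ gaussSign ⟧ half-factorial) ⟩
        half-factorial * ⟦ ∏ gaussSign ⟧ ≈∎)

      gauss : χ p (+ a) ≡ ∏ {h} (λ i → -1^ ((a ℕ.* suc (toℕ i) ℕ.+ a ℕ.* suc (toℕ i)) ℕ./ p))
      gauss = χ-char gauss≈

    residueℕ : ∀ a → a ≈ + (a %ℕ p) [ + p ]
    residueℕ a = congruent (divides (a /ℕ p) (trans
      (cong (_- + (a %ℕ p)) (a≡a%ℕn+[a/ℕn]*n a p)) (cancel (+ (a %ℕ p)) (a /ℕ p * + p))))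
      where
      cancel : ∀ x y → x + y - x ≡ y
      cancel = solve-∀

    -- That a ^ h is a sign modulo p is read off from `gauss≈` at the natural residue of a, which
    -- also covers negative a.
    euler : ∀ {a} → + p ∤ a → a ^ h ≈ ⟦ χ p a ⟧ [ + p ]
    euler {a} p∤a = subst (λ s → a ^ h ≈ ⟦ s ⟧ [ + p ]) (sym (χ-char a^h≈)) a^h≈
      where
      p∤r : + p ∤ + (a %ℕ p)
      p∤r d = p∤a (∣-resp-≈ (≈-sym (residueℕ a)) d)
      a^h≈ = ≈-trans (≈-^ h (residueℕ a)) (gauss≈ p∤r)

    χ-≈ : ∀ {a b} → + p ∤ a → a ≈ b [ + p ] → χ p a ≡ χ p b
    χ-≈ p∤a a≈b = sym (χ-char (≈-trans (≈-sym (≈-^ h a≈b)) (euler p∤a)))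

    χ-* : ∀ {a b} → + p ∤ a → + p ∤ b → χ p (a * b) ≡ χ p a Sign.* χ p b
    χ-* {a} {b} p∤a p∤b = χ-char (≈-trans (≈-reflexive (^-distribʳ-* a b h))
      (≈-trans (≈-* (euler p∤a) (euler p∤b)) (≈-reflexive (sym (⟦⟧-* (χ p a) (χ p b))))))

    χ-square : ∀ {a} → + p ∤ a → χ p (a * a) ≡ Sign.+
    χ-square {a} p∤a = trans (χ-* p∤a p∤a) (Sign.s*s≡+ (χ p a))

    χ-1 : χ p 1ℤ ≡ Sign.+
    χ-1 = χ-square p∤1

    χ-minus1 : χ p -1ℤ ≡ -1^ h
    χ-minus1 = χ-char (≈-reflexive (power h))
      where
      power : ∀ n → -1ℤ ^ n ≡ ⟦ -1^ n ⟧
      power zero    = refl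
      power (suc n) = trans (cong (-1ℤ *_) (power n)) (sym (⟦⟧-* Sign.- (-1^ n)))

    h≡1+ : ∃[ d ] h ≡ suc d
    h≡1+ with h | p≡1+2h
    ... | zero  | p≡1  = contradiction (∣-reflexive (cong +_ p≡1)) p∤1
    ... | suc d | _    = d , refl

    -- The squares 1², …, h² and a further a with χ p a = + would be too many
    -- roots of x^h − 1.
    χ-sqrt : ∀ {a} → + p ∤ a → χ p a ≡ Sign.+ → ∃[ x ] x * x ≈ a [ + p ]
    χ-sqrt {a} p∤a χa with Fin.any? {h} (λ i → + p ∣? (+ suc (toℕ i) * + suc (toℕ i) - a))
    ... | yes (i , d) = + suc (toℕ i) , congruent d
    ... | no nonsquare = contradiction
      (λ i → subst (+ p ∣_) (sym (monic-x^d-1 d (root i)))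
        (difference (subst (λ n → root i ^ n ≈ 1ℤ [ + p ]) h≡ (root^h i))))
      (tooManyRoots p-prime (-1ℤ ∷ replicate d 0ℤ) root root-distinct)
      where
      d  = proj₁ h≡1+
      h≡ = proj₂ h≡1+
      x : Fin h → ℤ
      x i = + suc (toℕ i)
      root : Fin (suc (suc d)) → ℤ
      root zero    = a
      root (suc i) = x (Fin.cast (sym h≡) i) * x (Fin.cast (sym h≡) i)
      root^h : ∀ i → root i ^ h ≈ 1ℤ [ + p ]
      root^h zero    = ≈-trans (euler p∤a) (≈-reflexive (cong ⟦_⟧ χa))
      root^h (suc i) = ≈-trans (euler (p∤* p∤x p∤x)) (≈-reflexive (cong ⟦_⟧ (χ-square p∤x)))
        where
        p∤x = i<h⇒p∤ (Fin.cast (sym h≡) i)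
      factor : ∀ x y → x * x - y * y ≡ (x - y) * (x + y)
      factor = solve-∀
      square-injective : ∀ i j → x i * x i ≈ x j * x j [ + p ] → i ≡ j
      square-injective i j (congruent e)
        with p∣*⇒ (x i - x j) (x i + x j) (subst (+ p ∣_) (factor (x i) (x j)) e)
      ... | inj₁ p∣ = ≈⇒≡ (congruent p∣)
      ... | inj₂ p∣ = contradiction p∣ (small-∤ (ℕ.+-mono-≤ (Fin.toℕ<n i) (Fin.toℕ<n j)))
      root-distinct : ∀ i j → root i ≈ root j [ + p ] → i ≡ j
      root-distinct zero    zero    _ = refl
      root-distinct zero    (suc j) e =
        contradiction (Fin.cast (sym h≡) j , difference (≈-sym e)) nonsquare
      root-distinct (suc i) zero    e =
        contradiction (Fin.cast (sym h≡) i , difference e) nonsquare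
      root-distinct (suc i) (suc j) e = cong suc (Fin.toℕ-injective (trans
        (sym (Fin.toℕ-cast (sym h≡) i)) (trans (cong toℕ (square-injective _ _ e))
          (Fin.toℕ-cast (sym h≡) j))))

-- Quadratic reciprocity by counting lattice points

module QuadraticReciprocity where
  open Congruences
  open SignProducts
  open LegendreSymbol
  open import Data.Nat.Base as ℕ using (ℕ; zero; suc; ⌊_/2⌋; NonZero; s≤s)
  import Data.Nat.Properties as ℕ
  import Data.Nat.DivMod as ℕ
  import Data.Nat.Divisibility as ℕ∣
  import Data.Nat.Tactic.RingSolver as ℕSolver
  open import Data.Nat.Primality using (Prime; prime⇒irreducible)
  open import Data.Integer.Base hiding (suc; NonZero)
  open import Data.Integer.Properties
  open import Data.Integer.Divisibility.Signed
  open import Data.Integer.Tactic.RingSolver using (solve-∀)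
  open import Data.Sign.Base as Sign using (Sign; opposite)
  import Data.Sign.Properties as Sign
  open import Data.Fin.Base as Fin using (Fin; zero; suc; toℕ)
  import Data.Fin.Properties as Fin
  open import Data.Product.Base using (_,_)
  open import Data.Sum.Base using (inj₁; inj₂)
  open import Function.Base using (_∘_)
  open import Relation.Nullary using (Dec; yes; no)
  open import Relation.Binary.PropositionalEquality

  -- Signs as the field with two elements: _*_ is its addition, ⟨_,_⟩ its multiplication.
  ⟨_,_⟩ : Sign → Sign → Sign
  ⟨ Sign.+ , t ⟩ = Sign.+
  ⟨ Sign.- , t ⟩ = t

  ⟨,+⟩ : ∀ s → ⟨ s , Sign.+ ⟩ ≡ Sign.+
  ⟨,+⟩ Sign.+ = refl
  ⟨,+⟩ Sign.- = refl

  ⟨,-⟩ : ∀ s → ⟨ s , Sign.- ⟩ ≡ s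
  ⟨,-⟩ Sign.+ = refl
  ⟨,-⟩ Sign.- = refl

  ∏-const : ∀ n s → ∏ {n} (λ _ → s) ≡ ⟨ -1^ n , s ⟩
  ∏-const n Sign.+ = trans (∏-plus n) (sym (⟨,+⟩ (-1^ n)))
  ∏-const n Sign.- = trans (∏-minus n) (sym (⟨,-⟩ (-1^ n)))

  signOf-cong : ∀ {A B : Set} (d : Dec A) (e : Dec B) → (A → B) → (B → A) → signOf d ≡ signOf e
  signOf-cong d (yes b) f g = signOf-yes d (g b)
  signOf-cong d (no ¬b) f g = signOf-no d (¬b ∘ f)

  infix 5 _≤±_

  -- The indicator of m ≤ n in the field with two elements, so that products of these signs count
  -- modulo 2.
  _≤±_ : ℕ → ℕ → Sign
  m ≤± n = opposite (signOf (m ℕ.≤? n))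

  ≤±-yes : ∀ {m n} → m ℕ.≤ n → m ≤± n ≡ Sign.-
  ≤±-yes {m} {n} le = cong opposite (signOf-yes (m ℕ.≤? n) le)

  ≤±-no : ∀ {m n} → n ℕ.< m → m ≤± n ≡ Sign.+
  ≤±-no {m} {n} lt = cong opposite (signOf-no (m ℕ.≤? n) (ℕ.<⇒≱ lt))

  ≤±-antisym : ∀ {m n} → m ≢ n → (m ≤± n) Sign.* (n ≤± m) ≡ Sign.-
  ≤±-antisym {m} {n} m≢n with ℕ.≤-total m n
  ... | inj₁ m≤n = cong₂ Sign._*_ (≤±-yes m≤n) (≤±-no (ℕ.≤∧≢⇒< m≤n m≢n))
  ... | inj₂ n≤m = cong₂ Sign._*_ (≤±-no (ℕ.≤∧≢⇒< n≤m (m≢n ∘ sym))) (≤±-yes n≤m)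

  -- The multiples d, …, k d of d include all positive ones up to m.
  count-multiples : ∀ d .{{_ : NonZero d}} k m → m ℕ.< d ℕ.* suc k →
                    ∏ {k} (λ j → d ℕ.* suc (toℕ j) ≤± m) ≡ -1^ (m ℕ./ d)
  count-multiples d zero m m<d
    rewrite ℕ.m<n⇒m/n≡0 (subst (m ℕ.<_) (ℕ.*-identityʳ d) m<d) = refl
  count-multiples d (suc k) m m<dk with m ℕ.<? d
  ... | yes m<d rewrite ℕ.m<n⇒m/n≡0 m<d = trans
    (∏-cong {suc k} λ j → ≤±-no (ℕ.<-≤-trans m<d (ℕ.m≤m*n d (suc (toℕ j)))))
    (∏-plus (suc k))
  -- The multiple d itself contributes one; the others are compared after subtracting d, in step
  -- with ⌊m / d⌋ = 1 + ⌊(m - d) / d⌋.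
  ... | no m≮d = begin
    (d ℕ.* 1 ≤± m) Sign.* ∏ {k} (λ j → d ℕ.* suc (suc (toℕ j)) ≤± m)
      ≡⟨ cong₂ Sign._*_ (≤±-yes (subst (ℕ._≤ m) (sym (ℕ.*-identityʳ d)) d≤m))
           (∏-cong {k} λ j → cong opposite (signOf-cong
             (d ℕ.* suc (suc (toℕ j)) ℕ.≤? m) (d ℕ.* suc (toℕ j) ℕ.≤? m ℕ.∸ d)
             (λ le → ℕ.m+n≤o⇒m≤o∸n (d ℕ.* suc (toℕ j)) (subst (ℕ._≤ m) (shift (toℕ j)) le))
             (λ le → subst (ℕ._≤ m) (sym (shift (toℕ j)))
                (subst (d ℕ.* suc (toℕ j) ℕ.+ d ℕ.≤_) (ℕ.m∸n+n≡m d≤m) (ℕ.+-monoˡ-≤ d le))))) ⟩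
    opposite (∏ {k} (λ j → d ℕ.* suc (toℕ j) ≤± m ℕ.∸ d))
      ≡⟨ cong opposite (count-multiples d k (m ℕ.∸ d) (ℕ.+-cancelʳ-< d _ _
           (subst₂ ℕ._<_ (sym (ℕ.m∸n+n≡m d≤m)) (shift k) m<dk))) ⟩
    -1^ (suc ((m ℕ.∸ d) ℕ./ d))
      ≡⟨ cong -1^ (ℕ.m/n≡1+[m∸n]/n d≤m) ⟨
    -1^ (m ℕ./ d) ∎
    where
    open ≡-Reasoning
    d≤m = ℕ.≮⇒≥ m≮d
    shift : ∀ j → d ℕ.* suc (suc j) ≡ d ℕ.* suc j ℕ.+ d
    shift j = trans (ℕ.*-suc d (suc j)) (ℕ.+-comm d _)

  module _ {p : ℕ} (p-prime : Prime p) (p≢2 : p ≢ 2) where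
    open PrimeModulus p-prime
    open OddPrime p-prime p≢2

    private
      floors : ∀ c → Fin h → Sign
      floors c i = -1^ ((suc (c ℕ.+ c) ℕ.* suc (toℕ i)) ℕ./ p)

      triangular : Sign
      triangular = ∏ {h} (λ i → -1^ (suc (toℕ i)))

      -- Gauss's lemma for (b + p) / 2, where b = 2c + 1.
      χ-2-odd : ∀ c → + p ∤ + suc (c ℕ.+ c) →
                χ p (+ suc (c ℕ.+ c)) ≡ χ p (+ 2) Sign.* (∏ (floors c) Sign.* triangular)
      χ-2-odd c p∤b = begin
        χ p (+ b)
          ≡⟨ χ-≈ p∤b (≈-sym (congruent (divides 1ℤ 2m-b≡p))) ⟩
        χ p (+ 2 * + m)
          ≡⟨ χ-* p∤2 p∤m ⟩
        χ p (+ 2) Sign.* χ p (+ m)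
          ≡⟨ cong (χ p (+ 2) Sign.*_) (trans (gauss {m} p∤m) (∏-cong {h} (λ i → floor (suc (toℕ i))))) ⟩
        χ p (+ 2) Sign.* ∏ {h} (λ i → floors c i Sign.* -1^ (suc (toℕ i)))
          ≡⟨ cong (χ p (+ 2) Sign.*_) (∏-distrib-* {h} (floors c) (λ i → -1^ (suc (toℕ i)))) ⟩
        χ p (+ 2) Sign.* (∏ (floors c) Sign.* triangular) ∎
        where
        open ≡-Reasoning
        b = suc (c ℕ.+ c)
        m = suc (c ℕ.+ h)
        m+m≡ : m ℕ.+ m ≡ b ℕ.+ p
        m+m≡ = trans (regroup c h) (cong (b ℕ.+_) (sym p≡1+2h))
          where
          regroup : ∀ c h → suc (c ℕ.+ h) ℕ.+ suc (c ℕ.+ h) ≡ suc (c ℕ.+ c) ℕ.+ suc (h ℕ.+ h)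
          regroup = ℕSolver.solve-∀
        2m≡ : + 2 * + m ≡ + b + + p
        2m≡ = trans (double (+ m)) (trans (sym (pos-+ m m)) (trans (cong +_ m+m≡) (pos-+ b p)))
          where
          double : ∀ x → + 2 * x ≡ x + x
          double = solve-∀
        2m-b≡p : + 2 * + m - + b ≡ 1ℤ * + p
        2m-b≡p = trans (cong (_- + b) 2m≡) (cancel (+ b) (+ p))
          where
          cancel : ∀ b p → b + p - b ≡ 1ℤ * p
          cancel = solve-∀
        p∤m : + p ∤ + m
        p∤m p∣m = p∤b (∣m+n∣n⇒∣m (subst (+ p ∣_) 2m≡ (∣n⇒∣m*n (+ 2) p∣m)) ∣-refl)
        -- Since 2m = b + p, the floor of 2 m x / p is that of b x / p plus x. The extra x do not
        -- depend on b and form `triangular`.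
        floor : ∀ x → -1^ ((m ℕ.* x ℕ.+ m ℕ.* x) ℕ./ p) ≡ -1^ ((b ℕ.* x) ℕ./ p) Sign.* -1^ x
        floor x = trans (cong -1^ (begin
          (m ℕ.* x ℕ.+ m ℕ.* x) ℕ./ p
            ≡⟨ ℕ./-congˡ (trans (sym (ℕ.*-distribʳ-+ x m m)) (trans (cong (ℕ._* x) m+m≡)
                 (trans (ℕ.*-distribʳ-+ x b p) (cong (b ℕ.* x ℕ.+_) (ℕ.*-comm p x))))) ⟩
          (b ℕ.* x ℕ.+ x ℕ.* p) ℕ./ p
            ≡⟨ ℕ.+-distrib-/-∣ʳ (b ℕ.* x) (ℕ∣.n∣m*n x) ⟩
          (b ℕ.* x) ℕ./ p ℕ.+ (x ℕ.* p) ℕ./ p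
            ≡⟨ cong ((b ℕ.* x) ℕ./ p ℕ.+_) (ℕ.m*n/n≡m x p) ⟩
          (b ℕ.* x) ℕ./ p ℕ.+ x ∎)) (-1^-+ ((b ℕ.* x) ℕ./ p) x)

    -- The case b = 1 of `χ-2-odd`: all floors vanish as x ≤ h < p, and (1 / p) = 1. The total
    -- exponent 1 + ... + h is the familiar (p² - 1) / 8.
    χ-2 : χ p (+ 2) ≡ ∏ {h} (λ i → -1^ (suc (toℕ i)))
    χ-2 = sym (begin
      triangular
        ≡⟨ Sign.*-identityˡ triangular ⟨
      Sign.+ Sign.* triangular
        ≡⟨ cong (Sign._* triangular) (sym floors-0) ⟩
      ∏ (floors 0) Sign.* triangular
        ≡⟨ solve-for (χ p (+ 2)) _ (trans (sym χ-1) (χ-2-odd 0 p∤1)) ⟩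
      χ p (+ 2) ∎)
      where
      open ≡-Reasoning
      solve-for : ∀ s t → Sign.+ ≡ s Sign.* t → t ≡ s
      solve-for Sign.+ t eq = sym eq
      solve-for Sign.- Sign.- eq = refl
      floors-0 : ∏ (floors 0) ≡ Sign.+
      floors-0 = trans (∏-cong {h} λ i → cong -1^ (ℕ.m<n⇒m/n≡0 (subst₂ ℕ._<_
        (sym (ℕ.*-identityˡ (suc (toℕ i)))) (sym p≡1+2h)
        (s≤s (ℕ.≤-trans (Fin.toℕ<n i) (ℕ.m≤m+n h h)))))) (∏-plus h)

    -- In `χ-2-odd` the factor (2 / p) equals `triangular` by `χ-2`, and the two cancel.
    eisenstein : ∀ c → + p ∤ + suc (c ℕ.+ c) → χ p (+ suc (c ℕ.+ c)) ≡
                 ∏ {h} (λ i → -1^ ((suc (c ℕ.+ c) ℕ.* suc (toℕ i)) ℕ./ p))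
    eisenstein c p∤b = trans (χ-2-odd c p∤b) (trans
      (cong (Sign._* (∏ (floors c) Sign.* triangular)) χ-2) (cancel triangular (∏ (floors c))))
      where
      cancel : ∀ s t → s Sign.* (t Sign.* s) ≡ t
      cancel Sign.+ t      = Sign.*-identityʳ t
      cancel Sign.- Sign.+ = refl
      cancel Sign.- Sign.- = refl

  -- q* = ± q with q* ≡ 1 (mod 4), for odd q
  star : ℕ → ℤ
  star q = ⟦ -1^ ⌊ q /2⌋ ⟧ * + q

  distinct⇒∤ : ∀ {p q} → Prime p → Prime q → p ≢ q → + p ∤ + q
  distinct⇒∤ p-prime q-prime p≢q d with prime⇒irreducible q-prime (∣⇒∣ᵤ d)
  ... | inj₁ p≡1 = PrimeModulus.p∤1 p-prime (∣-reflexive (cong +_ p≡1))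
  ... | inj₂ p≡q = p≢q p≡q

  module _ {p q : ℕ} (p-prime : Prime p) (p≢2 : p ≢ 2) (q-prime : Prime q) (q≢2 : q ≢ 2)
           (p≢q : p ≢ q) where
    private
      module P = OddPrime p-prime p≢2
      module Q = OddPrime q-prime q≢2
      instance
        p≢0 = P.p≢0
        q≢0 = Q.p≢0

    -- The floor of q x / p is the number of lattice points in column x on or below the line p y = q
    -- x.
    χ-floors : χ p (+ q) ≡
      ∏ {P.h} λ i → ∏ {Q.h} λ j → p ℕ.* suc (toℕ j) ≤± q ℕ.* suc (toℕ i)
    χ-floors = begin
      χ p (+ q)
        ≡⟨ cong (λ n → χ p (+ n)) Q.p≡1+2h ⟩
      χ p (+ suc (Q.h ℕ.+ Q.h))
        ≡⟨ eisenstein p-prime p≢2 Q.h (subst (λ n → + p ∤ + n) Q.p≡1+2h (distinct⇒∤ p-prime q-prime p≢q)) ⟩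
      ∏ {P.h} (λ i → -1^ ((suc (Q.h ℕ.+ Q.h) ℕ.* suc (toℕ i)) ℕ./ p))
        ≡⟨ (∏-cong {P.h} λ i → trans
             (cong (λ n → -1^ ((n ℕ.* suc (toℕ i)) ℕ./ p)) (sym Q.p≡1+2h))
             (sym (count-multiples p Q.h (q ℕ.* suc (toℕ i)) (half-< (bound i))))) ⟩
      (∏ {P.h} λ i → ∏ {Q.h} λ j → p ℕ.* suc (toℕ j) ≤± q ℕ.* suc (toℕ i)) ∎
      where
      open ≡-Reasoning
      -- From 2x ≤ 2h < p it follows that q x < p q / 2, so the column never reaches beyond y = (q -
      -- 1) / 2.
      bound : ∀ (i : Fin P.h) → q ℕ.* suc (toℕ i) ℕ.+ q ℕ.* suc (toℕ i) ℕ.<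
                                p ℕ.* suc Q.h ℕ.+ p ℕ.* suc Q.h
      bound i = ≤R.begin-strict
        q ℕ.* suc (toℕ i) ℕ.+ q ℕ.* suc (toℕ i)
          ≤R.≡⟨ sym (ℕ.*-distribˡ-+ q (suc (toℕ i)) (suc (toℕ i))) ⟩
        q ℕ.* (suc (toℕ i) ℕ.+ suc (toℕ i))
          ≤R.<⟨ ℕ.*-monoʳ-< q (ℕ.<-≤-trans (s≤s (ℕ.+-mono-≤ (Fin.toℕ<n i) (Fin.toℕ<n i)))
                  (ℕ.≤-reflexive (sym P.p≡1+2h))) ⟩
        q ℕ.* p
          ≤R.≡⟨ ℕ.*-comm q p ⟩
        p ℕ.* q
          ≤R.≤⟨ ℕ.*-monoʳ-≤ p (ℕ.≤-trans (ℕ.≤-reflexive Q.p≡1+2h)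
                  (s≤s (ℕ.+-monoʳ-≤ Q.h (ℕ.n≤1+n Q.h)))) ⟩
        p ℕ.* (suc Q.h ℕ.+ suc Q.h)
          ≤R.≡⟨ ℕ.*-distribˡ-+ p (suc Q.h) (suc Q.h) ⟩
        p ℕ.* suc Q.h ℕ.+ p ℕ.* suc Q.h ≤R.∎
        where
        module ≤R = ℕ.≤-Reasoning

  module _ {p q : ℕ} (p-prime : Prime p) (p≢2 : p ≢ 2) (q-prime : Prime q) (q≢2 : q ≢ 2)
           (p≢q : p ≢ q) where
    private
      module P = OddPrime p-prime p≢2
      module Q = OddPrime q-prime q≢2

    -- The two symbols count the points of one rectangle on the two sides of the line p y = q x. No
    -- point lies on the line, as p divides neither q nor x, so each point is counted exactly once.
    reciprocity : χ p (+ q) Sign.* χ q (+ p) ≡ ⟨ -1^ P.h , -1^ Q.h ⟩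
    reciprocity = begin
      χ p (+ q) Sign.* χ q (+ p)
        ≡⟨ cong₂ Sign._*_ (χ-floors p-prime p≢2 q-prime q≢2 p≢q)
             (trans (χ-floors q-prime q≢2 p-prime p≢2 (p≢q ∘ sym)) (∏-comm {Q.h} {P.h} _)) ⟩
      ∏ {P.h} (λ i → ∏ {Q.h} (λ j → p ℕ.* y j ≤± q ℕ.* x i)) Sign.*
        ∏ {P.h} (λ i → ∏ {Q.h} (λ j → q ℕ.* x i ≤± p ℕ.* y j))
        ≡⟨ ∏-distrib-* {P.h} _ _ ⟨
      ∏ {P.h} (λ i → ∏ {Q.h} (λ j → p ℕ.* y j ≤± q ℕ.* x i) Sign.*
                     ∏ {Q.h} (λ j → q ℕ.* x i ≤± p ℕ.* y j))
        ≡⟨ (∏-cong {P.h} λ i → trans (sym (∏-distrib-* {Q.h} _ _))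
             (trans (∏-cong {Q.h} λ j → ≤±-antisym (py≢qx i j)) (∏-minus Q.h))) ⟩
      ∏ {P.h} (λ _ → -1^ Q.h)
        ≡⟨ ∏-const P.h (-1^ Q.h) ⟩
      ⟨ -1^ P.h , -1^ Q.h ⟩ ∎
      where
      open ≡-Reasoning
      x : Fin P.h → ℕ
      x i = suc (toℕ i)
      y : Fin Q.h → ℕ
      y j = suc (toℕ j)
      py≢qx : ∀ i j → p ℕ.* y j ≢ q ℕ.* x i
      py≢qx i j eq = PrimeModulus.p∤* p-prime (distinct⇒∤ p-prime q-prime p≢q) (P.i<h⇒p∤ i)
        (subst (+ p ∣_) (pos-* q (x i)) (∣ᵤ⇒∣ (subst (p ℕ∣.∣_) eq (ℕ∣.m∣m*n (y j)))))

    -- The sign of q* contributes (-1 / p) to the power (q - 1) / 2, which is precisely the sign in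
    -- `reciprocity`.
    star-reciprocity : χ p (star q) ≡ χ q (+ p)
    star-reciprocity = begin
      χ p (star q)
        ≡⟨ P.χ-* (p∤sign (-1^ Q.h)) (distinct⇒∤ p-prime q-prime p≢q) ⟩
      χ p ⟦ -1^ Q.h ⟧ Sign.* χ p (+ q)
        ≡⟨ cong (Sign._* χ p (+ q)) (χ-sign (-1^ Q.h)) ⟩
      ⟨ -1^ P.h , -1^ Q.h ⟩ Sign.* χ p (+ q)
        ≡⟨ cong (Sign._* χ p (+ q)) (sym reciprocity) ⟩
      χ p (+ q) Sign.* χ q (+ p) Sign.* χ p (+ q)
        ≡⟨ cancel (χ p (+ q)) (χ q (+ p)) ⟩
      χ q (+ p) ∎
      where
      open ≡-Reasoning
      p∤sign : ∀ s → + p ∤ ⟦ s ⟧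
      p∤sign Sign.+ = PrimeModulus.p∤1 p-prime
      p∤sign Sign.- d = PrimeModulus.p∤1 p-prime (∣m⇒∣-m d)
      χ-sign : ∀ s → χ p ⟦ s ⟧ ≡ ⟨ -1^ P.h , s ⟩
      χ-sign Sign.+ = trans P.χ-1 (sym (⟨,+⟩ (-1^ P.h)))
      χ-sign Sign.- = trans P.χ-minus1 (sym (⟨,-⟩ (-1^ P.h)))
      cancel : ∀ s t → s Sign.* t Sign.* s ≡ t
      cancel Sign.+ t      = Sign.*-identityʳ t
      cancel Sign.- Sign.+ = refl
      cancel Sign.- Sign.- = refl

  -- The supplementary law at 2

  private
    -- q* as a function of h = (q - 1) / 2, freed from primality so that induction on h is possible.
    signedOdd : ℕ → ℤ
    signedOdd h = ⟦ -1^ h ⟧ * + suc (h ℕ.+ h)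

    opposite⁴ : ∀ s → opposite (opposite (opposite (opposite s))) ≡ s
    opposite⁴ Sign.+ = refl
    opposite⁴ Sign.- = refl

    signedOdd-4 : ∀ h → signedOdd (4 ℕ.+ h) ≡ signedOdd h + ⟦ -1^ h ⟧ * + 8
    signedOdd-4 h = begin
      ⟦ -1^ (4 ℕ.+ h) ⟧ * + suc ((4 ℕ.+ h) ℕ.+ (4 ℕ.+ h))
        ≡⟨ cong (λ s → ⟦ s ⟧ * + suc ((4 ℕ.+ h) ℕ.+ (4 ℕ.+ h))) (opposite⁴ (-1^ h)) ⟩
      ⟦ -1^ h ⟧ * + suc ((4 ℕ.+ h) ℕ.+ (4 ℕ.+ h))
        ≡⟨ cong (λ n → ⟦ -1^ h ⟧ * + n) (regroup h) ⟩
      ⟦ -1^ h ⟧ * + (suc (h ℕ.+ h) ℕ.+ 8)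
        ≡⟨ cong (⟦ -1^ h ⟧ *_) (pos-+ (suc (h ℕ.+ h)) 8) ⟩
      ⟦ -1^ h ⟧ * (+ suc (h ℕ.+ h) + + 8)
        ≡⟨ *-distribˡ-+ ⟦ -1^ h ⟧ (+ suc (h ℕ.+ h)) (+ 8) ⟩
      signedOdd h + ⟦ -1^ h ⟧ * + 8 ∎
      where
      open ≡-Reasoning
      regroup : ∀ h → suc ((4 ℕ.+ h) ℕ.+ (4 ℕ.+ h)) ≡ suc (h ℕ.+ h) ℕ.+ 8
      regroup = ℕSolver.solve-∀

    signedOdd-≈ : ∀ h → signedOdd (4 ℕ.+ h) ≈ signedOdd h [ + 8 ]
    signedOdd-≈ h = congruent (divides ⟦ -1^ h ⟧ (trans
      (cong (_- signedOdd h) (signedOdd-4 h)) (cancel (signedOdd h) (⟦ -1^ h ⟧ * + 8))))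
      where
      cancel : ∀ x y → x + y - x ≡ y
      cancel = solve-∀

    -- Both sides have period 4 in h: `signedOdd` moves by 8 or -8, and the factors -, +, -, + of a
    -- full period multiply to +.
    χ₂-signedOdd : ∀ h → χ 2 (signedOdd h) ≡ ∏ {h} (λ i → -1^ (suc (toℕ i)))
    χ₂-signedOdd 0 = refl
    χ₂-signedOdd 1 = refl
    χ₂-signedOdd 2 = refl
    χ₂-signedOdd 3 = refl
    χ₂-signedOdd (suc (suc (suc (suc h)))) = trans
      (signOf-cong (+ 8 ∣? (signedOdd (4 ℕ.+ h) - 1ℤ)) (+ 8 ∣? (signedOdd h - 1ℤ))
        (λ d → difference (≈-trans (≈-sym (signedOdd-≈ h)) (congruent d)))
        (λ d → difference (≈-trans (signedOdd-≈ h) (congruent d))))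
      (trans (χ₂-signedOdd h) (sym (trans (rotate _)
        (∏-cong {h} λ i → opposite⁴ (-1^ (suc (toℕ i)))))))
      where
      rotate : ∀ s → Sign.- Sign.* (Sign.+ Sign.* (Sign.- Sign.* (Sign.+ Sign.* s))) ≡ s
      rotate Sign.+ = refl
      rotate Sign.- = refl

    signedOdd≈1 : ∀ h → signedOdd h ≈ 1ℤ [ + 4 ]
    signedOdd≈1 0 = ≈-refl
    signedOdd≈1 1 = congruent (divides -1ℤ refl)
    signedOdd≈1 2 = congruent (divides 1ℤ refl)
    signedOdd≈1 3 = congruent (divides (- + 2) refl)
    signedOdd≈1 (suc (suc (suc (suc h)))) = ≈-trans
      (congruent (∣-trans (divides (+ 2) refl) (difference (signedOdd-≈ h)))) (signedOdd≈1 h)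

  module _ {q : ℕ} (q-prime : Prime q) (q≢2 : q ≢ 2) where
    private
      module Q = OddPrime q-prime q≢2
      star≡ : star q ≡ signedOdd Q.h
      star≡ = cong (λ n → ⟦ -1^ Q.h ⟧ * + n) Q.p≡1+2h

    star-≈1 : star q ≈ 1ℤ [ + 4 ]
    star-≈1 = ≈-trans (≈-reflexive star≡) (signedOdd≈1 Q.h)

    χ₂-star : χ 2 (star q) ≡ χ q (+ 2)
    χ₂-star = trans (cong (χ 2) star≡) (trans (χ₂-signedOdd Q.h) (sym (χ-2 q-prime q≢2)))

-- Valuations and the tame symbol

module TameSymbol where
  open Congruences
  open SignProducts
  open LegendreSymbol
  open QuadraticReciprocity
  open import Defs using (module Padic)
  open import Data.Nat.Base as ℕ using (ℕ; zero; suc; NonZero; s≤s)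
  import Data.Nat.Properties as ℕ
  import Data.Nat.Divisibility as ℕ∣
  open import Data.Nat.Primality using (Prime; prime?; prime⇒nonZero; prime[2])
  open import Data.Integer.Base hiding (suc; NonZero)
  open import Data.Integer.Properties
  open import Data.Integer.Divisibility.Signed
  open import Data.Integer.DivMod using (_%ℕ_; _/ℕ_; a≡a%ℕn+[a/ℕn]*n; n%ℕd<d)
  open import Data.Integer.Tactic.RingSolver using (solve-∀)
  open import Data.Sign.Base as Sign using (Sign)
  import Data.Sign.Properties as Sign
  open import Algebra.Bundles using (CommutativeMonoid)
  open import Algebra.Properties.CommutativeSemigroup
    (CommutativeMonoid.commutativeSemigroup Sign.*-commutativeMonoid) using (interchange)
  open import Data.Product.Base using (_×_; _,_; proj₁; proj₂)
  open import Data.Sum.Base using (_⊎_; inj₁; inj₂)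
  open import Function.Base using (_∘_)
  open import Relation.Nullary using (¬_; contradiction; Dec; yes; no)
  open import Relation.Binary.PropositionalEquality

  record Split (p : ℕ) (a : ℤ) : Set where
    constructor split
    field
      exponent : ℕ
      unit     : ℤ
      p∤unit   : + p ∤ unit
      eq       : a ≡ (+ p) ^ exponent * unit

  pos-^ : ∀ p k → + (p ℕ.^ k) ≡ (+ p) ^ k
  pos-^ p zero    = refl
  pos-^ p (suc k) = trans (pos-* p (p ℕ.^ k)) (cong (+ p *_) (pos-^ p k))

  module _ {p : ℕ} (p-prime : Prime p) where
    open PrimeModulus p-prime
    private instance
      p≢0 : NonZero p
      p≢0 = prime⇒nonZero p-prime

    splitting : ∀ a → a ≢ 0ℤ → Split p a
    splitting a a≢0
      with k , b , p∤b , eq ← Padic.p-part p p-prime ∣ a ∣ {{ℕ.≢-nonZero (a≢0 ∘ ∣i∣≡0⇒i≡0)}} =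
      split k (sign a ◃ b) (λ d → p∤b (subst (p ℕ∣.∣_) (abs-◃ (sign a) b) (∣⇒∣ᵤ d))) (begin
        a                             ≡⟨ ◃-inverse a ⟨
        sign a ◃ ∣ a ∣                ≡⟨ cong (sign a ◃_) eq ⟩
        sign a ◃ p ℕ.^ k ℕ.* b        ≡⟨ cong (_◃ p ℕ.^ k ℕ.* b) (Sign.*-identityˡ (sign a)) ⟨
        (Sign.+ Sign.* sign a) ◃ p ℕ.^ k ℕ.* b ≡⟨ ◃-distrib-* Sign.+ (sign a) (p ℕ.^ k) b ⟩
        (Sign.+ ◃ p ℕ.^ k) * (sign a ◃ b) ≡⟨ cong (_* (sign a ◃ b)) (+◃n≡+n (p ℕ.^ k)) ⟩
        + (p ℕ.^ k) * (sign a ◃ b)    ≡⟨ cong (_* (sign a ◃ b)) (pos-^ p k) ⟩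
        (+ p) ^ k * (sign a ◃ b)        ∎)
      where open ≡-Reasoning

    split-unique : ∀ {u v} k l → + p ∤ u → + p ∤ v → (+ p) ^ k * u ≡ (+ p) ^ l * v → k ≡ l × u ≡ v
    split-unique {u} {v} zero    zero    _   _   eq =
      refl , trans (sym (*-identityˡ u)) (trans eq (*-identityˡ v))
    split-unique {u} {v} zero    (suc l) p∤u _   eq = contradiction
      (divides ((+ p) ^ l * v) (trans (sym (*-identityˡ u)) (trans eq (rotate (+ p) ((+ p) ^ l) v)))) p∤u
      where
      rotate : ∀ a b c → a * b * c ≡ b * c * a
      rotate = solve-∀
    split-unique {u} {v} (suc k) zero    _   p∤v eq = contradiction
      (divides ((+ p) ^ k * u) (trans (sym (*-identityˡ v)) (trans (sym eq) (rotate (+ p) ((+ p) ^ k) u)))) p∤v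
      where
      rotate : ∀ a b c → a * b * c ≡ b * c * a
      rotate = solve-∀
    split-unique {u} {v} (suc k) (suc l) p∤u p∤v eq
      with refl , u≡v ← split-unique k l p∤u p∤v (*-cancelˡ-≡ (+ p) _ _
             (trans (sym (*-assoc (+ p) _ u)) (trans eq (*-assoc (+ p) _ v)))) = refl , u≡v

  -- Junk value (+ , +) when p is not prime or a = 0.
  local : ℕ → ℤ → Sign × Sign
  local p a with prime? p | a ≟ 0ℤ
  ... | no _        | _     = Sign.+ , Sign.+
  ... | yes _       | yes _ = Sign.+ , Sign.+
  ... | yes p-prime | no a≢0 = let open Split (splitting p-prime a a≢0) in -1^ exponent , χ p unit

  -- ν is the parity of the valuation, κ the quadratic character of the unit part.
  ν κ : ℕ → ℤ → Sign
  ν p a = proj₁ (local p a)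
  κ p a = proj₂ (local p a)

  local-nonprime : ∀ {p} a → ¬ Prime p → local p a ≡ (Sign.+ , Sign.+)
  local-nonprime {p} a ¬p with prime? p | a ≟ 0ℤ
  ... | no _  | _ = refl
  ... | yes p-prime | _ = contradiction p-prime ¬p

  ⟨⟩-distribʳ : ∀ s t u → ⟨ s Sign.* t , u ⟩ ≡ ⟨ s , u ⟩ Sign.* ⟨ t , u ⟩
  ⟨⟩-distribʳ Sign.+ t      u = refl
  ⟨⟩-distribʳ Sign.- Sign.+ u = sym (Sign.*-identityʳ u)
  ⟨⟩-distribʳ Sign.- Sign.- u = sym (Sign.s*s≡+ u)

  ⟨⟩-distribˡ : ∀ s t u → ⟨ s , t Sign.* u ⟩ ≡ ⟨ s , t ⟩ Sign.* ⟨ s , u ⟩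
  ⟨⟩-distribˡ Sign.+ t u = refl
  ⟨⟩-distribˡ Sign.- t u = refl

  -- For a = p^α u, b = p^β v and ε = (-1 / p) this is the classical (-1 / p)^(α β) (u / p)^β (v /
  -- p)^α, the exponents being read modulo 2.
  tame : Sign → Sign × Sign → Sign × Sign → Sign
  tame ε (α , s) (β , t) = ⟨ α , ⟨ β , ε ⟩ ⟩ Sign.* ⟨ s , β ⟩ Sign.* ⟨ t , α ⟩

  tame-unitˡ : ∀ ε {s β t} → tame ε (Sign.+ , s) (β , t) ≡ ⟨ s , β ⟩
  tame-unitˡ ε {s} {β} {t} rewrite ⟨,+⟩ t = Sign.*-identityʳ ⟨ s , β ⟩

  tame-unitʳ : ∀ ε {α s t} → tame ε (α , s) (Sign.+ , t) ≡ ⟨ t , α ⟩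
  tame-unitʳ ε {α} {s} rewrite ⟨,+⟩ α | ⟨,+⟩ s = refl

  tame-*ˡ : ∀ ε α s α′ s′ b → tame ε (α Sign.* α′ , s Sign.* s′) b ≡
            tame ε (α , s) b Sign.* tame ε (α′ , s′) b
  tame-*ˡ ε α s α′ s′ (β , t)
    rewrite ⟨⟩-distribʳ α α′ ⟨ β , ε ⟩ | ⟨⟩-distribʳ s s′ β | ⟨⟩-distribˡ t α α′ =
    trans (cong (Sign._* _) (interchange ⟨ α , ⟨ β , ε ⟩ ⟩ _ ⟨ s , β ⟩ _))
      (interchange (⟨ α , ⟨ β , ε ⟩ ⟩ Sign.* ⟨ s , β ⟩) _ ⟨ t , α ⟩ _)

  tame-*ʳ : ∀ ε a β t β′ t′ → tame ε a (β Sign.* β′ , t Sign.* t′) ≡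
            tame ε a (β , t) Sign.* tame ε a (β′ , t′)
  tame-*ʳ ε (α , s) β t β′ t′
    rewrite ⟨⟩-distribʳ β β′ ε | ⟨⟩-distribˡ α ⟨ β , ε ⟩ ⟨ β′ , ε ⟩
          | ⟨⟩-distribˡ s β β′ | ⟨⟩-distribʳ t t′ α =
    trans (cong (Sign._* _) (interchange ⟨ α , ⟨ β , ε ⟩ ⟩ _ ⟨ s , β ⟩ _))
      (interchange (⟨ α , ⟨ β , ε ⟩ ⟩ Sign.* ⟨ s , β ⟩) _ ⟨ t , α ⟩ _)

  -- The tame symbol for odd p; for p = 2 it is the Hilbert symbol provided that
  -- b ≡ 1 (mod 4).
  T : ℕ → ℤ → ℤ → Sign
  T p a b = tame (χ p -1ℤ) (local p a) (local p b)

  T-cong : ∀ p {a b s t} → local p a ≡ s → local p b ≡ t → T p a b ≡ tame (χ p -1ℤ) s t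
  T-cong p = cong₂ (tame (χ p -1ℤ))

  module _ {p : ℕ} (p-prime : Prime p) where
    open PrimeModulus p-prime
    open Split
    private instance
      p≢0 : NonZero p
      p≢0 = prime⇒nonZero p-prime

    split≢0 : ∀ {u} k → + p ∤ u → (+ p) ^ k * u ≢ 0ℤ
    split≢0 {u} k p∤u eq with i*j≡0⇒i≡0∨j≡0 ((+ p) ^ k) eq
    ... | inj₁ p^k≡0 = ℕ.≢-nonZero⁻¹ p (+-injective (i^n≡0⇒i≡0 (+ p) k p^k≡0))
    ... | inj₂ u≡0   = p∤u (subst (+ p ∣_) (sym u≡0) (divides 0ℤ refl))

    -- `local` uses a splitting of its own; by uniqueness any other computes the same pair.
    local-char : ∀ {a} (s : Split p a) → local p a ≡ (-1^ (exponent s) , χ p (unit s))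
    local-char {a} (split k u p∤u eq) with prime? p | a ≟ 0ℤ
    ... | no ¬p | _ = contradiction p-prime ¬p
    ... | yes _ | yes a≡0 = contradiction (trans (sym eq) a≡0) (split≢0 k p∤u)
    ... | yes p′ | no a≢0
      with k≡ , u≡ ← split-unique p-prime (exponent (splitting p′ a a≢0)) k
             (p∤unit (splitting p′ a a≢0)) p∤u (trans (sym (Split.eq (splitting p′ a a≢0))) eq) =
      cong₂ (λ k u → -1^ k , χ p u) k≡ u≡

    split-* : ∀ {a b} → Split p a → Split p b → Split p (a * b)
    split-* {a} {b} (split k u p∤u eq) (split l v p∤v eq′) =
      split (k ℕ.+ l) (u * v) (p∤* p∤u p∤v) (begin
        a * b                          ≡⟨ cong₂ _*_ eq eq′ ⟩
        ((+ p) ^ k * u) * ((+ p) ^ l * v)  ≡⟨ swap ((+ p) ^ k) u ((+ p) ^ l) v ⟩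
        ((+ p) ^ k * (+ p) ^ l) * (u * v)  ≡⟨ cong (_* (u * v)) (^-distribˡ-+-* (+ p) k l) ⟨
        (+ p) ^ (k ℕ.+ l) * (u * v)      ∎)
      where
      open ≡-Reasoning
      swap : ∀ a b c d → a * b * (c * d) ≡ a * c * (b * d)
      swap = solve-∀

    ν-* : ∀ {a b} → a ≢ 0ℤ → b ≢ 0ℤ → ν p (a * b) ≡ ν p a Sign.* ν p b
    ν-* {a} {b} a≢0 b≢0 = trans (cong proj₁ (local-char (split-* s t)))
      (trans (-1^-+ (exponent s) (exponent t))
        (sym (cong₂ Sign._*_ (cong proj₁ (local-char s)) (cong proj₁ (local-char t)))))
      where
      s = splitting p-prime a a≢0
      t = splitting p-prime b b≢0

    local-unit : ∀ {a} → + p ∤ a → local p a ≡ (Sign.+ , χ p a)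
    local-unit {a} p∤a = local-char (split 0 a p∤a (sym (*-identityˡ a)))

    module _ (p≢2 : p ≢ 2) where
      open OddPrime p-prime p≢2 using (χ-*)

      local-* : ∀ {a b} → a ≢ 0ℤ → b ≢ 0ℤ →
                local p (a * b) ≡ (ν p a Sign.* ν p b , κ p a Sign.* κ p b)
      local-* {a} {b} a≢0 b≢0 = cong₂ _,_ (ν-* a≢0 b≢0)
        (trans (cong proj₂ (local-char (split-* s t))) (trans (χ-* (p∤unit s) (p∤unit t))
          (sym (cong₂ Sign._*_ (cong proj₂ (local-char s)) (cong proj₂ (local-char t))))))
        where
        s = splitting p-prime a a≢0
        t = splitting p-prime b b≢0

  even∨odd : ∀ a → (+ 2 ∣ a) ⊎ (+ 2 ∣ a - 1ℤ)
  even∨odd a with a %ℕ 2 | a /ℕ 2 | a≡a%ℕn+[a/ℕn]*n a 2 | n%ℕd<d a 2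
  ... | 0 | q | eq | _ = inj₁ (divides q (trans eq (+-identityˡ _)))
  ... | 1 | q | eq | _ = inj₂ (divides q (trans (cong (_- 1ℤ) eq) (cancel q)))
    where
    cancel : ∀ q → 1ℤ + q * + 2 - 1ℤ ≡ q * + 2
    cancel = solve-∀
  ... | suc (suc _) | _ | _ | s≤s (s≤s ())

  2∤1mod4 : ∀ {b} → b ≈ 1ℤ [ + 4 ] → + 2 ∤ b
  2∤1mod4 {b} (congruent d) 2∣b = PrimeModulus.p∤1 prime[2] (subst (+ 2 ∣_) (cancel b)
    (∣m∣n⇒∣m-n 2∣b (∣-trans (divides (+ 2) refl) d)))
    where
    cancel : ∀ b → b - (b - 1ℤ) ≡ 1ℤ
    cancel = solve-∀

  1mod4≢0 : ∀ {b} → b ≈ 1ℤ [ + 4 ] → b ≢ 0ℤ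
  1mod4≢0 e refl = 2∤1mod4 e (divides 0ℤ refl)

  -- A number ≡ 1 (mod 4) is 1 or 5 modulo 8 according to the parity of its quotient by 4, and 5 · 5
  -- = 1 + 3 · 8.
  χ₂-* : ∀ {a b} → a ≈ 1ℤ [ + 4 ] → b ≈ 1ℤ [ + 4 ] → χ 2 (a * b) ≡ χ 2 a Sign.* χ 2 b
  χ₂-* {a} {b} (congruent (divides s a-1≡)) (congruent (divides t b-1≡))
    with even∨odd s | even∨odd t
  ... | inj₁ 2∣s | _ = trans
    (signOf-cong (+ 8 ∣? (a * b - 1ℤ)) (+ 8 ∣? (b - 1ℤ))
      (λ d → difference (≈-trans (≈-sym ab≈b) (congruent d)))
      (λ d → difference (≈-trans ab≈b (congruent d))))
    (cong (Sign._* χ 2 b) (sym (signOf-yes (+ 8 ∣? (a - 1ℤ)) 8∣a-1)))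
    where
    8∣a-1 : + 8 ∣ a - 1ℤ
    8∣a-1 = subst (+ 8 ∣_) (sym a-1≡) (*-monoˡ-∣ (+ 4) 2∣s)
    ab≈b : a * b ≈ b [ + 8 ]
    ab≈b = ≈-trans (≈-* {a = a} {b = 1ℤ} {c = b} {d = b} (congruent 8∣a-1) ≈-refl) (≈-reflexive (*-identityˡ b))
  ... | inj₂ _ | inj₁ 2∣t = trans
    (signOf-cong (+ 8 ∣? (a * b - 1ℤ)) (+ 8 ∣? (a - 1ℤ))
      (λ d → difference (≈-trans (≈-sym ab≈a) (congruent d)))
      (λ d → difference (≈-trans ab≈a (congruent d))))
    (trans (sym (Sign.*-identityʳ (χ 2 a)))
      (cong (χ 2 a Sign.*_) (sym (signOf-yes (+ 8 ∣? (b - 1ℤ)) 8∣b-1))))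
    where
    8∣b-1 : + 8 ∣ b - 1ℤ
    8∣b-1 = subst (+ 8 ∣_) (sym b-1≡) (*-monoˡ-∣ (+ 4) 2∣t)
    ab≈a : a * b ≈ a [ + 8 ]
    ab≈a = ≈-trans (≈-* {a = a} {b = a} {c = b} {d = 1ℤ} ≈-refl (congruent 8∣b-1)) (≈-reflexive (*-identityʳ a))
  ... | inj₂ 2∣s-1 | inj₂ 2∣t-1 = trans
    (signOf-yes (+ 8 ∣? (a * b - 1ℤ)) (difference (≈-trans (≈-* (≈5 a s a-1≡ 2∣s-1) (≈5 b t b-1≡ 2∣t-1))
      (congruent (divides (+ 3) refl)))))
    (sym (cong₂ Sign._*_ (signOf-no (+ 8 ∣? (a - 1ℤ)) (8∤ a (≈5 a s a-1≡ 2∣s-1)))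
                         (signOf-no (+ 8 ∣? (b - 1ℤ)) (8∤ b (≈5 b t b-1≡ 2∣t-1)))))
    where
    ≈5 : ∀ a s → a - 1ℤ ≡ s * + 4 → + 2 ∣ s - 1ℤ → a ≈ + 5 [ + 8 ]
    ≈5 a s a-1≡ 2∣s-1 = congruent (subst (+ 8 ∣_)
      (trans (expand s) (trans (cong (_- + 4) (sym a-1≡)) (shift a))) (*-monoˡ-∣ (+ 4) 2∣s-1))
      where
      expand : ∀ s → (s - 1ℤ) * + 4 ≡ s * + 4 - + 4
      expand = solve-∀
      shift : ∀ a → a - 1ℤ - + 4 ≡ a - + 5
      shift = solve-∀
    8∤ : ∀ a → a ≈ + 5 [ + 8 ] → + 8 ∤ a - 1ℤ
    8∤ a e d with ∣⇒∣ᵤ (difference (≈-trans (≈-sym (congruent d)) e))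
    ... | ℕ∣.divides zero ()
    ... | ℕ∣.divides (suc _) ()

  local₂ : ∀ {b} → b ≈ 1ℤ [ + 4 ] → local 2 b ≡ (Sign.+ , χ 2 b)
  local₂ b≈1 = local-unit prime[2] (2∤1mod4 b≈1)

  -- The values of χ 2 at -1 and at the odd part of a have no meaning, but `tame` pairs them with
  -- the valuation of b, which is 0.
  T₂ : ∀ a b → b ≈ 1ℤ [ + 4 ] → T 2 a b ≡ ⟨ χ 2 b , ν 2 a ⟩
  T₂ a b b≈1 = trans (T-cong 2 {a} {b} {local 2 a} {Sign.+ , χ 2 b} refl (local₂ b≈1))
    (tame-unitʳ (χ 2 -1ℤ) {ν 2 a} {κ 2 a} {χ 2 b})

  module _ {p : ℕ} (p-prime : Prime p) where

    T-*ˡ : ∀ {a b c} → a ≢ 0ℤ → b ≢ 0ℤ → c ≈ 1ℤ [ + 4 ] → T p (a * b) c ≡ T p a c Sign.* T p b c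
    T-*ˡ {a} {b} {c} a≢0 b≢0 c≈1 = cases (p ℕ.≟ 2)
      where
      cases : Dec (p ≡ 2) → T p (a * b) c ≡ T p a c Sign.* T p b c
      -- κ 2 is not multiplicative, as 3 · 5 ≡ 7 (mod 8) shows; at 2 only ν enters in the first
      -- argument.
      cases (yes refl) = trans (T₂ (a * b) c c≈1)
        (trans (cong ⟨ χ 2 c ,_⟩ (ν-* p-prime a≢0 b≢0))
        (trans (⟨⟩-distribˡ (χ 2 c) (ν 2 a) (ν 2 b))
        (sym (cong₂ Sign._*_ (T₂ a c c≈1) (T₂ b c c≈1)))))
      cases (no p≢2) = trans
        (T-cong p {b = c} (local-* p-prime p≢2 a≢0 b≢0) refl)
        (tame-*ˡ (χ p -1ℤ) (ν p a) (κ p a) (ν p b) (κ p b) (local p c))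

    T-*ʳ : ∀ {a b c} → b ≈ 1ℤ [ + 4 ] → c ≈ 1ℤ [ + 4 ] → T p a (b * c) ≡ T p a b Sign.* T p a c
    T-*ʳ {a} {b} {c} b≈1 c≈1 = cases (p ℕ.≟ 2)
      where
      cases : Dec (p ≡ 2) → T p a (b * c) ≡ T p a b Sign.* T p a c
      cases (yes refl) = trans (T₂ a (b * c) (≈-* b≈1 c≈1))
        (trans (cong ⟨_, ν 2 a ⟩ (χ₂-* b≈1 c≈1))
        (trans (⟨⟩-distribʳ (χ 2 b) (χ 2 c) (ν 2 a))
        (sym (cong₂ Sign._*_ (T₂ a b b≈1) (T₂ a c c≈1)))))
      cases (no p≢2) = trans
        (T-cong p {a} refl (local-* p-prime p≢2 (1mod4≢0 b≈1) (1mod4≢0 c≈1)))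
        (tame-*ʳ (χ p -1ℤ) (local p a) (ν p b) (κ p b) (ν p c) (κ p c))

-- The product formula for T

module HilbertReciprocity where
  open Congruences
  open SignProducts
  open LegendreSymbol
  open QuadraticReciprocity
  open TameSymbol
  open import Data.Nat.Base as ℕ using (ℕ; zero; suc; ⌊_/2⌋; NonZero; s≤s)
  import Data.Nat.Properties as ℕ
  import Data.Nat.Divisibility as ℕ∣
  open import Data.Nat.ListAction using (product)
  open import Data.Nat.Primality using (Prime; prime?; prime⇒nonZero; productOfPrimes≢0)
  open import Data.Nat.Primality.Factorisation using (PrimeFactorisation; factorise)
  open import Data.List.Base using (List; []; _∷_)
  open import Data.List.Relation.Unary.All using (All; []; _∷_)
  open import Data.Integer.Base hiding (suc; NonZero)
  open import Data.Integer.Properties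
  open import Data.Integer.Divisibility.Signed
  open import Data.Integer.Tactic.RingSolver using (solve-∀)
  open import Data.Sign.Base as Sign using (Sign; opposite)
  import Data.Sign.Properties as Sign
  open import Algebra.Bundles using (CommutativeMonoid)
  open import Algebra.Properties.CommutativeSemigroup
    (CommutativeMonoid.commutativeSemigroup Sign.*-commutativeMonoid) using (interchange)
  open import Data.Fin.Base using (zero; suc; toℕ)
  open import Data.Product.Base using (_,_)
  open import Data.Sum.Base using (_⊎_; inj₁; inj₂; [_,_]′)
  open import Function.Base using (_∘_)
  open import Relation.Nullary using (¬_; contradiction; Dec; yes; no)
  open import Relation.Binary.PropositionalEquality

  T-nonprime : ∀ {p} a b → ¬ Prime p → T p a b ≡ Sign.+
  T-nonprime {p} a b ¬p = T-cong p (local-nonprime a ¬p) (local-nonprime b ¬p)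

  T-all-*ˡ : ∀ p {a b c} → a ≢ 0ℤ → b ≢ 0ℤ → c ≈ 1ℤ [ + 4 ] → T p (a * b) c ≡ T p a c Sign.* T p b c
  T-all-*ˡ p {a} {b} {c} a≢0 b≢0 c≈1 = cases (prime? p)
    where
    cases : Dec (Prime p) → T p (a * b) c ≡ T p a c Sign.* T p b c
    cases (yes p-prime) = T-*ˡ p-prime a≢0 b≢0 c≈1
    cases (no ¬p) = trans (T-nonprime (a * b) c ¬p)
      (sym (cong₂ Sign._*_ (T-nonprime a c ¬p) (T-nonprime b c ¬p)))

  T-all-*ʳ : ∀ p {a b c} → b ≈ 1ℤ [ + 4 ] → c ≈ 1ℤ [ + 4 ] → T p a (b * c) ≡ T p a b Sign.* T p a c
  T-all-*ʳ p {a} {b} {c} b≈1 c≈1 = cases (prime? p)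
    where
    cases : Dec (Prime p) → T p a (b * c) ≡ T p a b Sign.* T p a c
    cases (yes p-prime) = T-*ʳ p-prime {a} b≈1 c≈1
    cases (no ¬p) = trans (T-nonprime a (b * c) ¬p)
      (sym (cong₂ Sign._*_ (T-nonprime a b ¬p) (T-nonprime a c ¬p)))

  sign-*′ : ∀ {a b} → a ≢ 0ℤ → b ≢ 0ℤ → sign (a * b) ≡ sign a Sign.* sign b
  sign-*′ {a} {b} a≢0 b≢0 = sign-* a b {{≢-nonZero ([ a≢0 , b≢0 ]′ ∘ i*j≡0⇒i≡0∨j≡0 a)}}

  -- ⟨ sign a , sign b ⟩ is the Hilbert symbol at ∞.
  S : ℕ → ℤ → ℤ → Sign
  S N a b = ∏ {N} (λ i → T (toℕ i) a b) Sign.* ⟨ sign a , sign b ⟩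

  -- The cut-off N does not vary with the arguments, so multiplicativity holds place by place.
  S-*ˡ : ∀ N {a b c} → a ≢ 0ℤ → b ≢ 0ℤ → c ≈ 1ℤ [ + 4 ] → S N (a * b) c ≡ S N a c Sign.* S N b c
  S-*ˡ N {a} {b} {c} a≢0 b≢0 c≈1 = trans
    (cong₂ Sign._*_
      (trans (∏-cong {N} (λ i → T-all-*ˡ (toℕ i) a≢0 b≢0 c≈1))
        (∏-distrib-* {N} (λ i → T (toℕ i) a c) (λ i → T (toℕ i) b c)))
      (trans (cong ⟨_, sign c ⟩ (sign-*′ a≢0 b≢0)) (⟨⟩-distribʳ (sign a) (sign b) (sign c))))
    (interchange (∏ {N} (λ i → T (toℕ i) a c)) (∏ {N} (λ i → T (toℕ i) b c))
      ⟨ sign a , sign c ⟩ ⟨ sign b , sign c ⟩)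

  S-*ʳ : ∀ N {a b c} → b ≈ 1ℤ [ + 4 ] → c ≈ 1ℤ [ + 4 ] → S N a (b * c) ≡ S N a b Sign.* S N a c
  S-*ʳ N {a} {b} {c} b≈1 c≈1 = trans
    (cong₂ Sign._*_
      (trans (∏-cong {N} (λ i → T-all-*ʳ (toℕ i) {a} b≈1 c≈1))
        (∏-distrib-* {N} (λ i → T (toℕ i) a b) (λ i → T (toℕ i) a c)))
      (trans (cong ⟨ sign a ,_⟩ (sign-*′ (1mod4≢0 b≈1) (1mod4≢0 c≈1)))
        (⟨⟩-distribˡ (sign a) (sign b) (sign c))))
    (interchange (∏ {N} (λ i → T (toℕ i) a b)) (∏ {N} (λ i → T (toℕ i) a c))
      ⟨ sign a , sign b ⟩ ⟨ sign a , sign c ⟩)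

  ∏-trivial : ∀ N {f : ℕ → Sign} → (∀ p → f p ≡ Sign.+) → ∏ {N} (f ∘ toℕ) ≡ Sign.+
  ∏-trivial N f≡+ = trans (∏-cong {N} (f≡+ ∘ toℕ)) (∏-plus N)

  ∏-single : ∀ {N f} q → q ℕ.< N → (∀ p → p ≢ q → f p ≡ Sign.+) → ∏ {N} (f ∘ toℕ) ≡ f q
  ∏-single {suc N} {f} zero _ f≡+ = trans
    (cong (f 0 Sign.*_) (∏-trivial N {f ∘ suc} (λ p → f≡+ (suc p) λ ()))) (Sign.*-identityʳ (f 0))
  ∏-single {suc N} {f} (suc q) (s≤s q<N) f≡+ = cong₂ Sign._*_ (f≡+ 0 λ ())
    (∏-single {N} {f ∘ suc} q q<N λ p p≢q → f≡+ (suc p) (p≢q ∘ ℕ.suc-injective))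

  -- f is split as `at` times `off`, its value at q and the rest; each factor is nontrivial at no
  -- more than one index.
  ∏-pair : ∀ {N f} q r → q ≢ r → q ℕ.< N → r ℕ.< N → (∀ p → p ≢ q → p ≢ r → f p ≡ Sign.+) →
           ∏ {N} (f ∘ toℕ) ≡ f q Sign.* f r
  ∏-pair {N} {f} q r q≢r q<N r<N f≡+ = begin
    ∏ {N} (f ∘ toℕ)
      ≡⟨ ∏-cong {N} (λ i → sym (at-off (toℕ i))) ⟩
    ∏ {N} (λ i → at (toℕ i) Sign.* off (toℕ i))
      ≡⟨ ∏-distrib-* {N} (at ∘ toℕ) (off ∘ toℕ) ⟩
    ∏ {N} (at ∘ toℕ) Sign.* ∏ {N} (off ∘ toℕ)
      ≡⟨ cong₂ Sign._*_ (trans (∏-single {N} {at} q q<N at-trivial) at-q)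
           (trans (∏-single {N} {off} r r<N off-trivial) off-r) ⟩
    f q Sign.* f r ∎
    where
    open ≡-Reasoning
    at off : ℕ → Sign
    at p with p ℕ.≟ q
    ... | yes _ = f p
    ... | no  _ = Sign.+
    off p with p ℕ.≟ q
    ... | yes _ = Sign.+
    ... | no  _ = f p
    at-off : ∀ p → at p Sign.* off p ≡ f p
    at-off p with p ℕ.≟ q
    ... | yes _ = Sign.*-identityʳ (f p)
    ... | no  _ = refl
    at-trivial : ∀ p → p ≢ q → at p ≡ Sign.+
    at-trivial p p≢q with p ℕ.≟ q
    ... | yes p≡q = contradiction p≡q p≢q
    ... | no  _   = refl
    off-trivial : ∀ p → p ≢ r → off p ≡ Sign.+
    off-trivial p p≢r with p ℕ.≟ q
    ... | yes _   = refl
    ... | no  p≢q = f≡+ p p≢q p≢r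
    at-q : at q ≡ f q
    at-q with q ℕ.≟ q
    ... | yes _   = refl
    ... | no  q≢q = contradiction refl q≢q
    off-r : off r ≡ f r
    off-r with r ℕ.≟ q
    ... | yes r≡q = contradiction (sym r≡q) q≢r
    ... | no  _   = refl

  p∤⟦⟧ : ∀ {p} → Prime p → ∀ s → + p ∤ ⟦ s ⟧
  p∤⟦⟧ p-prime Sign.+ = PrimeModulus.p∤1 p-prime
  p∤⟦⟧ p-prime Sign.- d = PrimeModulus.p∤1 p-prime (∣m⇒∣-m d)

  module _ {q : ℕ} (q-prime : Prime q) (q≢2 : q ≢ 2) where
    private
      module Q = OddPrime q-prime q≢2
      ε : Sign
      ε = -1^ ⌊ q /2⌋

      local-star : local q (star q) ≡ (Sign.- , χ q ⟦ ε ⟧)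
      local-star = local-char q-prime (split 1 ⟦ ε ⟧ (p∤⟦⟧ q-prime ε) (commute ⟦ ε ⟧ (+ q)))
        where
        commute : ∀ a b → a * b ≡ b * 1ℤ * a
        commute = solve-∀

      local-star-off : ∀ {p} → Prime p → p ≢ q → local p (star q) ≡ (Sign.+ , χ p (star q))
      local-star-off p-prime p≢q = local-unit p-prime
        (PrimeModulus.p∤* p-prime (p∤⟦⟧ p-prime ε) (distinct⇒∤ p-prime q-prime p≢q))

      local-self : ∀ {p} → Prime p → local p (+ p) ≡ (Sign.- , χ p 1ℤ)
      local-self {p} p-prime = local-char p-prime
        (split 1 1ℤ (PrimeModulus.p∤1 p-prime) (commute (+ p)))
        where
        commute : ∀ b → b ≡ b * 1ℤ * 1ℤ
        commute = solve-∀

      unit-at : ∀ {p a} → Prime p → p ≢ q → + p ∤ a → T p a (star q) ≡ Sign.+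
      unit-at {p} {a} p-prime p≢q p∤a = trans
        (T-cong p (local-unit p-prime p∤a) (local-star-off p-prime p≢q))
        (trans (tame-unitˡ (χ p -1ℤ) {χ p a} {Sign.+} {χ p (star q)}) (⟨,+⟩ (χ p a)))

      support : ∀ {p a} → (Prime p → + p ∤ a) → p ≢ q → T p a (star q) ≡ Sign.+
      support {p} {a} p∤a p≢q = cases (prime? p)
        where
        cases : Dec (Prime p) → T p a (star q) ≡ Sign.+
        cases (yes p-prime) = unit-at p-prime p≢q (p∤a p-prime)
        cases (no ¬p)       = T-nonprime a (star q) ¬p

      T-at-q : ∀ {a} → + q ∤ a → T q a (star q) ≡ χ q a
      T-at-q {a} q∤a = trans (T-cong q (local-unit q-prime q∤a) local-star)
        (trans (tame-unitˡ (χ q -1ℤ) {χ q a} {Sign.-} {χ q ⟦ ε ⟧}) (⟨,-⟩ (χ q a)))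

    module _ {N : ℕ} (q<N : q ℕ.< N) where

      S-1 : S N 1ℤ (star q) ≡ Sign.+
      S-1 = trans (cong (Sign._* Sign.+) (trans
        (∏-single {N} {λ p → T p 1ℤ (star q)} q q<N
          λ p → support (λ p-prime → PrimeModulus.p∤1 p-prime))
        (trans (T-at-q (p∤⟦⟧ q-prime Sign.+)) Q.χ-1))) refl

      -- The sign (-1 / q) at q and the sign of q* at ∞ are both (-1)^((q - 1) / 2), so they cancel.
      S-minus1 : S N -1ℤ (star q) ≡ Sign.+
      S-minus1 = trans (cong₂ Sign._*_
        (trans (∏-single {N} {λ p → T p -1ℤ (star q)} q q<N
            λ p → support (λ p-prime → p∤⟦⟧ p-prime Sign.-))
          (trans (T-at-q (p∤⟦⟧ q-prime Sign.-)) Q.χ-minus1))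
        (trans (sign-*′ {⟦ ε ⟧} {+ q} (⟦⟧≢0 ε) q≢0) (trans (Sign.*-identityʳ (sign ⟦ ε ⟧)) (sign⟦⟧ ε))))
        (Sign.s*s≡+ ε)
        where
        ⟦⟧≢0 : ∀ s → ⟦ s ⟧ ≢ 0ℤ
        ⟦⟧≢0 Sign.+ ()
        ⟦⟧≢0 Sign.- ()
        q≢0 : + q ≢ 0ℤ
        q≢0 eq = ℕ.≢-nonZero⁻¹ q {{Q.p≢0}} (+-injective eq)
        sign⟦⟧ : ∀ s → sign ⟦ s ⟧ ≡ s
        sign⟦⟧ Sign.+ = refl
        sign⟦⟧ Sign.- = refl

      -- At q the tame formula gives (-1 / q) (ε / q), where ε = (-1 / q) is the sign of q*. Both
      -- factors are 1 if ε = 1, and both are -1 otherwise.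
      S-self : S N (+ q) (star q) ≡ Sign.+
      S-self = trans (cong (Sign._* Sign.+) (trans
        (∏-single {N} {λ p → T p (+ q) (star q)} q q<N
          λ p p≢q → support (λ p-prime → distinct⇒∤ p-prime q-prime p≢q) p≢q)
        (trans (T-cong q (local-self q-prime) local-star)
          (trans (cong₂ (λ s t → tame t (Sign.- , s) (Sign.- , χ q ⟦ ε ⟧)) Q.χ-1 Q.χ-minus1)
            (cancel ε refl))))) refl
        where
        cancel : ∀ s → s ≡ ε → tame s (Sign.- , Sign.+) (Sign.- , χ q ⟦ s ⟧) ≡ Sign.+
        cancel Sign.+ _ = trans (⟨,-⟩ (χ q 1ℤ)) Q.χ-1
        cancel Sign.- eq = trans (cong opposite (trans (⟨,-⟩ (χ q -1ℤ)) Q.χ-minus1)) (cong opposite (sym eq))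

      -- For ℓ ≠ q only the places ℓ and q contribute, with (q* / ℓ) and (ℓ / q); these agree by
      -- reciprocity or, for ℓ = 2, by the supplementary law.
      S-prime : ∀ {ℓ} → Prime ℓ → ℓ ℕ.< N → S N (+ ℓ) (star q) ≡ Sign.+
      S-prime {ℓ} ℓ-prime ℓ<N = cases (ℓ ℕ.≟ q)
        where
        χℓ : Dec (ℓ ≡ 2) → ℓ ≢ q → χ ℓ (star q) ≡ χ q (+ ℓ)
        χℓ (yes refl) _   = χ₂-star q-prime q≢2
        χℓ (no ℓ≢2)   ℓ≢q = star-reciprocity ℓ-prime ℓ≢2 q-prime q≢2 ℓ≢q
        cases : Dec (ℓ ≡ q) → S N (+ ℓ) (star q) ≡ Sign.+
        cases (yes refl) = S-self
        cases (no ℓ≢q) = trans (cong (Sign._* Sign.+) (trans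
          (∏-pair {N} {λ p → T p (+ ℓ) (star q)} ℓ q ℓ≢q ℓ<N q<N
            λ p p≢ℓ → support (λ p-prime → distinct⇒∤ p-prime ℓ-prime p≢ℓ))
          (trans (cong₂ Sign._*_
              (trans (T-cong ℓ (local-self ℓ-prime) (local-star-off ℓ-prime ℓ≢q))
                (trans (tame-unitʳ (χ ℓ -1ℤ) {Sign.-} {χ ℓ 1ℤ} {χ ℓ (star q)})
                  (trans (⟨,-⟩ (χ ℓ (star q))) (χℓ (ℓ ℕ.≟ 2) ℓ≢q))))
              (T-at-q (distinct⇒∤ q-prime ℓ-prime (ℓ≢q ∘ sym))))
            (Sign.s*s≡+ (χ q (+ ℓ)))))) refl

  product-head-< : ∀ {N p} ps → All Prime ps → p ℕ.* product ps ℕ.< N → p ℕ.< N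
  product-head-< {N} {p} ps ps-prime lt =
    ℕ.≤-<-trans (ℕ.m≤m*n p (product ps) {{productOfPrimes≢0 ps-prime}}) lt

  product-tail-< : ∀ {N p} ps → Prime p → p ℕ.* product ps ℕ.< N → product ps ℕ.< N
  product-tail-< {N} {p} ps p-prime lt =
    ℕ.≤-<-trans (ℕ.m≤n*m (product ps) p {{prime⇒nonZero p-prime}}) lt

  module _ {N q : ℕ} (q-prime : Prime q) (q≢2 : q ≢ 2) (q<N : q ℕ.< N) where

    S-product : ∀ {ps} → All Prime ps → product ps ℕ.< N → S N (+ product ps) (star q) ≡ Sign.+
    S-product [] _ = S-1 q-prime q≢2 q<N
    S-product {p ∷ ps} (p-prime ∷ ps-prime) lt = trans
      (cong (λ n → S N n (star q)) (pos-* p (product ps)))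
      (trans (S-*ˡ N (ℕ≢0 (prime⇒nonZero p-prime)) (ℕ≢0 (productOfPrimes≢0 ps-prime)) (star-≈1 q-prime q≢2))
        (cong₂ Sign._*_ (S-prime q-prime q≢2 q<N p-prime (product-head-< ps ps-prime lt))
          (S-product ps-prime (product-tail-< ps p-prime lt))))
      where
      ℕ≢0 : ∀ {n} → NonZero n → + n ≢ 0ℤ
      ℕ≢0 {n} n≢0 eq = ℕ.≢-nonZero⁻¹ n {{n≢0}} (+-injective eq)

    S-star : ∀ a → a ≢ 0ℤ → ∣ a ∣ ℕ.< N → S N a (star q) ≡ Sign.+
    S-star (+ zero) a≢0 _ = contradiction refl a≢0
    S-star +[1+ n ] _ lt = subst (λ m → S N (+ m) (star q) ≡ Sign.+) (sym isFactorisation)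
      (S-product factorsPrime (subst (ℕ._< N) isFactorisation lt))
      where open PrimeFactorisation (factorise (suc n))
    S-star -[1+ n ] _ lt = trans (cong (λ b → S N b (star q)) (sym (-1*i≡-i +[1+ n ])))
      (trans (S-*ˡ N { -1ℤ} {+[1+ n ]} (λ ()) (λ ()) (star-≈1 q-prime q≢2))
        (cong₂ Sign._*_ (S-minus1 q-prime q≢2 q<N) (S-star +[1+ n ] (λ ()) lt)))

  ∣i∣≡∣j∣⇒i≡±j : ∀ i j → ∣ i ∣ ≡ ∣ j ∣ → i ≡ j ⊎ i ≡ - j
  ∣i∣≡∣j∣⇒i≡±j (+ m)    (+ .m)    refl = inj₁ refl
  ∣i∣≡∣j∣⇒i≡±j +[1+ m ] -[1+ .m ] refl = inj₂ refl
  ∣i∣≡∣j∣⇒i≡±j -[1+ m ] +[1+ .m ] refl = inj₂ refl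
  ∣i∣≡∣j∣⇒i≡±j -[1+ m ] -[1+ .m ] refl = inj₁ refl

  starProduct : List ℕ → ℤ
  starProduct []       = 1ℤ
  starProduct (q ∷ qs) = star q * starProduct qs

  ∣star∣ : ∀ q → ∣ star q ∣ ≡ q
  ∣star∣ q = trans (abs-* ⟦ -1^ ⌊ q /2⌋ ⟧ (+ q))
    (trans (cong (ℕ._* q) (∣⟦⟧∣ (-1^ ⌊ q /2⌋))) (ℕ.*-identityˡ q))
    where
    ∣⟦⟧∣ : ∀ s → ∣ ⟦ s ⟧ ∣ ≡ 1
    ∣⟦⟧∣ Sign.+ = refl
    ∣⟦⟧∣ Sign.- = refl

  ∣starProduct∣ : ∀ qs → ∣ starProduct qs ∣ ≡ product qs
  ∣starProduct∣ []       = refl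
  ∣starProduct∣ (q ∷ qs) = trans (abs-* (star q) (starProduct qs))
    (cong₂ ℕ._*_ (∣star∣ q) (∣starProduct∣ qs))

  2∤product-head : ∀ {p} ps → + 2 ∤ + (p ℕ.* product ps) → p ≢ 2
  2∤product-head ps 2∤ refl = 2∤ (∣ᵤ⇒∣ (ℕ∣.m∣m*n (product ps)))

  2∤product-tail : ∀ {p} ps → + 2 ∤ + (p ℕ.* product ps) → + 2 ∤ + product ps
  2∤product-tail {p} ps 2∤ d = 2∤ (∣ᵤ⇒∣ (ℕ∣.∣n⇒∣m*n p (∣⇒∣ᵤ d)))

  starProduct-≈1 : ∀ {qs} → All Prime qs → + 2 ∤ + product qs → starProduct qs ≈ 1ℤ [ + 4 ]
  starProduct-≈1 [] _ = ≈-refl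
  starProduct-≈1 {q ∷ qs} (q-prime ∷ qs-prime) 2∤ = ≈-*
    (star-≈1 q-prime (2∤product-head qs 2∤)) (starProduct-≈1 qs-prime (2∤product-tail {q} qs 2∤))

  module _ {N : ℕ} {a : ℤ} (a≢0 : a ≢ 0ℤ) (∣a∣<N : ∣ a ∣ ℕ.< N) where

    S-starProduct : ∀ {qs} → All Prime qs → + 2 ∤ + product qs → product qs ℕ.< N →
                    S N a (starProduct qs) ≡ Sign.+
    -- By multiplicativity in b, the value at b = 1 is its own square.
    S-starProduct [] _ _ = idempotent (S N a 1ℤ) (S-*ʳ N {a} {1ℤ} {1ℤ} ≈-refl ≈-refl)
      where
      idempotent : ∀ s → s ≡ s Sign.* s → s ≡ Sign.+
      idempotent s eq = trans eq (Sign.s*s≡+ s)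
    S-starProduct {q ∷ qs} (q-prime ∷ qs-prime) 2∤ lt = trans
      (S-*ʳ N {a} (star-≈1 q-prime q≢2) (starProduct-≈1 qs-prime (2∤product-tail {q} qs 2∤)))
      (cong₂ Sign._*_ (S-star q-prime q≢2 (product-head-< qs qs-prime lt) a a≢0 ∣a∣<N)
        (S-starProduct qs-prime (2∤product-tail {q} qs 2∤) (product-tail-< qs q-prime lt)))
      where
      q≢2 = 2∤product-head qs 2∤

    -- b is the product of q* over the prime factors of its absolute value: the two agree up to
    -- sign, and being both ≡ 1 (mod 4) they cannot be opposite.
    hilbert-reciprocity : ∀ {b} → b ≈ 1ℤ [ + 4 ] → ∣ b ∣ ℕ.< N → S N a b ≡ Sign.+
    hilbert-reciprocity {b} b≈1 ∣b∣<N = trans (cong (S N a) b≡)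
      (S-starProduct factorsPrime 2∤product (subst (ℕ._< N) isFactorisation ∣b∣<N))
      where
      instance
        ∣b∣≢0 : NonZero ∣ b ∣
        ∣b∣≢0 = ℕ.≢-nonZero (1mod4≢0 b≈1 ∘ ∣i∣≡0⇒i≡0)
      open PrimeFactorisation (factorise ∣ b ∣)
      2∤product : + 2 ∤ + product factors
      2∤product d = 2∤1mod4 b≈1 (∣ᵤ⇒∣ (subst (2 ℕ∣.∣_) (sym isFactorisation) (∣⇒∣ᵤ d)))
      same-abs⇒≡ : ∀ {c} → c ≈ 1ℤ [ + 4 ] → ∣ b ∣ ≡ ∣ c ∣ → b ≡ c
      same-abs⇒≡ {c} c≈1 eq with ∣i∣≡∣j∣⇒i≡±j b c eq
      ... | inj₁ b≡c  = b≡c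
      ... | inj₂ b≡-c = contradiction
        (difference (≈-trans (≈-sym b≈1) (≈-trans (≈-reflexive b≡-c) (≈-neg c≈1)))) λ d → 4∤2 (∣⇒∣ᵤ d)
        where
        4∤2 : ¬ 4 ℕ∣.∣ 2
        4∤2 (ℕ∣.divides zero ())
        4∤2 (ℕ∣.divides (suc _) ())
      b≡ : b ≡ starProduct factors
      b≡ = same-abs⇒≡ (starProduct-≈1 factorsPrime 2∤product)
        (trans isFactorisation (sym (∣starProduct∣ factors)))

-- The symbols of X and D at the places away from n

module ErdősStrausEquation where
  open Congruences
  open SignProducts
  open LegendreSymbol
  open QuadraticReciprocity
  open TameSymbol
  open HilbertReciprocity
  open import Defs using (∏[_]_; primeDivisors)
  open import Data.Nat.Base as ℕ using (ℕ; zero; suc; z≤n; s≤s)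
  import Data.Nat.Properties as ℕ
  import Data.Nat.Divisibility as ℕ∣
  open import Data.Nat.Primality using (Prime; prime?; prime⇒nonZero)
  open import Data.List.Base using ([]; _∷_; filter; applyUpTo; upTo)
  open import Data.Integer.Base hiding (suc; NonZero)
  open import Data.Integer.Properties
  open import Data.Integer.Divisibility.Signed
  open import Data.Integer.Tactic.RingSolver using (solve-∀)
  open import Data.Sign.Base as Sign using (Sign)
  import Data.Sign.Properties as Sign
  open import Data.Fin.Base using (zero; suc; toℕ)
  open import Data.Product.Base using (∃-syntax; _×_; _,_)
  open import Data.Sum.Base using (_⊎_; inj₁; inj₂; [_,_]′)
  open import Function.Base using (_∘_; id)
  open import Relation.Nullary using (¬_; contradiction; Dec; yes; no)
  open import Relation.Binary.PropositionalEquality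
  open import Relation.Nullary.Decidable using (_×-dec_)
  open import Relation.Binary.Definitions using (tri<; tri≈; tri>)

  1mod2-square : ∀ {n} → + 2 ∤ n → n * n ≈ 1ℤ [ + 8 ]
  1mod2-square {n} 2∤n with even∨odd n
  ... | inj₁ 2∣n = contradiction 2∣n 2∤n
  ... | inj₂ (divides m n-1≡) = congruent (subst (+ 8 ∣_) factor 8∣4m[m+1])
    where
    8∣4m[m+1] : + 8 ∣ m * (m + 1ℤ) * + 4
    8∣4m[m+1] = *-monoˡ-∣ (+ 4) ([ ∣m⇒∣m*n (m + 1ℤ) , ∣n⇒∣m*n m ∘ 2∣m+1 ]′ (even∨odd m))
      where
      2∣m+1 : + 2 ∣ m - 1ℤ → + 2 ∣ m + 1ℤ
      2∣m+1 d = subst (+ 2 ∣_) (shift m) (∣m∣n⇒∣m+n d ∣-refl)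
        where
        shift : ∀ m → m - 1ℤ + + 2 ≡ m + 1ℤ
        shift = solve-∀
    factor : m * (m + 1ℤ) * + 4 ≡ n * n - 1ℤ
    factor = trans (expand m) (trans (cong (λ t → t * (t + + 2)) (sym n-1≡)) (collect n))
      where
      expand : ∀ m → m * (m + 1ℤ) * + 4 ≡ (m * + 2) * (m * + 2 + + 2)
      expand = solve-∀
      collect : ∀ n → (n - 1ℤ) * (n - 1ℤ + + 2) ≡ n * n - 1ℤ
      collect = solve-∀

  module _ {p : ℕ} (p-prime : Prime p) where
    open PrimeModulus p-prime

    private
      -- Compare valuations: the right side has valuation exactly a, while p^(a + 1) divides the
      -- left.
      unequal-exponents : ∀ {c e v w} a k → + p ∤ e → + p ∤ v →
        c * (((+ p) ^ a * v) * ((+ p) ^ (a ℕ.+ suc k) * w)) ≢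
        e * ((+ p) ^ a * v + (+ p) ^ (a ℕ.+ suc k) * w)
      unequal-exponents {c} {e} {v} {w} a k p∤e p∤v eq =
        [ p∤e , (λ d → p∤v (∣m+n∣n⇒∣m d (∣m⇒∣m*n w (∣m⇒∣m*n P^k ∣-refl)))) ]′
          (p∣*⇒ e (v + P * P^k * w) (divides (c * v * P^a * P^k * w) (sym (*-cancelˡ-≡ P^a _ _
            {{≢-nonZero (1≢0 ∘ i^n≡0⇒i≡0 P a)}} cancelled))))
        where
        P   = + p
        P^a = P ^ a
        P^k = P ^ k
        1≢0 : P ≢ 0ℤ
        1≢0 e = ℕ.≢-nonZero⁻¹ p {{prime⇒nonZero p-prime}} (+-injective e)
        pow : P ^ (a ℕ.+ suc k) ≡ P^a * (P * P^k)
        pow = ^-distribˡ-+-* P a (suc k)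
        lhs : ∀ A P c v K w → A * (c * v * A * K * w * P) ≡ c * ((A * v) * (A * (P * K) * w))
        lhs = solve-∀
        rhs : ∀ A P e v K w → e * (A * v + A * (P * K) * w) ≡ A * (e * (v + P * K * w))
        rhs = solve-∀
        cancelled : P^a * (c * v * P^a * P^k * w * P) ≡ P^a * (e * (v + P * P^k * w))
        cancelled = begin
          P^a * (c * v * P^a * P^k * w * P)
            ≡⟨ lhs P^a P c v P^k w ⟩
          c * ((P^a * v) * (P^a * (P * P^k) * w))
            ≡⟨ cong (λ t → c * ((P^a * v) * (t * w))) pow ⟨
          c * ((P^a * v) * (P ^ (a ℕ.+ suc k) * w))
            ≡⟨ eq ⟩
          e * (P^a * v + P ^ (a ℕ.+ suc k) * w)
            ≡⟨ cong (λ t → e * (P^a * v + t * w)) pow ⟩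
          e * (P^a * v + P^a * (P * P^k) * w)
            ≡⟨ rhs P^a P e v P^k w ⟩
          P^a * (e * (v + P * P^k * w)) ∎
          where open ≡-Reasoning

    equal-exponents : ∀ {c e v w} a b → + p ∤ e → + p ∤ v → + p ∤ w →
      c * (((+ p) ^ a * v) * ((+ p) ^ b * w)) ≡ e * ((+ p) ^ a * v + (+ p) ^ b * w) → a ≡ b
    equal-exponents {c} {e} {v} {w} a b p∤e p∤v p∤w eq with ℕ.<-cmp a b
    ... | tri≈ _ a≡b _ = a≡b
    ... | tri< a<b _ _ with k , refl ← ℕ.m≤n⇒∃[o]m+o≡n a<b =
      contradiction (subst (λ b → c * (((+ p) ^ a * v) * ((+ p) ^ b * w)) ≡
                                  e * ((+ p) ^ a * v + (+ p) ^ b * w)) (sym (ℕ.+-suc a k)) eq)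
        (unequal-exponents {c} {e} {v} {w} a k p∤e p∤v)
    ... | tri> _ _ b<a with k , refl ← ℕ.m≤n⇒∃[o]m+o≡n b<a =
      contradiction (subst (λ a → c * (((+ p) ^ b * w) * ((+ p) ^ a * v)) ≡
                                  e * ((+ p) ^ b * w + (+ p) ^ a * v)) (sym (ℕ.+-suc b k))
        (trans (cong (c *_) (*-comm ((+ p) ^ b * w) _)) (trans eq (cong (e *_) (+-comm _ ((+ p) ^ b * w))))))
        (unequal-exponents {c} {e} {w} {v} b k p∤e p∤w)

    -- Dividing by p^a leaves c p^a v w = e (v + w), with e prime to p.
    equal-exponents-∣ : ∀ {c e v w} a → + p ∤ e → + p ∣ c →
      c * (((+ p) ^ a * v) * ((+ p) ^ a * w)) ≡ e * ((+ p) ^ a * v + (+ p) ^ a * w) → + p ∣ v + w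
    equal-exponents-∣ {c} {e} {v} {w} a p∤e p∣c eq =
      [ (λ d → contradiction d p∤e) , id ]′ (p∣*⇒ e (v + w)
        (subst (+ p ∣_) (*-cancelˡ-≡ P^a _ _ {{≢-nonZero (p≢0 ∘ i^n≡0⇒i≡0 (+ p) a)}} cancelled)
          (∣m⇒∣m*n (P^a * (v * w)) p∣c)))
      where
      P^a = (+ p) ^ a
      p≢0 : + p ≢ 0ℤ
      p≢0 e = ℕ.≢-nonZero⁻¹ p {{prime⇒nonZero p-prime}} (+-injective e)
      lhs : ∀ A c v w → A * (c * (A * (v * w))) ≡ c * ((A * v) * (A * w))
      lhs = solve-∀
      rhs : ∀ A e v w → e * (A * v + A * w) ≡ A * (e * (v + w))
      rhs = solve-∀
      cancelled : P^a * (c * (P^a * (v * w))) ≡ P^a * (e * (v + w))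
      cancelled = trans (lhs P^a c v w) (trans eq (rhs P^a e v w))

  -- If n - 4 u₃ < 0 then u₃ > 0, so u₁ or u₂ is negative. They are not both negative, as then (n -
  -- 4 u₃) u₁ u₂ < 0 ≤ - n u₃ (u₁ + u₂). Hence u₁ u₂ < 0 and X > 0.
  sign-lemma : ∀ n u₁ u₂ u₃ → u₁ ≢ 0ℤ → u₂ ≢ 0ℤ →
    (+ n - + 4 * u₃) * (u₁ * u₂) ≡ - (+ n * u₃) * (u₁ + u₂) →
    u₁ < 0ℤ ⊎ u₂ < 0ℤ ⊎ u₃ < 0ℤ →
    ⟨ sign (- (u₁ * u₂)) , sign (+ n * (+ n - + 4 * u₃)) ⟩ ≡ Sign.+
  sign-lemma n u₁ u₂ u₃ u₁≢0 u₂≢0 eq negative = by-c (+ n - + 4 * u₃) refl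
    where
    by-signs : ∀ n u₁ u₂ l c → u₁ ≢ 0ℤ → u₂ ≢ 0ℤ → u₁ < 0ℤ ⊎ u₂ < 0ℤ →
               -[1+ c ] * (u₁ * u₂) ≡ - (+ n * +[1+ l ]) * (u₁ + u₂) → sign (- (u₁ * u₂)) ≡ Sign.+
    by-signs n +[1+ a ] -[1+ b ] l c _ _ _ _ = refl
    by-signs n -[1+ a ] +[1+ b ] l c _ _ _ _ = refl
    -- n is split so that both sides evaluate far enough for the equation to be absurd.
    by-signs zero    -[1+ a ] -[1+ b ] l c _ _ _ ()
    by-signs (suc n) -[1+ a ] -[1+ b ] l c _ _ _ ()
    by-signs n (+ zero) u₂ l c u₁≢0 _ _ _ = contradiction refl u₁≢0
    by-signs n +[1+ a ] (+ zero) l c _ u₂≢0 _ _ = contradiction refl u₂≢0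
    by-signs n -[1+ a ] (+ zero) l c _ u₂≢0 _ _ = contradiction refl u₂≢0
    by-signs n +[1+ a ] +[1+ b ] l c _ _ (inj₁ (+<+ ())) _
    by-signs n +[1+ a ] +[1+ b ] l c _ _ (inj₂ (+<+ ())) _
    by-u₃ : ∀ u₃ c → + n - + 4 * u₃ ≡ -[1+ c ] →
            -[1+ c ] * (u₁ * u₂) ≡ - (+ n * u₃) * (u₁ + u₂) →
            u₁ < 0ℤ ⊎ u₂ < 0ℤ ⊎ u₃ < 0ℤ → sign (- (u₁ * u₂)) ≡ Sign.+
    by-u₃ (+ zero)   c c≡ = contradiction c≡ λ ()
    by-u₃ -[1+ l ]   c ()
    by-u₃ +[1+ l ]   c c≡ eq (inj₁ u₁<0)        = by-signs n u₁ u₂ l c u₁≢0 u₂≢0 (inj₁ u₁<0) eq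
    by-u₃ +[1+ l ]   c c≡ eq (inj₂ (inj₁ u₂<0)) = by-signs n u₁ u₂ l c u₁≢0 u₂≢0 (inj₂ u₂<0) eq
    by-u₃ +[1+ l ]   c c≡ eq (inj₂ (inj₂ (+<+ ())))
    by-c : ∀ c → + n - + 4 * u₃ ≡ c → ⟨ sign (- (u₁ * u₂)) , sign (+ n * (+ n - + 4 * u₃)) ⟩ ≡ Sign.+
    by-c (+ c) c≡ = trans
      (cong (λ c → ⟨ sign (- (u₁ * u₂)) , sign c ⟩) (trans (cong (+ n *_) c≡) (sym (pos-* n c))))
      (⟨,+⟩ (sign (- (u₁ * u₂))))
    by-c -[1+ c ] c≡ = cong ⟨_, sign (+ n * (+ n - + 4 * u₃)) ⟩
      (by-u₃ u₃ c c≡ (subst (λ c → c * (u₁ * u₂) ≡ - (+ n * u₃) * (u₁ + u₂)) c≡ eq) negative)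

  ∏-filter : ∀ {P : ℕ → Set} (P? : ∀ p → Dec (P p)) {f} → (∀ p → ¬ P p → f p ≡ Sign.+) →
             ∀ ps → ∏[ filter P? ps ] f ≡ ∏[ ps ] f
  ∏-filter P? f≡+ [] = refl
  ∏-filter P? {f} f≡+ (p ∷ ps) with P? p
  ... | yes _  = cong (f p Sign.*_) (∏-filter P? f≡+ ps)
  ... | no  ¬P = trans (∏-filter P? f≡+ ps) (cong (Sign._* ∏[ ps ] f) (sym (f≡+ p ¬P)))

  ∏-applyUpTo : ∀ f g m → ∏[ applyUpTo g m ] f ≡ ∏ {m} (λ i → f (g (toℕ i)))
  ∏-applyUpTo f g zero    = refl
  ∏-applyUpTo f g (suc m) = cong (f (g 0) Sign.*_) (∏-applyUpTo f (g ∘ suc) m)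

  ∏-extend : ∀ {m N f} → m ℕ.≤ N → (∀ p → m ℕ.≤ p → f p ≡ Sign.+) → ∏ {m} (f ∘ toℕ) ≡ ∏ {N} (f ∘ toℕ)
  ∏-extend {N = N} {f} z≤n f≡+ = sym (∏-trivial N {f} (λ p → f≡+ p z≤n))
  ∏-extend {f = f} (s≤s m≤N) f≡+ = cong (f 0 Sign.*_)
    (∏-extend {f = f ∘ suc} m≤N (λ p m≤p → f≡+ (suc p) (s≤s m≤p)))

  module ErdősStraus (n : ℕ) (2∤n : + 2 ∤ + n) (u₁ u₂ u₃ : ℤ)
    (u₁≢0 : u₁ ≢ 0ℤ) (u₂≢0 : u₂ ≢ 0ℤ) (u₃≢0 : u₃ ≢ 0ℤ)
    (equation : + n * (u₂ * u₃ + u₁ * u₃ + u₁ * u₂) ≡ + 4 * (u₁ * u₂ * u₃)) where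

    X c D : ℤ
    X = - (u₁ * u₂)
    c = + n - + 4 * u₃
    D = + n * c

    n≢0 : + n ≢ 0ℤ
    n≢0 eq = 2∤n (subst (+ 2 ∣_) (sym eq) (divides 0ℤ refl))

    c-equation : c * (u₁ * u₂) ≡ - (+ n * u₃) * (u₁ + u₂)
    c-equation = begin
      c * (u₁ * u₂)
        ≡⟨ expand (+ n) u₁ u₂ u₃ ⟩
      + n * (u₁ * u₂) - + 4 * (u₁ * u₂ * u₃)
        ≡⟨ cong (_-_ (+ n * (u₁ * u₂))) equation ⟨
      + n * (u₁ * u₂) - + n * (u₂ * u₃ + u₁ * u₃ + u₁ * u₂)
        ≡⟨ collect (+ n) u₁ u₂ u₃ ⟩
      - (+ n * u₃) * (u₁ + u₂) ∎
      where
      open ≡-Reasoning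
      expand : ∀ n u₁ u₂ u₃ → (n - + 4 * u₃) * (u₁ * u₂) ≡ n * (u₁ * u₂) - + 4 * (u₁ * u₂ * u₃)
      expand = solve-∀
      collect : ∀ n u₁ u₂ u₃ → n * (u₁ * u₂) - n * (u₂ * u₃ + u₁ * u₃ + u₁ * u₂) ≡
                - (n * u₃) * (u₁ + u₂)
      collect = solve-∀

    private
      D-expand : ∀ n u → n * (n - + 4 * u) - n * n ≡ - (n * u) * + 4
      D-expand = solve-∀

    D≈1 : D ≈ 1ℤ [ + 4 ]
    D≈1 = ≈-trans (congruent (divides (- (+ n * u₃)) (D-expand (+ n) u₃)))
      (congruent (∣-trans (divides (+ 2) refl) (difference (1mod2-square 2∤n))))

    D≢0 : D ≢ 0ℤ
    D≢0 = 1mod4≢0 D≈1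

    X≢0 : X ≢ 0ℤ
    X≢0 eq = [ u₁≢0 , u₂≢0 ]′ (i*j≡0⇒i≡0∨j≡0 u₁ (neg-injective eq))

    -- Secures that the change of variables to X, D, -1, whose scaling factors contain u₁ + u₂, is
    -- invertible over ℚ.
    u₁+u₂≢0 : u₁ + u₂ ≢ 0ℤ
    u₁+u₂≢0 eq = [ (λ c≡0 → D≢0 (trans (cong (+ n *_) c≡0) (*-zeroʳ (+ n))))
                   , (λ u₁u₂≡0 → X≢0 (cong -_ u₁u₂≡0)) ]′
      (i*j≡0⇒i≡0∨j≡0 c (trans c-equation
        (trans (cong (- (+ n * u₃) *_) eq) (*-zeroʳ (- (+ n * u₃))))))

    XD≡ : X * D ≡ + n * + n * (u₁ + u₂) * u₃
    XD≡ = trans (isolate (+ n) c (u₁ * u₂)) (trans (cong (λ t → - (+ n * t)) c-equation)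
      (collect (+ n) u₃ (u₁ + u₂)))
      where
      isolate : ∀ n c w → - w * (n * c) ≡ - (n * (c * w))
      isolate = solve-∀
      collect : ∀ n u s → - (n * (- (n * u) * s)) ≡ n * n * s * u
      collect = solve-∀

    module _ {p : ℕ} (p-prime : Prime p) (p∤n : + p ∤ + n) where
      open PrimeModulus p-prime
      open Split

      private
        T-p∣u₃ : + p ∣ u₃ → T p X D ≡ Sign.+
        T-p∣u₃ p∣u₃ = trans (T-cong p {X} refl (trans (local-unit p-prime p∤D) (cong (Sign.+ ,_) (χD (p ℕ.≟ 2)))))
          (tame-unitʳ (χ p -1ℤ) {ν p X} {κ p X} {Sign.+})
          where
          D≈n² : D ≈ + n * + n [ + p ]
          D≈n² = congruent (subst (+ p ∣_) (sym (D-expand (+ n) u₃))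
            (∣m⇒∣m*n (+ 4) (∣m⇒∣-m (∣n⇒∣m*n (+ n) p∣u₃))))
          p∤D : + p ∤ D
          p∤D d = p∤* p∤n p∤n (∣-resp-≈ D≈n² d)
          χD : Dec (p ≡ 2) → χ p D ≡ Sign.+
          χD (yes refl) = signOf-yes (+ 8 ∣? (D - 1ℤ)) (difference (≈-trans D≈n²[8] (1mod2-square 2∤n)))
            where
            -- D - n² = - 4 n u₃, and an even u₃ supplies the third factor 2 that the symbol at 2
            -- asks for.
            D≈n²[8] : D ≈ + n * + n [ + 8 ]
            D≈n²[8] = congruent (subst (+ 8 ∣_) (sym (D-expand (+ n) u₃))
              (*-monoˡ-∣ (+ 4) (∣m⇒∣-m (∣n⇒∣m*n (+ n) p∣u₃))))
          χD (no p≢2) = trans (χ-≈ p∤D D≈n²) (χ-square p∤n)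
            where open OddPrime p-prime p≢2

        T-p∤u₃ : Split p u₁ → Split p u₂ → + p ∤ u₃ → T p X D ≡ Sign.+
        T-p∤u₃ s₁ s₂ p∤u₃ = cases (+ p ∣? D)
          where
          a = exponent s₁
          b = exponent s₂
          v = unit s₁
          w = unit s₂
          e = - (+ n * u₃)
          p∤e : + p ∤ e
          p∤e d = p∤* p∤n p∤u₃ (subst (+ p ∣_) (neg-involutive (+ n * u₃)) (∣m⇒∣-m d))
          split-equation : c * (((+ p) ^ a * v) * ((+ p) ^ b * w)) ≡ e * ((+ p) ^ a * v + (+ p) ^ b * w)
          split-equation = subst₂ (λ s t → c * (s * t) ≡ e * (s + t)) (Split.eq s₁) (Split.eq s₂) c-equation
          a≡b : a ≡ b
          a≡b = equal-exponents p-prime {c} {e} a b p∤e (p∤unit s₁) (p∤unit s₂) split-equation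
          p∤-vw : + p ∤ - (v * w)
          p∤-vw d = p∤* (p∤unit s₁) (p∤unit s₂) (subst (+ p ∣_) (neg-involutive (v * w)) (∣m⇒∣-m d))
          X≡ : X ≡ (+ p) ^ (a ℕ.+ b) * - (v * w)
          X≡ = trans (cong -_ (Split.eq (split-* p-prime s₁ s₂))) (neg-distribʳ-* ((+ p) ^ (a ℕ.+ b)) (v * w))
          local-X : local p X ≡ (Sign.+ , χ p (- (v * w)))
          local-X = trans (local-char p-prime (split (a ℕ.+ b) (- (v * w)) p∤-vw X≡))
            (cong (_, χ p (- (v * w))) (trans (cong (λ b → -1^ (a ℕ.+ b)) (sym a≡b)) (-1^-double a)))
          χ-vw : + p ∣ D → Dec (p ≡ 2) → χ p (- (v * w)) ≡ Sign.+
          χ-vw p∣D (yes refl) = contradiction p∣D (2∤1mod4 D≈1)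
          χ-vw p∣D (no p≢2) = trans (χ-≈ { - (v * w)} {v * v} p∤-vw (congruent (subst (+ p ∣_) (square v w)
              (∣m⇒∣-m (∣n⇒∣m*n v p∣v+w))))) (χ-square {v} (p∤unit s₁))
            where
            open OddPrime p-prime p≢2
            square : ∀ v w → - (v * (v + w)) ≡ - (v * w) - v * v
            square = solve-∀
            p∣c : + p ∣ c
            p∣c = [ (λ d → contradiction d p∤n) , id ]′ (p∣*⇒ (+ n) c p∣D)
            p∣v+w : + p ∣ v + w
            p∣v+w = equal-exponents-∣ p-prime {c} {e} a p∤e p∣c
              (subst (λ b → c * (((+ p) ^ a * v) * ((+ p) ^ b * w)) ≡ e * ((+ p) ^ a * v + (+ p) ^ b * w))
                (sym a≡b) split-equation)
          cases : Dec (+ p ∣ D) → T p X D ≡ Sign.+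
          cases (yes p∣D) = trans (T-cong p {b = D} (trans local-X (cong (Sign.+ ,_) (χ-vw p∣D (p ℕ.≟ 2)))) refl)
            (tame-unitˡ (χ p -1ℤ) {Sign.+} {ν p D} {κ p D})
          -- Both valuations are even here, so the tame symbol is trivial. The prime 2 always
          -- arrives at this case because D is odd.
          cases (no p∤D) = trans (T-cong p local-X (local-unit p-prime p∤D))
            (trans (tame-unitˡ (χ p -1ℤ) {χ p (- (v * w))} {Sign.+} {χ p D}) (⟨,+⟩ (χ p (- (v * w)))))

      T-good : T p X D ≡ Sign.+
      T-good = cases (+ p ∣? u₃)
        where
        cases : Dec (+ p ∣ u₃) → T p X D ≡ Sign.+
        cases (yes p∣u₃) = T-p∣u₃ p∣u₃
        cases (no p∤u₃)  = T-p∤u₃ (splitting p-prime u₁ u₁≢0) (splitting p-prime u₂ u₂≢0) p∤u₃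

    sign-good : u₁ < 0ℤ ⊎ u₂ < 0ℤ ⊎ u₃ < 0ℤ → ⟨ sign X , sign D ⟩ ≡ Sign.+
    sign-good = sign-lemma n u₁ u₂ u₃ u₁≢0 u₂≢0 c-equation

    product-formula : u₁ < 0ℤ ⊎ u₂ < 0ℤ ⊎ u₃ < 0ℤ → ∏[ primeDivisors n ] (λ p → T p X D) ≡ Sign.+
    product-formula negative = begin
      ∏[ primeDivisors n ] f
        ≡⟨ ∏-filter (λ p → prime? p ×-dec p ℕ∣.∣? n) f≡+ (upTo (suc n)) ⟩
      ∏[ upTo (suc n) ] f
        ≡⟨ ∏-applyUpTo f id (suc n) ⟩
      ∏ {suc n} (f ∘ toℕ)
        ≡⟨ ∏-extend {suc n} {N} {f} (ℕ.m≤m+n (suc n) _) (λ p n<p → f≡+ p λ (_ , p∣n) →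
             ℕ.<⇒≱ n<p (ℕ∣.∣⇒≤ {{ℕ.≢-nonZero λ n≡0 → n≢0 (cong +_ n≡0)}} p∣n)) ⟩
      ∏ {N} (f ∘ toℕ)
        ≡⟨ Sign.*-identityʳ _ ⟨
      ∏ {N} (f ∘ toℕ) Sign.* Sign.+
        ≡⟨ cong (∏ {N} (f ∘ toℕ) Sign.*_) (sign-good negative) ⟨
      S N X D
        ≡⟨ hilbert-reciprocity X≢0 (ℕ.m≤n⇒m≤o+n (suc n) (s≤s (ℕ.m≤m+n ∣ X ∣ ∣ D ∣))) D≈1
             (ℕ.m≤n⇒m≤o+n (suc n) (s≤s (ℕ.m≤n+m ∣ D ∣ ∣ X ∣))) ⟩
      Sign.+ ∎
      where
      open ≡-Reasoning
      f : ℕ → Sign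
      f p = T p X D
      N : ℕ
      -- Exceeds n as well as the absolute values of X and D, so the range contains all divisors of
      -- n and `hilbert-reciprocity` applies.
      N = suc n ℕ.+ suc (∣ X ∣ ℕ.+ ∣ D ∣)
      f≡+ : ∀ p → ¬ (Prime p × p ℕ∣.∣ n) → f p ≡ Sign.+
      f≡+ p ¬P = cases (prime? p)
        where
        cases : Dec (Prime p) → f p ≡ Sign.+
        cases (yes p-prime) = T-good p-prime λ p∣n → ¬P (p-prime , ∣⇒∣ᵤ p∣n)
        cases (no ¬p)       = T-nonprime X D ¬p

-- Diagonal ternary forms and their p-adic zeros

module TernaryForms where
  open Congruences
  open TameSymbol
  open import Data.Nat.Base as ℕ using (ℕ; zero; suc)
  import Data.Nat.Properties as ℕ
  import Data.Nat.Tactic.RingSolver as ℕSolver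
  open import Data.Nat.Primality using (Prime; prime⇒nonZero)
  open import Data.Integer.Base as ℤ hiding (suc; NonZero)
  open import Data.Integer.Properties
  open import Data.Integer.Divisibility.Signed
  open import Data.Integer.Tactic.RingSolver using (solve-∀)
  open import Data.Sign.Base as Sign using (Sign)
  open import Data.Product.Base using (∃-syntax; _×_; _,_)
  open import Data.Sum.Base using (inj₁; inj₂)
  open import Function.Base using (_∘_)
  open import Relation.Nullary using (¬_; contradiction)
  open import Relation.Binary.PropositionalEquality

  ℤ³ : Set
  ℤ³ = ℤ × ℤ × ℤ

  infixl 7 _⊛_
  infix  4 _∣³_

  _⊛_ : ℤ → ℤ³ → ℤ³
  d ⊛ (x , y , z) = d * x , d * y , d * z

  form : ℤ³ → ℤ³ → ℤ
  form (A , B , C) (x , y , z) = A * (x * x) + B * (y * y) + C * (z * z)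

  _∣³_ : ℤ → ℤ³ → Set
  m ∣³ (x , y , z) = (m ∣ x) × (m ∣ y) × (m ∣ z)

  _≈³_[_] : ℤ³ → ℤ³ → ℤ → Set
  (x , y , z) ≈³ (x′ , y′ , z′) [ m ] = x ≈ x′ [ m ] × y ≈ y′ [ m ] × z ≈ z′ [ m ]

  form-⊛ : ∀ F d v → form F (d ⊛ v) ≡ d * d * form F v
  form-⊛ (A , B , C) d (x , y , z) = homogeneous A B C d x y z
    where
    homogeneous : ∀ A B C d x y z →
      A * (d * x * (d * x)) + B * (d * y * (d * y)) + C * (d * z * (d * z)) ≡
      d * d * (A * (x * x) + B * (y * y) + C * (z * z))
    homogeneous = solve-∀

  triple-≡ : ∀ {x y z x′ y′ z′ : ℤ} → x ≡ x′ → y ≡ y′ → z ≡ z′ → (x , y , z) ≡ (x′ , y′ , z′)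
  triple-≡ refl refl refl = refl

  -- Equivalence over ℚ up to the factor c, kept integral: `to` and `from` are inverse up to the
  -- scalar d. Of their linearity only the compatibility with divisibility and congruence is
  -- recorded.
  record Similar (F G : ℤ³) : Set where
    field
      to from : ℤ³ → ℤ³
      to-∣    : ∀ {m v} → m ∣³ v → m ∣³ to v
      from-∣  : ∀ {m v} → m ∣³ v → m ∣³ from v
      from-≈  : ∀ {m v w} → v ≈³ w [ m ] → from v ≈³ from w [ m ]
      d c     : ℤ
      d≢0     : d ≢ 0ℤ
      c≢0     : c ≢ 0ℤ
      to-from : ∀ v → to (from v) ≡ d ⊛ v
      from-to : ∀ v → from (to v) ≡ d ⊛ v
      form-to : ∀ v → form G (to v) ≡ c * form F v

  module Local {p : ℕ} (p-prime : Prime p) where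
    open PrimeModulus p-prime
    open Split

    infixl 8 p^_
    p^_ : ℕ → ℤ
    p^ k = (+ p) ^ k

    p≢0ℤ : + p ≢ 0ℤ
    p≢0ℤ e = ℕ.≢-nonZero⁻¹ p {{prime⇒nonZero p-prime}} (+-injective e)

    p^-nonZero : ∀ k → ℤ.NonZero (p^ k)
    p^-nonZero k = ≢-nonZero (p≢0ℤ ∘ i^n≡0⇒i≡0 (+ p) k)

    p^-+ : ∀ k l → p^ (k ℕ.+ l) ≡ p^ k * p^ l
    p^-+ = ^-distribˡ-+-* (+ p)

    p^-∣ : ∀ {k l} → k ℕ.≤ l → p^ k ∣ p^ l
    p^-∣ {k} k≤l with m , refl ← ℕ.m≤n⇒∃[o]m+o≡n k≤l = divides (p^ m) (trans (p^-+ k m) (*-comm (p^ k) (p^ m)))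

    unit-cancel : ∀ k {u x} → + p ∤ u → p^ k ∣ u * x → p^ k ∣ x
    unit-cancel zero {x = x} p∤u _ = divides x (sym (*-identityʳ x))
    unit-cancel (suc k) {u} {x} p∤u d
      with p∣*⇒ u x (∣-trans (∣m⇒∣m*n (p^ k) ∣-refl) d)
    ... | inj₁ p∣u = contradiction p∣u p∤u
    ... | inj₂ (divides y refl) = subst (_∣ y * + p) (*-comm (p^ k) (+ p)) (*-monoˡ-∣ (+ p)
      (unit-cancel k p∤u (*-cancelˡ-∣ (+ p) {{≢-nonZero p≢0ℤ}} (subst (+ p * p^ k ∣_) (rotate u y (+ p)) d))))
      where
      rotate : ∀ u y p → u * (y * p) ≡ p * (u * y)
      rotate = solve-∀

    split-cancel : ∀ {d} (s : Split p d) k {x} → p^ (k ℕ.+ exponent s) ∣ d * x → p^ k ∣ x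
    split-cancel {d} (split l u p∤u eq) k {x} div = unit-cancel k p∤u (*-cancelʳ-∣ (p^ l) {{p^-nonZero l}}
      (subst₂ _∣_ (p^-+ k l) (trans (cong (_* x) eq) (rotate (p^ l) u x)) div))
      where
      rotate : ∀ a b c → a * b * c ≡ b * c * a
      rotate = solve-∀

    split-cancel³ : ∀ {d} (s : Split p d) k {v} → p^ (k ℕ.+ exponent s) ∣³ d ⊛ v → p^ k ∣³ v
    split-cancel³ s k (x , y , z) = split-cancel s k x , split-cancel s k y , split-cancel s k z

    -- The p-adic estimate that the square of the norm of v is at most a constant times the norm of
    -- F v. Such a bound passes to limits of rational vectors, which the mere absence of integer
    -- zeros does not.
    Anisotropic : ℤ³ → Set
    Anisotropic F = ∃[ c ] ∀ k v → p^ (c ℕ.+ (k ℕ.+ k)) ∣ form F v → p^ k ∣³ v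

    -- A nonzero zero over the p-adic integers, given by integer approximations; `level` keeps the
    -- limit away from 0.
    record Isotropic (F : ℤ³) : Set where
      field
        zeros      : ℕ → ℤ³
        cauchy     : ∀ k → zeros (suc k) ≈³ zeros k [ p^ k ]
        vanishing  : ∀ k → p^ k ∣ form F (zeros k)
        level      : ℕ
        nontrivial : ∀ k → level ℕ.≤ k → ¬ p^ level ∣³ zeros k

    module _ {F G : ℤ³} (sim : Similar F G) where
      open Similar sim

      private
        dₛ = splitting p-prime d d≢0
        cₛ = splitting p-prime c c≢0
        s  = exponent dₛ
        t  = exponent cₛ

      -- Going through `to` and back by `from` multiplies v by d. Cancelling d costs s powers of p,
      -- hence s + s in the constant.
      transfer-anisotropic : Anisotropic G → Anisotropic F
      transfer-anisotropic (b , aniso) = b ℕ.+ (s ℕ.+ s) , λ k v div →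
        split-cancel³ dₛ k (subst (p^ (k ℕ.+ s) ∣³_) (from-to v) (from-∣
          (aniso (k ℕ.+ s) (to v) (subst₂ _∣_ (cong p^_ (regroup b s k)) (sym (form-to v))
            (∣n⇒∣m*n c div)))))
        where
        regroup : ∀ b s k → b ℕ.+ (s ℕ.+ s) ℕ.+ (k ℕ.+ k) ≡ b ℕ.+ ((k ℕ.+ s) ℕ.+ (k ℕ.+ s))
        regroup = ℕSolver.solve-∀

      -- In c · F (from w) = d² · G w cancelling c costs t powers of p, recovered by starting t
      -- terms later; d raises the level by s.
      transfer-isotropic : Isotropic G → Isotropic F
      transfer-isotropic iso = record
        { zeros      = λ k → from (zeros (k ℕ.+ t))
        ; cauchy     = λ k → weaken k (from-≈ (cauchy (k ℕ.+ t)))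
        ; vanishing  = λ k → split-cancel cₛ k (subst (p^ (k ℕ.+ t) ∣_)
            (sym (c-form (zeros (k ℕ.+ t)))) (∣n⇒∣m*n (d * d) (vanishing (k ℕ.+ t))))
        ; level      = level ℕ.+ s
        ; nontrivial = λ k le div → nontrivial (k ℕ.+ t)
            (ℕ.≤-trans (ℕ.m≤m+n level s) (ℕ.≤-trans le (ℕ.m≤m+n k t)))
            (split-cancel³ dₛ level (subst (p^ (level ℕ.+ s) ∣³_) (to-from (zeros (k ℕ.+ t)))
              (to-∣ div)))
        }
        where
        open Isotropic iso
        weaken₁ : ∀ k {x y} → x ≈ y [ p^ (k ℕ.+ t) ] → x ≈ y [ p^ k ]
        weaken₁ k (congruent e) = congruent (∣-trans (p^-∣ (ℕ.m≤m+n k t)) e)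
        weaken : ∀ k {v w} → v ≈³ w [ p^ (k ℕ.+ t) ] → v ≈³ w [ p^ k ]
        weaken k (x , y , z) = weaken₁ k x , weaken₁ k y , weaken₁ k z
        c-form : ∀ w → c * form F (from w) ≡ d * d * form G w
        c-form w = trans (sym (form-to (from w))) (trans (cong (form G) (to-from w)) (form-⊛ G d w))

    Decided : ℤ³ → Sign → Set
    Decided F Sign.+ = Isotropic F
    Decided F Sign.- = Anisotropic F

    transfer : ∀ {F G} s → Similar F G → Decided G s → Decided F s
    transfer Sign.+ = transfer-isotropic
    transfer Sign.- = transfer-anisotropic

-- Zeros and descent at an odd prime

module OddPrimeForms where
  open Congruences
  open SignProducts
  open LegendreSymbol
  open TameSymbol
  open TernaryForms
  open import Data.Nat.Base as ℕ using (ℕ; zero; suc)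
  import Data.Nat.Properties as ℕ
  open import Data.Nat.Primality using (Prime)
  open import Data.Integer.Base as ℤ hiding (suc; NonZero)
  open import Data.Integer.Properties
  open import Data.Integer.Divisibility.Signed
  open import Data.Integer.DivMod using (_%ℕ_; n%ℕd<d)
  open import Data.Integer.Tactic.RingSolver using (solve-∀)
  open import Data.Sign.Base as Sign using (Sign)
  import Data.Sign.Properties as Sign
  open import Data.Product.Base using (∃-syntax; _×_; _,_; proj₁; proj₂)
  open import Data.Sum.Base using ([_,_]′)
  open import Relation.Nullary using (contradiction; Dec; yes; no)
  open import Relation.Binary.PropositionalEquality

  module OddLocal {p : ℕ} (p-prime : Prime p) (p≢2 : p ≢ 2) where
    open PrimeModulus p-prime
    open OddPrime p-prime p≢2
    open Local p-prime
    open Split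

    -- As h = d + 1, the product a · a^d · a^h is the square of a^h, which is a sign modulo p.
    inverse : ∀ {a} → + p ∤ a → ∃[ b ] a * b ≈ 1ℤ [ + p ]
    inverse {a} p∤a with d , h≡ ← h≡1+ = a ^ d * a ^ h , (
      a * (a ^ d * a ^ h)       ≈⟨ ≈-reflexive (sym (*-assoc a (a ^ d) (a ^ h))) ⟩
      a ^ suc d * a ^ h         ≈⟨ ≈-reflexive (cong (λ n → a ^ n * a ^ h) (sym h≡)) ⟩
      a ^ h * a ^ h             ≈⟨ ≈-* (euler p∤a) (euler p∤a) ⟩
      ⟦ χ p a ⟧ * ⟦ χ p a ⟧     ≈⟨ ≈-reflexive (⟦⟧² (χ p a)) ⟩
      1ℤ                        ≈∎)

    module Hensel {e : ℤ} (p∤e : + p ∤ e) (χe : χ p e ≡ Sign.+) where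
      private
        r₀ = proj₁ (χ-sqrt p∤e χe)
        r₀²≈e : r₀ * r₀ ≈ e [ + p ]
        r₀²≈e = proj₂ (χ-sqrt p∤e χe)

        p∤r₀ : + p ∤ r₀
        p∤r₀ p∣r₀ = p∤e (∣-resp-≈ r₀²≈e (∣m⇒∣m*n r₀ p∣r₀))

        j = proj₁ (inverse (p∤* p∤2 p∤r₀))
        2r₀j≈1 : + 2 * r₀ * j ≈ 1ℤ [ + p ]
        2r₀j≈1 = proj₂ (inverse (p∤* p∤2 p∤r₀))

      -- Newton's iteration with the fixed inverse j of 2 r₀ modulo p.
      root : ℕ → ℤ
      root zero    = r₀
      root (suc k) = root k - j * (root k * root k - e)

      root≈r₀ : ∀ k → root k ≈ r₀ [ + p ]
      root²≈e : ∀ k → p^ (suc k) ∣ root k * root k - e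

      private
        p∣root²-e : ∀ k → + p ∣ root k * root k - e
        p∣root²-e k = ∣-trans (∣m⇒∣m*n (p^ k) ∣-refl) (root²≈e k)

      root≈r₀ zero    = ≈-refl
      root≈r₀ (suc k) = ≈-trans (≈-+ (root≈r₀ k) (≈-neg (∣⇒≈0 (∣n⇒∣m*n j (p∣root²-e k)))))
        (≈-reflexive (+-identityʳ r₀))

      root²≈e zero = subst (_∣ r₀ * r₀ - e) (sym (*-identityʳ (+ p))) (difference r₀²≈e)
      root²≈e (suc k) = subst₂ _∣_ (*-comm (p^ (suc k)) (+ p)) (sym (newton (root k) j e))
        (∣-trans (*-monoʳ-∣ (p^ (suc k)) p∣factor) (*-monoˡ-∣ factor (root²≈e k)))
        where
        r = root k
        f = r * r - e
        -- The ratio of the new error to f. It is divisible by p because r ≡ r₀, j inverts 2 r₀ and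
        -- p ∣ f; so each step gains one power of p.
        factor = 1ℤ - + 2 * r * j + j * j * f
        newton : ∀ r j e → (r - j * (r * r - e)) * (r - j * (r * r - e)) - e ≡
                 (r * r - e) * (1ℤ - + 2 * r * j + j * j * (r * r - e))
        newton = solve-∀
        p∣factor : + p ∣ factor
        p∣factor = ∣m∣n⇒∣m+n (difference (≈-sym (≈-trans
          (≈-* (≈-* (≈-refl {a = + 2}) (root≈r₀ k)) (≈-refl {a = j})) 2r₀j≈1)))
          (∣n⇒∣m*n (j * j) (p∣root²-e k))

      root-cauchy : ∀ k → root (suc k) ≈ root k [ p^ k ]
      root-cauchy k = congruent (subst (p^ k ∣_) (sym (cancel (root k) (j * (root k * root k - e))))
        (∣m⇒∣-m (∣n⇒∣m*n j (∣-trans (p^-∣ (ℕ.n≤1+n k)) (root²≈e k)))))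
        where
        cancel : ∀ r x → r - x - r ≡ - x
        cancel = solve-∀

      root-vanishing : ∀ k → p^ k ∣ root k * root k - e
      root-vanishing k = ∣-trans (p^-∣ (ℕ.n≤1+n k)) (root²≈e k)

      p∤root : ∀ k → + p ∤ root k
      p∤root k d = p∤r₀ (∣-resp-≈ (root≈r₀ k) d)

    -- Only z, a square root of A x² + B y², has to be lifted; x and y stay constant.
    representsSquare⇒isotropic : ∀ A B x y → let e = A * (x * x) + B * (y * y) in
      + p ∤ e → χ p e ≡ Sign.+ → Isotropic (A , B , -1ℤ)
    representsSquare⇒isotropic A B x y p∤e χe = record
      { zeros      = λ k → x , y , root k
      ; cauchy     = λ k → ≈-refl , ≈-refl , root-cauchy k
      ; vanishing  = λ k → subst (p^ k ∣_) (regroup (A * (x * x) + B * (y * y)) (root k))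
                             (∣m⇒∣-m (root-vanishing k))
      ; level      = 1
      ; nontrivial = λ k _ (_ , _ , d) → p∤root k (subst (_∣ root k) (*-identityʳ (+ p)) d)
      }
      where
      open Hensel p∤e χe
      regroup : ∀ e r → - (r * r - e) ≡ e + -1ℤ * (r * r)
      regroup = solve-∀

    unitˡ⇒isotropic : ∀ {A} B → + p ∤ A → χ p A ≡ Sign.+ → Isotropic (A , B , -1ℤ)
    unitˡ⇒isotropic {A} B p∤A χA = representsSquare⇒isotropic A B 1ℤ 0ℤ
      (subst (+ p ∤_) e≡ p∤A) (subst (λ e → χ p e ≡ Sign.+) e≡ χA)
      where
      expand : ∀ A B → A ≡ A * (1ℤ * 1ℤ) + B * (0ℤ * 0ℤ)
      expand = solve-∀
      e≡ = expand A B

    unitʳ⇒isotropic : ∀ A {B} → + p ∤ B → χ p B ≡ Sign.+ → Isotropic (A , B , -1ℤ)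
    unitʳ⇒isotropic A {B} p∤B χB = representsSquare⇒isotropic A B 0ℤ 1ℤ
      (subst (+ p ∤_) e≡ p∤B) (subst (λ e → χ p e ≡ Sign.+) e≡ χB)
      where
      expand : ∀ A B → B ≡ A * (0ℤ * 0ℤ) + B * (1ℤ * 1ℤ)
      expand = solve-∀
      e≡ = expand A B

    -- Since 1 is a residue, descending from a nonresidue must meet a residue directly below a
    -- nonresidue.
    consecutive : ∀ r → suc r ℕ.< p → χ p (+ suc r) ≡ Sign.- →
                  ∃[ m ] suc (suc m) ℕ.< p × χ p (+ suc m) ≡ Sign.+ × χ p (+ suc (suc m)) ≡ Sign.-
    consecutive zero    _  χ1≡- = contradiction (trans (sym χ1≡-) χ-1) λ ()
    consecutive (suc r) lt χ≡- = cases (χ p (+ suc r)) refl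
      where
      cases : ∀ s → χ p (+ suc r) ≡ s → _
      cases Sign.+ χr = r , lt , χr , χ≡-
      cases Sign.- χr = consecutive r (ℕ.<-trans (ℕ.n<1+n _) lt) χr

    nonresidue-pair : ∀ {A} → + p ∤ A → χ p A ≡ Sign.- →
                      ∃[ m ] suc (suc m) ℕ.< p × χ p (+ suc m) ≡ Sign.+ × χ p (+ suc (suc m)) ≡ Sign.-
    nonresidue-pair {A} p∤A χA = from-residue (A %ℕ p) (n%ℕd<d A p) (residueℕ A)
      where
      from-residue : ∀ r → r ℕ.< p → A ≈ + r [ + p ] → _
      from-residue zero    _  A≈0 = contradiction (≈0⇒∣ A≈0) p∤A
      from-residue (suc r) lt A≈r = consecutive r lt (trans (sym (χ-≈ p∤A A≈r)) χA)

    below-p : ∀ {n} → suc n ℕ.< p → + p ∤ + suc n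
    below-p lt = small-∤ (ℕ.≤-pred (subst (_ ℕ.<_) p≡1+2h lt))

    -- For nonresidues A and B with A B ≡ s², and m = w² a residue with m + 1 a
    -- nonresidue, A s² + B (A w)² ≡ A² B (1 + m) is a residue.
    units⇒isotropic : ∀ {A B} → + p ∤ A → + p ∤ B → Isotropic (A , B , -1ℤ)
    units⇒isotropic {A} {B} p∤A p∤B = cases (χ p A) (χ p B) refl refl
      where
      expand : ∀ A B w → B * (A * w * (A * w)) ≡ A * A * B * (w * w)
      expand = solve-∀
      collect : ∀ A B m → A * (A * B) + A * A * B * m ≡ A * A * (B * (1ℤ + m))
      collect = solve-∀
      both : χ p B ≡ Sign.- → ∀ m w s → + p ∤ + suc m → χ p (+ suc m) ≡ Sign.- →
             w * w ≈ + m [ + p ] → s * s ≈ A * B [ + p ] → Isotropic (A , B , -1ℤ)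
      both χB m w s p∤m+1 χm+1 w²≈m s²≈AB =
        representsSquare⇒isotropic A B s (A * w) (λ d → p∤target (∣-resp-≈ e≈ d))
          (trans (sym (χ-≈ p∤target (≈-sym e≈))) (trans (χ-* (p∤* p∤A p∤A) (p∤* p∤B p∤m+1))
            (cong₂ Sign._*_ (χ-square p∤A) (trans (χ-* p∤B p∤m+1) (cong₂ Sign._*_ χB χm+1)))))
        where
        p∤target : + p ∤ A * A * (B * + suc m)
        p∤target = p∤* (p∤* p∤A p∤A) (p∤* p∤B p∤m+1)
        e≈ : A * (s * s) + B * (A * w * (A * w)) ≈ A * A * (B * + suc m) [ + p ]
        e≈ = ≈-trans (≈-+ (≈-* (≈-refl {a = A}) s²≈AB)
               (≈-trans (≈-reflexive (expand A B w)) (≈-* (≈-refl {a = A * A * B}) w²≈m)))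
             (≈-reflexive (collect A B (+ m)))
      cases : ∀ s t → χ p A ≡ s → χ p B ≡ t → Isotropic (A , B , -1ℤ)
      cases Sign.+ _      χA _  = unitˡ⇒isotropic B p∤A χA
      cases Sign.- Sign.+ _  χB = unitʳ⇒isotropic A p∤B χB
      cases Sign.- Sign.- χA χB =
        let m , lt , χm , χm+1 = nonresidue-pair p∤A χA
            w , w²≈m  = χ-sqrt (below-p (ℕ.<-trans (ℕ.n<1+n _) lt)) χm
            s , s²≈AB = χ-sqrt (p∤* p∤A p∤B) (trans (χ-* p∤A p∤B) (cong₂ Sign._*_ χA χB))
        in both χB (suc m) w s (below-p lt) χm+1 w²≈m s²≈AB

    -- Otherwise B would be the square of z / y modulo p.
    nonresidue-∣ : ∀ {B} y z → + p ∤ B → χ p B ≡ Sign.- → B * (y * y) ≈ z * z [ + p ] →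
                   (+ p ∣ y) × (+ p ∣ z)
    nonresidue-∣ {B} y z p∤B χB e = cases (+ p ∣? y)
      where
      cases : Dec (+ p ∣ y) → (+ p ∣ y) × (+ p ∣ z)
      cases (yes p∣y) = p∣y , p∣²⇒ z (∣-resp-≈ e (∣n⇒∣m*n B (∣m⇒∣m*n y p∣y)))
      cases (no p∤y) = contradiction (trans (sym χB) (trans (sym (Sign.*-identityʳ (χ p B)))
        (trans (cong (χ p B Sign.*_) (sym (χ-square p∤y))) (trans (sym (χ-* p∤B (p∤* p∤y p∤y)))
          (trans (χ-≈ (p∤* p∤B (p∤* p∤y p∤y)) e) (χ-square p∤z)))))) λ ()
        where
        p∤z : + p ∤ z
        p∤z p∣z = p∤* p∤B (p∤* p∤y p∤y) (∣-resp-≈ (≈-sym e) (∣m⇒∣m*n z p∣z))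

    module _ {A B : ℤ} (p∤A : + p ∤ A) (p∤B : + p ∤ B) (χB : χ p B ≡ Sign.-) where

      private
        F : ℤ³
        F = + p * A , B , -1ℤ

        -- Modulo p only B y² - z² is left, so p divides y and z. Then p² divides these two terms
        -- and therefore p A x².
        descend : ∀ v → + p * + p ∣ form F v → + p ∣³ v
        descend (x , y , z) p²∣ with nonresidue-∣ y z p∤B χB By²≈z²
          where
          isolate : ∀ q A B x y z → q * A * (x * x) + B * (y * y) + -1ℤ * (z * z) - q * (A * (x * x)) ≡
                    B * (y * y) - z * z
          isolate = solve-∀
          By²≈z² : B * (y * y) ≈ z * z [ + p ]
          By²≈z² = congruent (subst (+ p ∣_) (isolate (+ p) A B x y z)
            (∣m∣n⇒∣m-n (∣-trans (∣m⇒∣m*n (+ p) ∣-refl) p²∣) (∣m⇒∣m*n (A * (x * x)) ∣-refl)))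
        ... | divides y′ refl , divides z′ refl = p∣x , divides y′ refl , divides z′ refl
          where
          isolate : ∀ q A B x y z → q * A * (x * x) + B * (y * q * (y * q)) + -1ℤ * (z * q * (z * q)) -
                    q * q * (B * (y * y) - z * z) ≡ q * (A * (x * x))
          isolate = solve-∀
          p∣x : + p ∣ x
          p∣x = [ (λ d → contradiction d p∤A) , p∣²⇒ x ]′ (p∣*⇒ A (x * x)
            (*-cancelˡ-∣ (+ p) {{≢-nonZero p≢0ℤ}} (subst (+ p * + p ∣_) (isolate (+ p) A B x y′ z′)
              (∣m∣n⇒∣m-n p²∣ (∣m⇒∣m*n (B * (y′ * y′) - z′ * z′) ∣-refl)))))

      nonresidue⇒anisotropic : Anisotropic F
      -- Dividing v by p divides the value by exactly p², so nothing is lost along the descent and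
      -- the constant is 0.
      nonresidue⇒anisotropic = 0 , induct
        where
        induct : ∀ k v → p^ (k ℕ.+ k) ∣ form F v → p^ k ∣³ v
        induct zero (x , y , z) _ = 1∣ x , 1∣ y , 1∣ z
          where
          1∣ : ∀ x → 1ℤ ∣ x
          1∣ x = divides x (sym (*-identityʳ x))
        induct (suc k) v div = cases (descend v (∣-trans (∣m⇒∣m*n (p^ (k ℕ.+ k)) ∣-refl) div′))
          where
          div′ : + p * + p * p^ (k ℕ.+ k) ∣ form F v
          div′ = subst (_∣ form F v) (trans (cong (λ n → + p * p^ n) (ℕ.+-suc k k))
            (sym (*-assoc (+ p) (+ p) (p^ (k ℕ.+ k))))) div
          cases : + p ∣³ v → p^ (suc k) ∣³ v
          cases (divides x refl , divides y refl , divides z refl) =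
            let dx , dy , dz = smaller in lift x dx , lift y dy , lift z dz
            where
            scaled : form F (x * + p , y * + p , z * + p) ≡ + p * + p * form F (x , y , z)
            scaled = trans (cong (form F) (triple-≡ (*-comm x (+ p)) (*-comm y (+ p)) (*-comm z (+ p))))
              (form-⊛ F (+ p) (x , y , z))
            smaller : p^ k ∣³ (x , y , z)
            smaller = induct k (x , y , z) (*-cancelˡ-∣ (+ p * + p) {{≢-nonZero p²≢0}}
              (subst (+ p * + p * p^ (k ℕ.+ k) ∣_) scaled div′))
              where
              p²≢0 : + p * + p ≢ 0ℤ
              p²≢0 eq = [ p≢0ℤ , p≢0ℤ ]′ (i*j≡0⇒i≡0∨j≡0 (+ p) eq)
            lift : ∀ x → p^ k ∣ x → p^ (suc k) ∣ x * + p
            lift x d = subst (_∣ x * + p) (*-comm (p^ k) (+ p)) (*-monoˡ-∣ (+ p) d)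

-- The tame symbol decides isotropy at odd primes

module Classification where
  open Congruences
  open SignProducts
  open LegendreSymbol
  open QuadraticReciprocity
  open TameSymbol
  open TernaryForms
  open OddPrimeForms
  open import Data.Nat.Base as ℕ using (ℕ; ⌊_/2⌋)
  open import Data.Nat.Primality using (Prime)
  open import Data.Integer.Base as ℤ hiding (suc; NonZero)
  open import Data.Integer.Properties
  open import Data.Integer.Divisibility.Signed
  open import Data.Integer.Tactic.RingSolver using (solve-∀)
  open import Data.Sign.Base as Sign using (Sign; opposite)
  import Data.Sign.Properties as Sign
  open import Data.Product.Base using (∃-syntax; _×_; _,_)
  open import Data.Sum.Base using (_⊎_; inj₁; inj₂; [_,_]′)
  open import Function.Base using (_∘_; id)
  open import Relation.Binary.PropositionalEquality

  *-≢0 : ∀ {a b} → a ≢ 0ℤ → b ≢ 0ℤ → a * b ≢ 0ℤ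
  *-≢0 {a} a≢0 b≢0 eq = [ a≢0 , b≢0 ]′ (i*j≡0⇒i≡0∨j≡0 a eq)

  ≈-*ˡ : ∀ {m a b} c → a ≈ b [ m ] → c * a ≈ c * b [ m ]
  ≈-*ˡ c = ≈-* (≈-refl {a = c})

  strip : ∀ P Q A B → P ≢ 0ℤ → Q ≢ 0ℤ → Similar (P * P * A , Q * Q * B , -1ℤ) (A , B , -1ℤ)
  strip P Q A B P≢0 Q≢0 = record
    { to      = λ (x , y , z) → P * x , Q * y , z
    ; from    = λ (x , y , z) → Q * x , P * y , P * Q * z
    ; to-∣    = λ (x , y , z) → ∣n⇒∣m*n P x , ∣n⇒∣m*n Q y , z
    ; from-∣  = λ (x , y , z) → ∣n⇒∣m*n Q x , ∣n⇒∣m*n P y , ∣n⇒∣m*n (P * Q) z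
    ; from-≈  = λ (x , y , z) → ≈-*ˡ Q x , ≈-*ˡ P y , ≈-*ˡ (P * Q) z
    ; d       = P * Q
    ; c       = 1ℤ
    ; d≢0     = *-≢0 P≢0 Q≢0
    ; c≢0     = λ ()
    ; to-from = λ (x , y , z) → triple-≡ (assoc P Q x) (swapped P Q y) refl
    ; from-to = λ (x , y , z) → triple-≡ (swapped P Q x) (assoc P Q y) refl
    ; form-to = λ (x , y , z) → scale P Q A B x y z
    }
    where
    assoc : ∀ P Q x → P * (Q * x) ≡ P * Q * x
    assoc = solve-∀
    swapped : ∀ P Q x → Q * (P * x) ≡ P * Q * x
    swapped = solve-∀
    scale : ∀ P Q A B x y z →
            A * (P * x * (P * x)) + B * (Q * y * (Q * y)) + -1ℤ * (z * z) ≡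
            1ℤ * (P * P * A * (x * x) + Q * Q * B * (y * y) + -1ℤ * (z * z))
    scale = solve-∀

  swap : ∀ A B → Similar (A , B , -1ℤ) (B , A , -1ℤ)
  swap A B = record
    { to      = λ (x , y , z) → y , x , z
    ; from    = λ (x , y , z) → y , x , z
    ; to-∣    = λ (x , y , z) → y , x , z
    ; from-∣  = λ (x , y , z) → y , x , z
    ; from-≈  = λ (x , y , z) → y , x , z
    ; d       = 1ℤ
    ; c       = 1ℤ
    ; d≢0     = λ ()
    ; c≢0     = λ ()
    ; to-from = λ (x , y , z) → triple-≡ (one x) (one y) (one z)
    ; from-to = λ (x , y , z) → triple-≡ (one x) (one y) (one z)
    ; form-to = λ (x , y , z) → scale A B x y z
    }
    where
    one : ∀ x → x ≡ 1ℤ * x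
    one = solve-∀
    scale : ∀ A B x y z → B * (y * y) + A * (x * x) + -1ℤ * (z * z) ≡
            1ℤ * (A * (x * x) + B * (y * y) + -1ℤ * (z * z))
    scale = solve-∀

  -- (a , b) = (a , − a b) for the Hilbert symbol, with the square P² removed from a b.
  twist : ∀ P A B → P ≢ 0ℤ → A ≢ 0ℤ → Similar (P * A , P * B , -1ℤ) (P * A , - (A * B) , -1ℤ)
  twist P A B P≢0 A≢0 = record
    { to      = λ (x , y , z) → z , P * y , P * A * x
    ; from    = λ (x , y , z) → z , A * y , P * A * x
    ; to-∣    = λ (x , y , z) → z , ∣n⇒∣m*n P y , ∣n⇒∣m*n (P * A) x
    ; from-∣  = λ (x , y , z) → z , ∣n⇒∣m*n A y , ∣n⇒∣m*n (P * A) x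
    ; from-≈  = λ (x , y , z) → z , ≈-*ˡ A y , ≈-*ˡ (P * A) x
    ; d       = P * A
    ; c       = - (P * A)
    ; d≢0     = *-≢0 P≢0 A≢0
    ; c≢0     = *-≢0 P≢0 A≢0 ∘ neg-injective
    ; to-from = λ (x , y , z) → triple-≡ refl (assoc P A y) refl
    ; from-to = λ (x , y , z) → triple-≡ refl (swapped P A y) refl
    ; form-to = λ (x , y , z) → scale P A B x y z
    }
    where
    assoc : ∀ P A y → P * (A * y) ≡ P * A * y
    assoc = solve-∀
    swapped : ∀ P A y → A * (P * y) ≡ P * A * y
    swapped = solve-∀
    scale : ∀ P A B x y z →
            P * A * (z * z) + - (A * B) * (P * y * (P * y)) + -1ℤ * (P * A * x * (P * A * x)) ≡
            - (P * A) * (P * A * (x * x) + P * B * (y * y) + -1ℤ * (z * z))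
    scale = solve-∀

  -- From (u₁ + u₂) (u₁ x² + u₂ y²) = (u₁ x + u₂ y)² + u₁ u₂ (x − y)².
  diagonalise : ∀ n u₁ u₂ u₃ D → let X = - (u₁ * u₂) in
    n ≢ 0ℤ → X ≢ 0ℤ → u₁ + u₂ ≢ 0ℤ → X * D ≡ n * n * (u₁ + u₂) * u₃ →
    Similar (u₁ , u₂ , u₃) (X , D , -1ℤ)
  diagonalise n u₁ u₂ u₃ D n≢0 X≢0 u₁+u₂≢0 XD≡ = record
    { to      = λ (x , y , z) → n * (u₁ * x + u₂ * y) , X * z , n * X * (x + - y)
    ; from    = λ (x , y , z) → X * x + u₂ * z , X * x + - u₁ * z , n * (u₁ + u₂) * y
    ; to-∣    = λ (x , y , z) →
        ∣n⇒∣m*n n (∣m∣n⇒∣m+n (∣n⇒∣m*n u₁ x) (∣n⇒∣m*n u₂ y)) , ∣n⇒∣m*n X z ,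
        ∣n⇒∣m*n (n * X) (∣m∣n⇒∣m+n x (∣m⇒∣-m y))
    ; from-∣  = λ (x , y , z) →
        ∣m∣n⇒∣m+n (∣n⇒∣m*n X x) (∣n⇒∣m*n u₂ z) , ∣m∣n⇒∣m+n (∣n⇒∣m*n X x) (∣n⇒∣m*n (- u₁) z) ,
        ∣n⇒∣m*n (n * (u₁ + u₂)) y
    ; from-≈  = λ (x , y , z) →
        ≈-+ (≈-*ˡ X x) (≈-*ˡ u₂ z) , ≈-+ (≈-*ˡ X x) (≈-*ˡ (- u₁) z) , ≈-*ˡ (n * (u₁ + u₂)) y
    ; d       = n * X * (u₁ + u₂)
    ; c       = X * (n * n) * (u₁ + u₂)
    ; d≢0     = *-≢0 (*-≢0 n≢0 X≢0) u₁+u₂≢0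
    ; c≢0     = *-≢0 (*-≢0 X≢0 (*-≢0 n≢0 n≢0)) u₁+u₂≢0
    ; to-from = λ (x , y , z) →
        triple-≡ (to-from₁ n X u₁ u₂ x z) (to-from₂ n X u₁ u₂ y) (to-from₃ n X u₁ u₂ x z)
    ; from-to = λ (x , y , z) →
        triple-≡ (from-to₁ n X u₁ u₂ x y) (from-to₂ n X u₁ u₂ x y) (from-to₃ n X u₁ u₂ z)
    -- The coefficient of z² is D X² = X · (X D); the hypothesis on X D brings out the same factor c
    -- as in the other two coefficients.
    ; form-to = λ (x , y , z) → trans (expand n u₁ u₂ D x y z)
        (trans (cong (λ t → X * (n * n) * ((u₁ + u₂) * (u₁ * (x * x) + u₂ * (y * y))) + X * t * (z * z)) XD≡)
          (collect n X u₁ u₂ u₃ x y z))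
    }
    where
    X : ℤ
    X = - (u₁ * u₂)
    to-from₁ : ∀ n X u₁ u₂ x z → n * (u₁ * (X * x + u₂ * z) + u₂ * (X * x + - u₁ * z)) ≡
               n * X * (u₁ + u₂) * x
    to-from₁ = solve-∀
    to-from₂ : ∀ n X u₁ u₂ y → X * (n * (u₁ + u₂) * y) ≡ n * X * (u₁ + u₂) * y
    to-from₂ = solve-∀
    to-from₃ : ∀ n X u₁ u₂ x z → n * X * (X * x + u₂ * z + - (X * x + - u₁ * z)) ≡
               n * X * (u₁ + u₂) * z
    to-from₃ = solve-∀
    from-to₁ : ∀ n X u₁ u₂ x y → X * (n * (u₁ * x + u₂ * y)) + u₂ * (n * X * (x + - y)) ≡
               n * X * (u₁ + u₂) * x
    from-to₁ = solve-∀
    from-to₂ : ∀ n X u₁ u₂ x y → X * (n * (u₁ * x + u₂ * y)) + - u₁ * (n * X * (x + - y)) ≡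
               n * X * (u₁ + u₂) * y
    from-to₂ = solve-∀
    from-to₃ : ∀ n X u₁ u₂ z → n * (u₁ + u₂) * (X * z) ≡ n * X * (u₁ + u₂) * z
    from-to₃ = solve-∀
    expand : ∀ n u₁ u₂ D x y z → let X = - (u₁ * u₂) in
      X * (n * (u₁ * x + u₂ * y) * (n * (u₁ * x + u₂ * y))) + D * (X * z * (X * z)) +
        -1ℤ * (n * X * (x + - y) * (n * X * (x + - y))) ≡
      X * (n * n) * ((u₁ + u₂) * (u₁ * (x * x) + u₂ * (y * y))) + X * (X * D) * (z * z)
    expand = solve-∀
    collect : ∀ n X u₁ u₂ u₃ x y z →
      X * (n * n) * ((u₁ + u₂) * (u₁ * (x * x) + u₂ * (y * y))) +
        X * (n * n * (u₁ + u₂) * u₃) * (z * z) ≡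
      X * (n * n) * (u₁ + u₂) * (u₁ * (x * x) + u₂ * (y * y) + u₃ * (z * z))
    collect = solve-∀

  module _ {p : ℕ} (p-prime : Prime p) (p≢2 : p ≢ 2) where
    open PrimeModulus p-prime
    open OddPrime p-prime p≢2
    open Local p-prime
    open OddLocal p-prime p≢2
    open Split

    private
      ramified : ∀ {A B} → + p ∤ A → + p ∤ B → Decided (+ p * A , B , -1ℤ) (χ p B)
      ramified {A} {B} p∤A p∤B = cases (χ p B) refl
        where
        cases : ∀ s → χ p B ≡ s → Decided (+ p * A , B , -1ℤ) s
        cases Sign.+ χB = unitʳ⇒isotropic (+ p * A) p∤B χB
        cases Sign.- χB = nonresidue⇒anisotropic p∤A p∤B χB

      χ-neg : ∀ {A} → + p ∤ A → χ p (- A) ≡ χ p -1ℤ Sign.* χ p A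
      χ-neg {A} p∤A = trans (cong (χ p) (sym (-1*i≡-i A)))
        (χ-* { -1ℤ} {A} (λ d → p∤1 (∣m⇒∣-m d)) p∤A)

      -- Moves the largest even power of p into a square, so that only the exponents 0 and 1 remain
      -- to be treated.
      halve : ∀ k u → ∃[ i ] ((-1^ k ≡ Sign.+ × p^ k * u ≡ p^ i * p^ i * u) ⊎
                              (-1^ k ≡ Sign.- × p^ k * u ≡ p^ i * p^ i * (+ p * u)))
      halve k u with half k
      ... | inj₁ k≡ = ⌊ k /2⌋ , inj₁ (trans (cong -1^ k≡) (-1^-double ⌊ k /2⌋) ,
        cong (_* u) (trans (cong p^_ k≡) (p^-+ ⌊ k /2⌋ ⌊ k /2⌋)))
      ... | inj₂ k≡ = ⌊ k /2⌋ , inj₂ (trans (cong -1^ k≡) (cong opposite (-1^-double ⌊ k /2⌋)) ,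
        trans (cong (_* u) (trans (cong p^_ k≡) (cong (+ p *_) (p^-+ ⌊ k /2⌋ ⌊ k /2⌋))))
          (rotate (+ p) (p^ ⌊ k /2⌋ * p^ ⌊ k /2⌋) u))
        where
        rotate : ∀ a b c → a * b * c ≡ b * (a * c)
        rotate = solve-∀

      p^≢0 : ∀ i → p^ i ≢ 0ℤ
      p^≢0 i = p≢0ℤ ∘ i^n≡0⇒i≡0 (+ p) i

      unstrip : ∀ {X D A B s} i j → X ≡ p^ i * p^ i * A → D ≡ p^ j * p^ j * B →
                Decided (A , B , -1ℤ) s → Decided (X , D , -1ℤ) s
      unstrip {A = A} {B} {s} i j refl refl = transfer s (strip (p^ i) (p^ j) A B (p^≢0 i) (p^≢0 j))

      decide-split : ∀ {X D} (s : Split p X) (t : Split p D) → Decided (X , D , -1ℤ)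
        (tame (χ p -1ℤ) (-1^ (exponent s) , χ p (unit s)) (-1^ (exponent t) , χ p (unit t)))
      decide-split {X} {D} (split k A p∤A X≡) (split l B p∤B D≡) = cases (halve k A) (halve l B)
        where
        ε = χ p -1ℤ
        a = χ p A
        b = χ p B
        result : ∀ {s α β} → -1^ k ≡ α → -1^ l ≡ β → tame ε (α , a) (β , b) ≡ s →
                 Decided (X , D , -1ℤ) s → Decided (X , D , -1ℤ) (tame ε (-1^ k , a) (-1^ l , b))
        result refl refl refl = id
        cases : ∃[ i ] _ → ∃[ j ] _ → Decided (X , D , -1ℤ) (tame ε (-1^ k , a) (-1^ l , b))
        cases (i , inj₁ (k-even , A≡)) (j , inj₁ (l-even , B≡)) =
          result k-even l-even (trans (tame-unitˡ ε {a} {Sign.+} {b}) (⟨,+⟩ a))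
            (unstrip i j (trans X≡ A≡) (trans D≡ B≡) (units⇒isotropic p∤A p∤B))
        cases (i , inj₁ (k-even , A≡)) (j , inj₂ (l-odd , B≡)) =
          result k-even l-odd (trans (tame-unitˡ ε {a} {Sign.-} {b}) (⟨,-⟩ a))
            (unstrip {s = a} i j (trans X≡ A≡) (trans D≡ B≡)
              (transfer a (swap A (+ p * B)) (ramified p∤B p∤A)))
        cases (i , inj₂ (k-odd , A≡)) (j , inj₁ (l-even , B≡)) =
          result k-odd l-even (trans (tame-unitʳ ε {Sign.-} {a} {b}) (⟨,-⟩ b))
            (unstrip {s = b} i j (trans X≡ A≡) (trans D≡ B≡) (ramified p∤A p∤B))
        -- Two odd valuations: `twist` replaces p B by the unit - A B, whose character (-1 / p) (A /
        -- p) (B / p) is the tame value.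
        cases (i , inj₂ (k-odd , A≡)) (j , inj₂ (l-odd , B≡)) =
          result k-odd l-odd twisted
            (unstrip {s = χ p (- (A * B))} i j (trans X≡ A≡) (trans D≡ B≡)
              (transfer (χ p (- (A * B))) (twist (+ p) A B p≢0ℤ A≢0)
                (ramified p∤A λ d → p∤* p∤A p∤B (subst (+ p ∣_) (neg-involutive (A * B)) (∣m⇒∣-m d)))))
          where
          A≢0 : A ≢ 0ℤ
          A≢0 eq = p∤A (subst (+ p ∣_) (sym eq) (divides 0ℤ refl))
          twisted : tame ε (Sign.- , a) (Sign.- , b) ≡ χ p (- (A * B))
          twisted = trans (cong₂ (λ s t → ε Sign.* s Sign.* t) (⟨,-⟩ a) (⟨,-⟩ b))
            (trans (Sign.*-assoc ε a b) (sym (trans (χ-neg (p∤* p∤A p∤B)) (cong (ε Sign.*_) (χ-* p∤A p∤B)))))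

    decide : ∀ {X D} → X ≢ 0ℤ → D ≢ 0ℤ → Decided (X , D , -1ℤ) (T p X D)
    decide {X} {D} X≢0 D≢0 = subst (Decided (X , D , -1ℤ))
      (sym (T-cong p (local-char p-prime s) (local-char p-prime t))) (decide-split s t)
      where
      s = splitting p-prime X X≢0
      t = splitting p-prime D D≢0

-- From integer forms to conics over ℚₚ

module PadicConics where
  open Congruences hiding (_≈⟨_⟩_; _≈∎)
  open TameSymbol
  open TernaryForms
  open import Defs
  open import Data.Nat.Base as ℕ using (ℕ; zero; suc; NonZero)
  import Data.Nat.Properties as ℕ
  import Data.Nat.Divisibility as ℕ∣
  import Data.Nat.Tactic.RingSolver as ℕSolver
  open import Data.Nat.Primality using (Prime)
  open import Data.Integer.Base as ℤ hiding (suc; NonZero)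
  open import Data.Integer.Properties
  open import Data.Integer.Divisibility.Signed
  open import Data.Integer.Tactic.RingSolver using (solve-∀)
  open import Data.Rational.Unnormalised.Base as ℚ
    using (ℚᵘ; ↥_; ↧_; ↧ₙ_; _≃_; *≡*; 0ℚᵘ; 1ℚᵘ)
  import Data.Rational.Unnormalised.Properties as ℚ
  import Data.Rational.Unnormalised.Solver as ℚSolver
  open import Data.Sign.Base as Sign using (Sign)
  open import Data.Product.Base using (∃-syntax; _×_; _,_; proj₁; proj₂)
  open import Function.Base using (_∘_)
  open import Relation.Nullary using (¬_)
  open import Relation.Binary.PropositionalEquality

  fromℤ-+ : ∀ i j → fromℤ (i + j) ≃ fromℤ i ℚ.+ fromℤ j
  fromℤ-+ i j = *≡* (cong (_* 1ℤ) (sym (cong₂ _+_ (*-identityʳ i) (*-identityʳ j))))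

  fromℤ-injective : ∀ {i j} → fromℤ i ≃ fromℤ j → i ≡ j
  fromℤ-injective {i} {j} (*≡* eq) = trans (sym (*-identityʳ i)) (trans eq (*-identityʳ j))

  fromℤ-minus : ∀ i j → fromℤ i ℚ.- fromℤ j ≃ fromℤ (i - j)
  fromℤ-minus i j = ℚ.≃-sym (fromℤ-+ i (- j))

  formℚ : ℤ³ → ℚᵘ → ℚᵘ → ℚᵘ → ℚᵘ
  formℚ (A , B , C) x y z =
    fromℤ A ℚ.* (x ℚ.* x) ℚ.+ fromℤ B ℚ.* (y ℚ.* y) ℚ.+ fromℤ C ℚ.* (z ℚ.* z)

  formℚ-fromℤ : ∀ F x y z → fromℤ (form F (x , y , z)) ≃ formℚ F (fromℤ x) (fromℤ y) (fromℤ z)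
  formℚ-fromℤ (A , B , C) x y z = ℚ.≃-trans (fromℤ-+ (A * (x * x) + B * (y * y)) (C * (z * z)))
    (ℚ.+-congˡ (fromℤ (C * (z * z))) (fromℤ-+ (A * (x * x)) (B * (y * y))))

  formℚ-cong : ∀ F {x y z x′ y′ z′} → x ≃ x′ → y ≃ y′ → z ≃ z′ → formℚ F x y z ≃ formℚ F x′ y′ z′
  formℚ-cong (A , B , C) x y z = ℚ.+-cong (ℚ.+-cong (square A x) (square B y)) (square C z)
    where
    square : ∀ c {x x′} → x ≃ x′ → fromℤ c ℚ.* (x ℚ.* x) ≃ fromℤ c ℚ.* (x′ ℚ.* x′)
    square c e = ℚ.*-cong (ℚ.≃-refl {fromℤ c}) (ℚ.*-cong e e)

  formℚ-scale : ∀ F d x y z →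
    formℚ F (d ℚ.* x) (d ℚ.* y) (d ℚ.* z) ≃ d ℚ.* d ℚ.* formℚ F x y z
  formℚ-scale (A , B , C) = homogeneous (fromℤ A) (fromℤ B) (fromℤ C)
    where
    open ℚSolver.+-*-Solver
    homogeneous : ∀ A B C d x y z →
      A ℚ.* (d ℚ.* x ℚ.* (d ℚ.* x)) ℚ.+ B ℚ.* (d ℚ.* y ℚ.* (d ℚ.* y)) ℚ.+ C ℚ.* (d ℚ.* z ℚ.* (d ℚ.* z)) ≃
      d ℚ.* d ℚ.* (A ℚ.* (x ℚ.* x) ℚ.+ B ℚ.* (y ℚ.* y) ℚ.+ C ℚ.* (z ℚ.* z))
    homogeneous = solve 7 (λ A B C d x y z →
      A :* (d :* x :* (d :* x)) :+ B :* (d :* y :* (d :* y)) :+ C :* (d :* z :* (d :* z)) :=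
      d :* d :* (A :* (x :* x) :+ B :* (y :* y) :+ C :* (z :* z))) ℚ.≃-refl

  conic : ℤ → ℤ → ℚᵘ → ℚᵘ → ℚᵘ → ℚᵘ → ℚᵘ
  conic u₁ u₂ w x y z =
    z ℚ.* z ℚ.- (ℚ.- (fromℤ u₁ ℚ.* w) ℚ.* (x ℚ.* x) ℚ.+ ℚ.- (fromℤ u₂ ℚ.* w) ℚ.* (y ℚ.* y))

  -- w stands for 1 / u₃.
  module _ (u₁ u₂ u₃ : ℤ) (w : ℚᵘ) (u₃w≃1 : fromℤ u₃ ℚ.* w ≃ 1ℚᵘ) where

    conic-form : ∀ x y z → w ℚ.* formℚ (u₁ , u₂ , u₃) x y z ≃ conic u₁ u₂ w x y z
    conic-form x y z = ℚ.≃-trans (distribute (fromℤ u₁) (fromℤ u₂) (fromℤ u₃) w x y z)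
      (ℚ.+-congˡ _ (ℚ.≃-trans (ℚ.*-cong u₃w≃1 (ℚ.≃-refl {z ℚ.* z})) (ℚ.*-identityˡ (z ℚ.* z))))
      where
      open ℚSolver.+-*-Solver
      distribute : ∀ u₁ u₂ u₃ w x y z →
        w ℚ.* (u₁ ℚ.* (x ℚ.* x) ℚ.+ u₂ ℚ.* (y ℚ.* y) ℚ.+ u₃ ℚ.* (z ℚ.* z)) ≃
        u₃ ℚ.* w ℚ.* (z ℚ.* z) ℚ.- (ℚ.- (u₁ ℚ.* w) ℚ.* (x ℚ.* x) ℚ.+ ℚ.- (u₂ ℚ.* w) ℚ.* (y ℚ.* y))
      distribute = solve 7 (λ u₁ u₂ u₃ w x y z →
        w :* (u₁ :* (x :* x) :+ u₂ :* (y :* y) :+ u₃ :* (z :* z)) :=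
        u₃ :* w :* (z :* z) :- (:- (u₁ :* w) :* (x :* x) :+ :- (u₂ :* w) :* (y :* y))) ℚ.≃-refl

    form-conic : ∀ x y z → formℚ (u₁ , u₂ , u₃) x y z ≃ fromℤ u₃ ℚ.* conic u₁ u₂ w x y z
    form-conic x y z = ℚ.≃-sym (ℚ.≃-trans (ℚ.*-cong (ℚ.≃-refl {fromℤ u₃}) (ℚ.≃-sym (conic-form x y z)))
      (ℚ.≃-trans (ℚ.≃-sym (ℚ.*-assoc (fromℤ u₃) w (formℚ (u₁ , u₂ , u₃) x y z)))
        (ℚ.≃-trans (ℚ.*-cong u₃w≃1 ℚ.≃-refl) (ℚ.*-identityˡ (formℚ (u₁ , u₂ , u₃) x y z)))))

  module _ {p : ℕ} (p-prime : Prime p) where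
    open PrimeModulus p-prime
    open Local p-prime
    open Padic p p-prime using (ℚₚ; seq; ∣_∣≤p^-_; small; small-≃; small-*; bounded; p-part;
      fromℚ; 0ₚ; HasNontrivialSolution)
      renaming (_≈_ to _≈ₚ_; _*_ to _*ₚ_; _+_ to _+ₚ_; p∤1 to p∤1ℕ)

    -- X is q cleared of its denominator by p^e b, and the factor p^e accounts for e of the powers
    -- of p in X.
    ∣⇒small : ∀ {q k X e b} → ¬ p ℕ∣.∣ b → p^ (k ℕ.+ e) ∣ X →
              X * ↧ q ≡ + (p ℕ.^ e ℕ.* b) * ↥ q → ∣ q ∣≤p^- k
    ∣⇒small {q} {k} {X} {e} {b} p∤b (divides t X≡) eq = small t b p∤b
      (*-cancelˡ-≡ (p^ e) (↥ q * + b) (+ (p ℕ.^ k) * t * ↧ q) {{p^-nonZero e}} (begin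
        p^ e * (↥ q * + b)              ≡⟨ rotate (p^ e) (↥ q) (+ b) ⟩
        p^ e * + b * ↥ q                ≡⟨ cong (λ t → t * + b * ↥ q) (pos-^ p e) ⟨
        + (p ℕ.^ e) * + b * ↥ q         ≡⟨ cong (_* ↥ q) (pos-* (p ℕ.^ e) b) ⟨
        + (p ℕ.^ e ℕ.* b) * ↥ q         ≡⟨ eq ⟨
        X * ↧ q                         ≡⟨ cong (_* ↧ q) (trans X≡ (cong (t *_) (p^-+ k e))) ⟩
        t * (p^ k * p^ e) * ↧ q         ≡⟨ regroup t (p^ k) (p^ e) (↧ q) ⟩
        p^ e * (p^ k * t * ↧ q)         ≡⟨ cong (λ s → p^ e * (s * t * ↧ q)) (pos-^ p k) ⟨
        p^ e * (+ (p ℕ.^ k) * t * ↧ q)  ∎))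
      where
      open ≡-Reasoning
      rotate : ∀ a b c → a * (b * c) ≡ a * c * b
      rotate = solve-∀
      regroup : ∀ a b c d → a * (b * c) * d ≡ c * (b * a * d)
      regroup = solve-∀

    small⇒∣ : ∀ {q k X D j} → ∣ q ∣≤p^- k → X * ↧ q ≡ D * ↥ q → p^ j ∣ D → p^ (k ℕ.+ j) ∣ X
    small⇒∣ {q@record{}} {k} {X} {D} {j} (small a b p∤b eq) X≡ (divides t D≡) =
      unit-cancel (k ℕ.+ j) {+ b} (p∤b ∘ ∣⇒∣ᵤ) (divides (t * a)
        (*-cancelʳ-≡ (+ b * X) (t * a * p^ (k ℕ.+ j)) (↧ q) (begin
        + b * X * ↧ q               ≡⟨ *-assoc (+ b) X (↧ q) ⟩
        + b * (X * ↧ q)             ≡⟨ cong (+ b *_) X≡ ⟩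
        + b * (D * ↥ q)             ≡⟨ rotate (+ b) D (↥ q) ⟩
        D * (↥ q * + b)             ≡⟨ cong₂ _*_ D≡ (trans eq (cong (λ s → s * a * ↧ q) (pos-^ p k))) ⟩
        t * p^ j * (p^ k * a * ↧ q) ≡⟨ regroup t (p^ j) (p^ k) a (↧ q) ⟩
        t * a * (p^ k * p^ j) * ↧ q ≡⟨ cong (λ s → t * a * s * ↧ q) (p^-+ k j) ⟨
        t * a * p^ (k ℕ.+ j) * ↧ q  ∎)))
      where
      open ≡-Reasoning
      rotate : ∀ b d n → b * (d * n) ≡ d * (n * b)
      rotate = solve-∀
      regroup : ∀ t j k a m → t * j * (k * a * m) ≡ t * a * (k * j) * m
      regroup = solve-∀

    fromℤ-small : ∀ {k x} → p^ k ∣ x → ∣ fromℤ x ∣≤p^- k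
    fromℤ-small {k} {x} d = ∣⇒small {fromℤ x} {k} {x} {0} {1} p∤1ℕ
      (subst (λ n → p^ n ∣ x) (sym (ℕ.+-identityʳ k)) d) (*-comm x 1ℤ)

    small-fromℤ : ∀ {k x} → ∣ fromℤ x ∣≤p^- k → p^ k ∣ x
    small-fromℤ {k} {x} s = subst (λ n → p^ n ∣ x) (ℕ.+-identityʳ k)
      (small⇒∣ {fromℤ x} {k} {x} {1ℤ} {0} s (*-comm x 1ℤ) ∣-refl)

    minus-0 : ∀ q → q ℚ.- 0ℚᵘ ≃ q
    minus-0 = ℚ.+-identityʳ

    fromℤ-seq : (x : ℕ → ℤ) → (∀ k → x (suc k) ≈ x k [ p^ k ]) → ℚₚ
    fromℤ-seq x step = record
      { seq    = fromℤ ∘ x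
      ; cauchy = λ k → k , λ i j k≤i k≤j → small-≃ (ℚ.≃-sym (fromℤ-minus (x i) (x j)))
          (fromℤ-small (difference (≈-trans (from-level k k≤i) (≈-sym (from-level k k≤j)))))
      }
      where
      climb : ∀ k o → x (k ℕ.+ o) ≈ x k [ p^ k ]
      climb k zero    = ≈-reflexive (cong x (ℕ.+-identityʳ k))
      climb k (suc o) = ≈-trans (≈-reflexive (cong x (ℕ.+-suc k o)))
        (≈-trans (congruent (∣-trans (p^-∣ (ℕ.m≤m+n k o)) (difference (step (k ℕ.+ o))))) (climb k o))
      from-level : ∀ {i} k → k ℕ.≤ i → x i ≈ x k [ p^ k ]
      from-level k k≤i with o , refl ← ℕ.m≤n⇒∃[o]m+o≡n k≤i = climb k o

    module _ (u₁ u₂ u₃ : ℤ) (w : ℚᵘ) (u₃w≃1 : fromℤ u₃ ℚ.* w ≃ 1ℚᵘ) where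
      private
        F : ℤ³
        F = u₁ , u₂ , u₃
        a b : ℚₚ
        a = fromℚ (ℚ.- (fromℤ u₁ ℚ.* w))
        b = fromℚ (ℚ.- (fromℤ u₂ ℚ.* w))

      isotropic⇒solvable : Isotropic F → HasNontrivialSolution a b
      isotropic⇒solvable iso = x , y , z , nonzero , zero-of-conic
        where
        open Isotropic iso
        x = fromℤ-seq (λ k → proj₁ (zeros k)) (λ k → proj₁ (cauchy k))
        y = fromℤ-seq (λ k → proj₁ (proj₂ (zeros k))) (λ k → proj₁ (proj₂ (cauchy k)))
        z = fromℤ-seq (λ k → proj₂ (proj₂ (zeros k))) (λ k → proj₂ (proj₂ (cauchy k)))
        nonzero : ¬ (x ≈ₚ 0ₚ × y ≈ₚ 0ₚ × z ≈ₚ 0ₚ)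
        nonzero (x≈0 , y≈0 , z≈0) =
          let M , f = x≈0 level
              N , g = y≈0 level
              O , h = z≈0 level
              i     = level ℕ.+ (M ℕ.+ (N ℕ.+ O))
              M≤i   = ℕ.m≤n⇒m≤o+n level (ℕ.m≤m+n M (N ℕ.+ O))
              N≤i   = ℕ.m≤n⇒m≤o+n level (ℕ.m≤n⇒m≤o+n M (ℕ.m≤m+n N O))
              O≤i   = ℕ.m≤n⇒m≤o+n level (ℕ.m≤n⇒m≤o+n M (ℕ.m≤n+m O N))
          in nontrivial i (ℕ.m≤m+n level _)
               ( small-fromℤ (small-≃ (minus-0 _) (f i M≤i))
               , small-fromℤ (small-≃ (minus-0 _) (g i N≤i))
               , small-fromℤ (small-≃ (minus-0 _) (h i O≤i)))
        zero-of-conic : z *ₚ z ≈ₚ a *ₚ (x *ₚ x) +ₚ b *ₚ (y *ₚ y)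
        zero-of-conic k =
          -- w = 1 / u₃ may have p^m in its denominator, so the form has to vanish modulo p^(m + k),
          -- which it does from index m + k on.
          let m , w-bounded = bounded w in
          m ℕ.+ k , λ i m+k≤i → small-≃
            (w-form (zeros i))
            (small-* m {k} {w} {fromℤ (form F (zeros i))} w-bounded
              (fromℤ-small {m ℕ.+ k} {form F (zeros i)} (∣-trans (p^-∣ m+k≤i) (vanishing i))))
          where
          w-form : ∀ v → let (x , y , z) = v in
                   w ℚ.* fromℤ (form F v) ≃ conic u₁ u₂ w (fromℤ x) (fromℤ y) (fromℤ z)
          w-form (x , y , z) = ℚ.≃-trans
            (ℚ.*-cong (ℚ.≃-refl {w}) (formℚ-fromℤ F x y z))
            (conic-form u₁ u₂ u₃ w u₃w≃1 (fromℤ x) (fromℤ y) (fromℤ z))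

      -- Clearing denominators by d multiplies the form by d², which is where the
      -- rate 2k in the definition of Anisotropic is needed.
      anisotropic⇒unsolvable : Anisotropic F → ¬ HasNontrivialSolution a b
      anisotropic⇒unsolvable (c , aniso) (x , y , z , nonzero , zero-of-conic) = nonzero
        ( (λ k → let N , f = all-small k in N , λ i N≤i → small-≃ (ℚ.≃-sym (minus-0 _)) (proj₁ (f i N≤i)))
        , (λ k → let N , f = all-small k in N , λ i N≤i → small-≃ (ℚ.≃-sym (minus-0 _)) (proj₁ (proj₂ (f i N≤i))))
        , (λ k → let N , f = all-small k in N , λ i N≤i → small-≃ (ℚ.≃-sym (minus-0 _)) (proj₂ (proj₂ (f i N≤i)))))
        where
        at : ∀ k x y z → ∣ conic u₁ u₂ w x y z ∣≤p^- (c ℕ.+ (k ℕ.+ k)) →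
             ∣ x ∣≤p^- k × ∣ y ∣≤p^- k × ∣ z ∣≤p^- k
        at k x@record{} y@record{} z@record{} conic-small =
          -- (X , Y , Z) is (x , y , z) times the common denominator D, of valuation e. The form at
          -- it is D² u₃ times the conic, so the exponent grows by 2e; dividing by D afterwards
          -- takes k + e back to k.
          let dX , dY , dZ = aniso (k ℕ.+ e) (X , Y , Z) div in
          clear x dX (X-eq (↥ x) (↧ x) (↧ y) (↧ z)) ,
          clear y dY (Y-eq (↥ y) (↧ x) (↧ y) (↧ z)) ,
          clear z dZ (Z-eq (↥ z) (↧ x) (↧ y) (↧ z))
          where
          d = ↧ₙ x ℕ.* ↧ₙ y ℕ.* ↧ₙ z
          part = p-part d
          e    = proj₁ part
          unit = proj₁ (proj₂ part)
          p∤unit = proj₁ (proj₂ (proj₂ part))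
          d≡   = proj₂ (proj₂ (proj₂ part))
          D    = ↧ x * ↧ y * ↧ z
          +d≡D : + d ≡ D
          +d≡D = trans (pos-* (↧ₙ x ℕ.* ↧ₙ y) (↧ₙ z)) (cong (_* ↧ z) (pos-* (↧ₙ x) (↧ₙ y)))
          X = ↥ x * (↧ y * ↧ z)
          Y = ↥ y * (↧ x * ↧ z)
          Z = ↥ z * (↧ x * ↧ y)
          X-eq : ∀ n m₁ m₂ m₃ → n * (m₂ * m₃) * m₁ ≡ m₁ * m₂ * m₃ * n
          X-eq = solve-∀
          Y-eq : ∀ n m₁ m₂ m₃ → n * (m₁ * m₃) * m₂ ≡ m₁ * m₂ * m₃ * n
          Y-eq = solve-∀
          Z-eq : ∀ n m₁ m₂ m₃ → n * (m₁ * m₂) * m₃ ≡ m₁ * m₂ * m₃ * n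
          Z-eq = solve-∀
          clear : ∀ q {X} → p^ (k ℕ.+ e) ∣ X → X * ↧ q ≡ D * ↥ q → ∣ q ∣≤p^- k
          clear q dvd eq = ∣⇒small {q} p∤unit dvd
            (trans eq (cong (_* ↥ q) (trans (sym +d≡D) (cong +_ d≡))))
          cleared : ∀ q {X} → X * ↧ q ≡ D * ↥ q → fromℤ X ≃ fromℤ D ℚ.* q
          cleared q@record{} {X} eq = *≡* (trans (cong (X *_) (*-identityˡ (↧ q)))
            (trans eq (sym (*-identityʳ (D * ↥ q)))))
          uncleared : ∀ q {X E} → fromℤ X ≃ fromℤ E ℚ.* q → X * ↧ q ≡ E * ↥ q
          uncleared q@record{} {X} {E} (*≡* eq) = trans (cong (X *_) (sym (*-identityˡ (↧ q))))
            (trans eq (*-identityʳ (E * ↥ q)))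
          p^e∣D : p^ e ∣ D
          p^e∣D = divides (+ unit) (trans (sym +d≡D) (trans (cong +_ d≡)
            (trans (pos-* (p ℕ.^ e) unit) (trans (cong (_* + unit) (pos-^ p e)) (*-comm (p^ e) (+ unit))))))
          p^2e∣D² : p^ (e ℕ.+ e) ∣ D * D
          p^2e∣D² = subst (_∣ D * D) (sym (p^-+ e e))
            (∣-trans (*-monoʳ-∣ (p^ e) p^e∣D) (*-monoˡ-∣ D p^e∣D))
          regroup : ∀ c k e → c ℕ.+ (k ℕ.+ k) ℕ.+ (e ℕ.+ e) ≡ c ℕ.+ ((k ℕ.+ e) ℕ.+ (k ℕ.+ e))
          regroup = ℕSolver.solve-∀
          form-eq : fromℤ (form F (X , Y , Z)) ≃ fromℤ (D * D * u₃) ℚ.* conic u₁ u₂ w x y z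
          form-eq = ℚ.≃-trans (formℚ-fromℤ F X Y Z) (ℚ.≃-trans
            (formℚ-cong F {fromℤ X} {fromℤ Y} {fromℤ Z} {fromℤ D ℚ.* x} {fromℤ D ℚ.* y} {fromℤ D ℚ.* z}
              (cleared x (X-eq (↥ x) (↧ x) (↧ y) (↧ z)))
              (cleared y (Y-eq (↥ y) (↧ x) (↧ y) (↧ z))) (cleared z (Z-eq (↥ z) (↧ x) (↧ y) (↧ z))))
            (ℚ.≃-trans (formℚ-scale F (fromℤ D) x y z)
            (ℚ.≃-trans (ℚ.*-cong (ℚ.≃-refl {fromℤ D ℚ.* fromℤ D}) (form-conic u₁ u₂ u₃ w u₃w≃1 x y z))
              (ℚ.≃-sym (ℚ.*-assoc (fromℤ D ℚ.* fromℤ D) (fromℤ u₃) (conic u₁ u₂ w x y z))))))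
          div : p^ (c ℕ.+ ((k ℕ.+ e) ℕ.+ (k ℕ.+ e))) ∣ form F (X , Y , Z)
          div = subst (λ n → p^ n ∣ form F (X , Y , Z)) (regroup c k e)
            (small⇒∣ {conic u₁ u₂ w x y z} {c ℕ.+ (k ℕ.+ k)} {D = D * D * u₃} {e ℕ.+ e}
              conic-small (uncleared (conic u₁ u₂ w x y z) {form F (X , Y , Z)} {D * D * u₃} form-eq) (∣m⇒∣m*n u₃ p^2e∣D²))
        all-small : ∀ k → ∃[ N ] ∀ i → N ℕ.≤ i →
                    ∣ seq x i ∣≤p^- k × ∣ seq y i ∣≤p^- k × ∣ seq z i ∣≤p^- k
        all-small k = let N , f = zero-of-conic (c ℕ.+ (k ℕ.+ k)) in
          N , λ i N≤i → at k (seq x i) (seq y i) (seq z i) (f i N≤i)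

    Decided⇒HilbertSymbol : ∀ u₁ u₂ u₃ w → fromℤ u₃ ℚ.* w ≃ 1ℚᵘ → ∀ s → Decided (u₁ , u₂ , u₃) s →
      Padic.HilbertSymbol p p-prime
        (fromℚ (ℚ.- (fromℤ u₁ ℚ.* w))) (fromℚ (ℚ.- (fromℤ u₂ ℚ.* w))) s
    Decided⇒HilbertSymbol u₁ u₂ u₃ w u₃w≃1 Sign.+ iso =
      Padic.solvable (isotropic⇒solvable u₁ u₂ u₃ w u₃w≃1 iso)
    Decided⇒HilbertSymbol u₁ u₂ u₃ w u₃w≃1 Sign.- aniso =
      Padic.unsolvable (anisotropic⇒unsolvable u₁ u₂ u₃ w u₃w≃1 aniso)

  clear-denominators : ∀ n .{{_ : NonZero n}} u₁ u₂ u₃ {w₁ w₂ w₃} →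
    fromℤ u₁ ℚ.* w₁ ≃ 1ℚᵘ → fromℤ u₂ ℚ.* w₂ ≃ 1ℚᵘ → fromℤ u₃ ℚ.* w₃ ≃ 1ℚᵘ →
    + 4 ℚ./ n ≃ w₁ ℚ.+ w₂ ℚ.+ w₃ →
    + n * (u₂ * u₃ + u₁ * u₃ + u₁ * u₂) ≡ + 4 * (u₁ * u₂ * u₃)
  clear-denominators n@(suc _) u₁ u₂ u₃ {w₁} {w₂} {w₃} e₁ e₂ e₃ eq = fromℤ-injective (begin
    fromℤ (+ n * (u₂ * u₃ + u₁ * u₃ + u₁ * u₂))
      ≈⟨ ℚ.*-cong (ℚ.≃-refl {N}) (ℚ.≃-trans (fromℤ-+ (u₂ * u₃ + u₁ * u₃) (u₁ * u₂))
           (ℚ.+-congˡ (U₁ ℚ.* U₂) (fromℤ-+ (u₂ * u₃) (u₁ * u₃)))) ⟩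
    N ℚ.* (U₂ ℚ.* U₃ ℚ.+ U₁ ℚ.* U₃ ℚ.+ U₁ ℚ.* U₂)
      ≈⟨ ℚ.*-cong (ℚ.≃-refl {N}) (ℚ.+-cong (ℚ.+-cong (one e₁ (U₂ ℚ.* U₃)) (one e₂ (U₁ ℚ.* U₃)))
           (one e₃ (U₁ ℚ.* U₂))) ⟩
    N ℚ.* (U₁ ℚ.* w₁ ℚ.* (U₂ ℚ.* U₃) ℚ.+ U₂ ℚ.* w₂ ℚ.* (U₁ ℚ.* U₃) ℚ.+ U₃ ℚ.* w₃ ℚ.* (U₁ ℚ.* U₂))
      ≈⟨ factor N U₁ U₂ U₃ w₁ w₂ w₃ ⟩
    U₁ ℚ.* U₂ ℚ.* U₃ ℚ.* (N ℚ.* (w₁ ℚ.+ w₂ ℚ.+ w₃))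
      ≈⟨ ℚ.*-cong (ℚ.≃-refl {U₁ ℚ.* U₂ ℚ.* U₃}) (ℚ.≃-trans
           (ℚ.*-cong (ℚ.≃-refl {N}) (ℚ.≃-sym eq)) cancel) ⟩
    U₁ ℚ.* U₂ ℚ.* U₃ ℚ.* fromℤ (+ 4)
      ≈⟨ ℚ.*-comm (U₁ ℚ.* U₂ ℚ.* U₃) (fromℤ (+ 4)) ⟩
    fromℤ (+ 4 * (u₁ * u₂ * u₃)) ∎)
    where
    open ℚ.≃-Reasoning
    open ℚSolver.+-*-Solver
    N  = fromℤ (+ n)
    U₁ = fromℤ u₁
    U₂ = fromℤ u₂
    U₃ = fromℤ u₃
    one : ∀ {q} → q ≃ 1ℚᵘ → ∀ r → r ≃ q ℚ.* r
    one {q} q≃1 r = ℚ.≃-trans (ℚ.≃-sym (ℚ.*-identityˡ r)) (ℚ.*-cong (ℚ.≃-sym q≃1) (ℚ.≃-refl {r}))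
    cancel : N ℚ.* (+ 4 ℚ./ n) ≃ fromℤ (+ 4)
    cancel = *≡* (trans (*-identityʳ (+ n * + 4)) (trans (*-comm (+ n) (+ 4))
      (cong (+ 4 *_) (sym (*-identityˡ (+ n))))))
    factor : ∀ N U₁ U₂ U₃ w₁ w₂ w₃ →
      N ℚ.* (U₁ ℚ.* w₁ ℚ.* (U₂ ℚ.* U₃) ℚ.+ U₂ ℚ.* w₂ ℚ.* (U₁ ℚ.* U₃) ℚ.+ U₃ ℚ.* w₃ ℚ.* (U₁ ℚ.* U₂)) ≃
      U₁ ℚ.* U₂ ℚ.* U₃ ℚ.* (N ℚ.* (w₁ ℚ.+ w₂ ℚ.+ w₃))
    factor = solve 7 (λ N U₁ U₂ U₃ w₁ w₂ w₃ →
      N :* (U₁ :* w₁ :* (U₂ :* U₃) :+ U₂ :* w₂ :* (U₁ :* U₃) :+ U₃ :* w₃ :* (U₁ :* U₂)) :=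
      U₁ :* U₂ :* U₃ :* (N :* (w₁ :+ w₂ :+ w₃))) ℚ.≃-refl

-- The Hilbert symbols at the primes dividing n

open TameSymbol
open ErdősStrausEquation
open TernaryForms
open Classification
open PadicConics
import Data.Rational.Unnormalised.Properties as ℚ
open import Data.Product.Base using (_,_)
open import Function.Base using (_∘_)
open import Relation.Binary.PropositionalEquality using (_≢_; subst; cong)
import Data.Integer.Divisibility.Signed as ℤ∣

open import Defs
open import Data.Nat.Base as ℕ using (ℕ)
open import Data.Nat.Divisibility using (_∣_; _∤_)
open import Data.Nat.Primality using (Prime)
open import Data.Integer.Base as ℤ using (ℤ; +_; 0ℤ)
open import Data.Rational.Unnormalised.Base using (_/_; _≃_; 1/_; _÷_; _+_; -_)
open import Data.Sign.Base as Sign using (Sign)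
open import Data.Product.Base using (∃-syntax; _×_)
open import Data.Sum.Base using (_⊎_)
open import Relation.Binary.PropositionalEquality using (_≡_)

theorem1p5 : (n : ℕ) .{{_ : ℕ.NonZero n}} → 2 ∤ n →
    (u₁ u₂ u₃ : ℤ)
    .{{_ : ℤ.NonZero u₁}} .{{_ : ℤ.NonZero u₂}} .{{_ : ℤ.NonZero u₃}} →
    + 4 / n ≃ 1/ fromℤ u₁ + 1/ fromℤ u₂ + 1/ fromℤ u₃ →
    (u₁ ℤ.< 0ℤ ⊎ u₂ ℤ.< 0ℤ ⊎ u₃ ℤ.< 0ℤ) →
    ∃[ h ]
    ((p : ℕ) (p-prime : Prime p) → p ∣ n →
    Padic.HilbertSymbol p p-prime
    (Padic.fromℚ p p-prime (- (fromℤ u₁ ÷ fromℤ u₃)))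
    (Padic.fromℚ p p-prime (- (fromℤ u₂ ÷ fromℤ u₃)))
    (h p))
    × ∏[ primeDivisors n ] h ≡ Sign.+
theorem1p5 n 2∤n u₁ u₂ u₃ equation negative =
  -- The explicit sign serves as h; `symbol` identifies it with the Hilbert symbol at each p ∣ n,
  -- where p ≠ 2 because n is odd.
  (λ p → T p X D) , symbol , product-formula negative
  where
  nonZero⇒≢0 : ∀ u .{{_ : ℤ.NonZero u}} → u ≢ 0ℤ
  nonZero⇒≢0 u u≡0 = ℕ.≢-nonZero⁻¹ ℤ.∣ u ∣ (cong ℤ.∣_∣ u≡0)
  open ErdősStraus n (2∤n ∘ ℤ∣.∣⇒∣ᵤ) u₁ u₂ u₃
    (nonZero⇒≢0 u₁) (nonZero⇒≢0 u₂) (nonZero⇒≢0 u₃)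
    (clear-denominators n u₁ u₂ u₃ {1/ fromℤ u₁} {1/ fromℤ u₂} {1/ fromℤ u₃}
      (ℚ.*-inverseʳ (fromℤ u₁)) (ℚ.*-inverseʳ (fromℤ u₂))
      (ℚ.*-inverseʳ (fromℤ u₃)) equation)
  symbol : (p : ℕ) (p-prime : Prime p) → p ∣ n →
    Padic.HilbertSymbol p p-prime
    (Padic.fromℚ p p-prime (- (fromℤ u₁ ÷ fromℤ u₃)))
    (Padic.fromℚ p p-prime (- (fromℤ u₂ ÷ fromℤ u₃)))
    (T p X D)
  symbol p p-prime p∣n = Decided⇒HilbertSymbol p-prime u₁ u₂ u₃ (1/ fromℤ u₃)
    (ℚ.*-inverseʳ (fromℤ u₃)) (T p X D)
    (Local.transfer p-prime (T p X D) (diagonalise (+ n) u₁ u₂ u₃ D n≢0 X≢0 u₁+u₂≢0 XD≡)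
      (decide p-prime (λ p≡2 → 2∤n (subst (_∣ n) p≡2 p∣n)) X≢0 D≢0))
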